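{- Let $r$ be a positive integer and $p$ a prime. Suppose $f(x)=a_dx^d+\dots+a_0\in\mathbb{Q}[x]$ (with $a_d\neq 0$) is not $p^r$-pure and $d>r$. Then $f$ is eventually $p^r$-pure if and only if the following conditions hold: (i) $d=p^m$ for some $m\ge 1$; (ii) $\nu_p(a_d)=\nu_p(a_0)=0$ and $\nu_p(a_i)\ge 1$ for all $1\le i\le d-1$ (i.e. $f(x)\equiv a_dx^d+a_0 \pmod p$); (iii) $f(x+c)$ is $p^r$-pure for some $c\in\mathbb{Q}$. Moreover, the least integer $n>1$ such that $f^n$ is $p^r$-pure is $n=p$ if $a_d\equiv 1\pmod p$, and $n=\operatorname{ord}_p(a_d)$ otherwise.
   Context: $\nu_p$ denotes the $p$-adic valuation on $\mathbb{Q}$ (with $\nu_p(0)=\infty$). A polynomial $g(x)=b_ex^e+\dots+b_0\in\mathbb{Q}[x]$ of degree $e$ is $p^r$-pure if $\nu_p(b_e)=0$, $\nu_p(b_0)=r$, and $\frac{\nu_p(b_i)}{e-i}\ge\frac{r}{e}$ for all $1\le i\le e-1$. $f^n$ denotes the $n$-fold composition of $f$. A polynomial $f$ is eventually $p^r$-pure if $f^n$ is $p^r$-pure for some $n\ge1$. For $a\in\mathbb{Q}$ with $\nu_p(a)=0$, $\operatorname{ord}_p(a)$ is the multiplicative order of $a$ modulo $p$. -}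

module Defs where

open import Data.Nat as ℕ using (ℕ; zero; suc; _≤_; _<_)
import Data.Nat.DivMod as ℕD
open import Data.Nat.Divisibility using (_∣?_)
open import Data.Integer as ℤ using (ℤ; +_)
open import Data.Rational as ℚ using (ℚ; 0ℚ; 1ℚ; _+_; _*_; _-_)
open import Data.List using (List; []; _∷_; foldr)
open import Data.Product using (Σ; _×_)
open import Data.Unit using (⊤)
open import Relation.Nullary using (¬_; yes; no)
open import Relation.Binary.PropositionalEquality using (_≡_; _≢_)

-- ν_p on positive naturals, with fuel (fuel = n suffices since ν_p(n) ≤ n).
vNat : ℕ → ℕ → ℕ → ℕ
vNat zero    p       n = 0
vNat (suc k) zero    n = 0
vNat (suc k) (suc q) zero = 0
vNat (suc k) (suc q) (suc m) with suc q ∣? suc m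
... | yes _ = suc (vNat k (suc q) (ℕD._/_ (suc m) (suc q)))
... | no  _ = 0

vN : ℕ → ℕ → ℕ
vN p n = vNat n p n

data ℤ∞ : Set where
  ∞   : ℤ∞
  fin : ℤ → ℤ∞

ν : ℕ → ℚ → ℤ∞
ν p q with ℤ.∣ ℚ.numerator q ∣
... | zero  = ∞
... | suc k = fin (vN p (suc k) ℤ.⊖ vN p (ℚ.denominatorℕ q))

ValAtLeast : ℤ∞ → ℤ → Set
ValAtLeast ∞       k = ⊤
ValAtLeast (fin v) k = k ℤ.≤ v

CongMod : ℕ → ℚ → ℚ → Set
CongMod p a b = ValAtLeast (ν p (a - b)) (+ 1)

powQ : ℚ → ℕ → ℚ
powQ a zero    = 1ℚ
powQ a (suc n) = a * powQ a n

IsOrd : ℕ → ℚ → ℕ → Set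
IsOrd p a k = (1 ≤ k) × CongMod p (powQ a k) 1ℚ
            × (∀ j → 1 ≤ j → j < k → ¬ CongMod p (powQ a j) 1ℚ)

-- Polynomials over ℚ as coefficient lists, constant term first

Poly : Set
Poly = List ℚ

coeff : Poly → ℕ → ℚ
coeff []       i       = 0ℚ
coeff (a ∷ f)  zero    = a
coeff (a ∷ f)  (suc i) = coeff f i

addP : Poly → Poly → Poly
addP []      g       = g
addP (a ∷ f) []      = a ∷ f
addP (a ∷ f) (b ∷ g) = (a + b) ∷ addP f g

scaleP : ℚ → Poly → Poly
scaleP c []      = []
scaleP c (a ∷ f) = (c * a) ∷ scaleP c f

mulP : Poly → Poly → Poly
mulP []      g = []
mulP (a ∷ f) g = addP (scaleP a g) (0ℚ ∷ mulP f g)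

compose : Poly → Poly → Poly
compose f g = foldr (λ a acc → addP (a ∷ []) (mulP g acc)) [] f

iter : ℕ → Poly → Poly
iter zero    f = 0ℚ ∷ 1ℚ ∷ []
iter (suc n) f = compose f (iter n f)

xPlus : ℚ → Poly
xPlus c = c ∷ 1ℚ ∷ []

HasDegree : Poly → ℕ → Set
HasDegree g e = (coeff g e ≢ 0ℚ) × (∀ i → e < i → coeff g i ≡ 0ℚ)

-- ν/(e-i) ≥ r/e, i.e. ν·e ≥ r·(e-i)  (true when ν = ∞)
SlopeOK : ℤ∞ → ℕ → ℕ → ℕ → Set
SlopeOK ∞       r e i = ⊤
SlopeOK (fin v) r e i = + (r ℕ.* (e ℕ.∸ i)) ℤ.≤ v ℤ.* (+ e)

Pure : ℕ → ℕ → Poly → Set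
Pure p r g = Σ ℕ λ e → HasDegree g e
  × (ν p (coeff g e) ≡ fin (+ 0))
  × (ν p (coeff g 0) ≡ fin (+ r))
  × (∀ i → 1 ≤ i → i < e → SlopeOK (ν p (coeff g i)) r e i)

EventuallyPure : ℕ → ℕ → Poly → Set
EventuallyPure p r f = Σ ℕ λ n → (1 ≤ n) × Pure p r (iter n f)

LeastPureAbove1 : ℕ → ℕ → Poly → ℕ → Set
LeastPureAbove1 p r f n = (1 < n) × Pure p r (iter n f)
  × (∀ m → 1 < m → m < n → ¬ Pure p r (iter m f))

{-# OPTIONS --safe #-}
module Submission where

-- Give p the weight N and x the weight s, and filter polynomials by the resulting Gauss valuation. Composition respects these
-- filtrations, and initial forms that are monomials compose. Different weights give degrees, the p-integrality of f
-- and the reduction f ≡ a x^d + b mod p from that of an iterate, and the fact that f(g(x)) is p^r-pure exactly when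
-- f(x + g(0)) is, whenever g ≡ u x^t + g(0) mod p; the last uses r < d.
-- If f^n is pure, then f(x + f(0)) also reduces to a monomial plus a constant; when p ∤ f(0) this forces p ∣ C(d,i)
-- for 0 < i < d, so d is a power of p, and when p ∣ f(0) it would make f itself pure.
-- Conversely, by Frobenius and Fermat, f acts modulo p as x ↦ a x + b, so f^n(0) ≡ b (1 + a + ... + a^(n-1)), and f^n is
-- pure exactly when this vanishes modulo p.

open import Defs
open import Data.Nat as ℕ using (ℕ; zero; suc; _≤_; _<_; _^_; z≤n; s≤s; NonZero)
import Data.Nat.Properties as ℕP
import Data.Nat.DivMod as ℕD
open import Data.Nat.Divisibility using (_∣_; _∣?_; divides)
import Data.Nat.Divisibility as ∣P
import Data.Nat.Coprimality as Coprime
open import Data.Nat.Primality using (Prime; euclidsLemma; prime⇒nonZero; prime⇒nonTrivial)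
open import Data.Integer as ℤ using (ℤ; +_; -[1+_]; _⊖_)
import Data.Integer.Properties as ℤP
open import Data.Integer.Tactic.RingSolver using () renaming (solve-∀ to solveℤ)
open import Data.Nat.Tactic.RingSolver using () renaming (solve-∀ to solveℕ)
open import Data.Rational as ℚ using (ℚ; 0ℚ; 1ℚ; _+_; _*_; _-_; -_; ↥_; ↧_; ↧ₙ_; mkℚ)
import Data.Rational.Properties as ℚP
import Data.Rational.Unnormalised as ℚᵘ
import Data.Rational.Unnormalised.Properties as ℚᵘP
open import Data.List using ([]; _∷_)
open import Data.Product using (Σ; _×_; _,_; proj₁; proj₂; ∃)
open import Data.Sum using (_⊎_; inj₁; inj₂)
open import Data.Unit using (tt)
open import Relation.Nullary using (¬_; Dec; yes; no; contradiction)
open import Relation.Binary.PropositionalEquality using (_≡_; _≢_; refl; sym; trans; cong; cong₂; subst; subst₂; module ≡-Reasoning)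
open import Data.Maybe using (Maybe; just; nothing)
open import Relation.Nullary.Decidable using (dec⇒maybe; ¬?; decidable-stable)
open import Algebra using (CommutativeRing)
open import Tactic.RingSolver using (solve-∀)
open import Tactic.RingSolver.Core.AlmostCommutativeRing using (AlmostCommutativeRing; fromCommutativeRing)
open import Level using (0ℓ)
import Relation.Binary.Reasoning.Setoid as SetoidReasoning
open import Relation.Binary using (Setoid; IsEquivalence; tri<; tri≈; tri>)
open import Data.Nat.Combinatorics using (_C_; k>n⇒nCk≡0; nCn≡1; nC1≡n; nCk≡nC[n∸k]; nCk+nC[k+1]≡[n+1]C[k+1])

-- The slopes r/e are fractions. Giving p the weight e and x the weight r turns the slope condition
-- into one integral lower bound for a Gauss valuation. The hypothesis r < d matters because p then
-- weighs d and x only r: adding a multiple of p to x leaves its initial form alone, so purity of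
-- f(x + c) depends only on c modulo p. For the same reason p cannot divide f(0) when f^n is pure
-- and f is not: 0 would be fixed modulo p, and c = f^(n-1)(0) could be moved back to 0. Reduction
-- modulo p has no meaning before f is known to be p-integral, and nothing in the hypotheses says
-- so. Integrality is extracted from an iterate: a worst coefficient of f, suitably weighted, would
-- reappear as a power in f^n with its denominator intact. Congruences are bounds on differences in
-- ℚ and no residue field is formed, so Fermat's theorem is needed for p-integral fractions and not
-- only for integers.

fin-injective : ∀ {u v} → fin u ≡ fin v → u ≡ v
fin-injective refl = refl

-- The comparisons of weights are polynomial inequalities. Naming the nonnegative difference `k`
-- leaves an identity for the ring solver.
≤-by : ∀ {i j} k → + 0 ℤ.≤ k → j ≡ i ℤ.+ k → i ℤ.≤ j
≤-by {i} {j} k 0≤k eq = subst (i ℤ.≤_) (sym eq) (subst (ℤ._≤ i ℤ.+ k) (ℤP.+-identityʳ i) (ℤP.+-monoʳ-≤ i 0≤k))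

0≤-+ : ∀ {i j} → + 0 ℤ.≤ i → + 0 ℤ.≤ j → + 0 ℤ.≤ i ℤ.+ j
0≤-+ = ℤP.+-mono-≤

0≤-* : ∀ {i j} → + 0 ℤ.≤ i → + 0 ℤ.≤ j → + 0 ℤ.≤ i ℤ.* j
0≤-* {+ m} {+ n} _ _ = subst (+ 0 ℤ.≤_) (ℤP.pos-* m n) (ℤ.+≤+ z≤n)

0≤pos : ∀ {n} → + 0 ℤ.≤ + n
0≤pos = ℤ.+≤+ z≤n

i+1≰i : ∀ i → ¬ i ℤ.+ + 1 ℤ.≤ i
i+1≰i i le = ℤP.<-irrefl refl (ℤP.suc[i]≤j⇒i<j (subst (ℤ._≤ i) (ℤP.+-comm i (+ 1)) le))

*-cancelˡ-<-nonNeg : ∀ n {i j} → + n ℤ.* i ℤ.+ + 1 ℤ.≤ + n ℤ.* j → i ℤ.+ + 1 ℤ.≤ j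
*-cancelˡ-<-nonNeg n {i} {j} le with j ℤP.≤? i
... | yes j≤i = contradiction (ℤP.≤-trans le (ℤP.*-monoˡ-≤-nonNeg (+ n) j≤i)) (i+1≰i (+ n ℤ.* i))
... | no  j≰i = subst (ℤ._≤ j) (ℤP.+-comm (+ 1) i) (ℤP.i<j⇒suc[i]≤j (ℤP.≰⇒> j≰i))

pos-∣ : ∀ m n {i} → + m ℤ.* i ≡ + n → m ∣ n
pos-∣ m n {i} eq = divides ℤ.∣ i ∣ (trans (sym (cong ℤ.∣_∣ eq)) (trans (ℤP.abs-* (+ m) i) (ℕP.*-comm m ℤ.∣ i ∣)))

-- The p-adic valuation on ℚ

module Valuation (p : ℕ) (p-prime : Prime p) where

  instance
    p≢0 : NonZero p
    p≢0 = prime⇒nonZero p-prime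

  p>1 : 1 < p
  p>1 = ℕ.nonTrivial⇒n>1 p {{prime⇒nonTrivial p-prime}}

  p∤1 : ¬ p ∣ 1
  p∤1 p∣1 = ℕP.<⇒≱ p>1 (∣P.∣⇒≤ p∣1)

  ∤-* : ∀ {a b} → ¬ p ∣ a → ¬ p ∣ b → ¬ p ∣ a ℕ.* b
  ∤-* {a} {b} ∤a ∤b ∣ab with euclidsLemma a b p-prime ∣ab
  ... | inj₁ ∣a = ∤a ∣a
  ... | inj₂ ∣b = ∤b ∣b

  ∤⇒≢0 : ∀ {a} → ¬ p ∣ a → NonZero a
  ∤⇒≢0 {zero}  ∤0 = contradiction (p ∣P.∣0) ∤0
  ∤⇒≢0 {suc _} _  = _

  p^*-injective : ∀ i j {a b} → ¬ p ∣ a → ¬ p ∣ b → p ^ i ℕ.* a ≡ p ^ j ℕ.* b → i ≡ j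
  p^*-injective zero    zero    ∤a ∤b eq = refl
  p^*-injective zero    (suc j) {a} {b} ∤a ∤b eq = contradiction
    (divides (p ^ j ℕ.* b) (trans (sym (ℕP.*-identityˡ a)) (trans eq (trans (ℕP.*-assoc p (p ^ j) b) (ℕP.*-comm p _))))) ∤a
  p^*-injective (suc i) zero    {a} {b} ∤a ∤b eq = contradiction
    (divides (p ^ i ℕ.* a) (trans (sym (ℕP.*-identityˡ b)) (trans (sym eq) (trans (ℕP.*-assoc p (p ^ i) a) (ℕP.*-comm p _))))) ∤b
  p^*-injective (suc i) (suc j) {a} {b} ∤a ∤b eq = cong suc (p^*-injective i j ∤a ∤b
    (ℕP.*-cancelˡ-≡ _ _ p (trans (sym (ℕP.*-assoc p (p ^ i) a)) (trans eq (ℕP.*-assoc p (p ^ j) b)))))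

  -- The argument `q` exposes p as a successor, the form on which `vNat` computes. The fuel suffices
  -- because n/p < n.
  vNat-spec : ∀ k q n → p ≡ suc q → 1 ≤ n → n ≤ k →
    ∃ λ a → n ≡ p ^ vNat k p n ℕ.* a × ¬ p ∣ a
  vNat-spec zero    q zero    refl () n≤k
  vNat-spec zero    q (suc m) refl 1≤n ()
  vNat-spec (suc k) q (suc m) refl 1≤n n≤k with p ∣? suc m
  ... | no  p∤n = suc m , sym (ℕP.*-identityˡ _) , p∤n
  ... | yes p∣n =
    let n/p = suc m ℕD./ p
        n≡ = trans (∣P.m∣n⇒n≡m*quotient p∣n) (cong (p ℕ.*_) (sym (∣P.n/m≡quotient p∣n)))
        1≤n/p = ℕD.m≥n⇒m/n>0 (∣P.∣⇒≤ p∣n)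
        n/p≤k = ℕP.≤-pred (ℕP.≤-trans (ℕD.m/n<m (suc m) p p>1) n≤k)
        a , eq , ∤a = vNat-spec k q n/p refl 1≤n/p n/p≤k
    in a , trans n≡ (trans (cong (p ℕ.*_) eq) (sym (ℕP.*-assoc p (p ^ vNat k p n/p) a))) , ∤a

  p-part : ∀ n → 1 ≤ n → ∃ λ a → n ≡ p ^ vN p n ℕ.* a × ¬ p ∣ a
  p-part n 1≤n = vNat-spec n (ℕ.pred p) n (sym (ℕP.suc-pred p)) 1≤n ℕP.≤-refl

  p^-regroup : ∀ i j a b → p ^ (i ℕ.+ j) ℕ.* (a ℕ.* b) ≡ (p ^ i ℕ.* a) ℕ.* (p ^ j ℕ.* b)
  p^-regroup i j a b = trans (cong (ℕ._* (a ℕ.* b)) (ℕP.^-distribˡ-+-* p i j)) (lem (p ^ i) (p ^ j) a b)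
    where
    lem : ∀ x y a b → (x ℕ.* y) ℕ.* (a ℕ.* b) ≡ (x ℕ.* a) ℕ.* (y ℕ.* b)
    lem = solveℕ

  -- `ν` reads the reduced fraction. The cross-multiplied hypothesis admits any fraction equal to q
  -- up to sign, so a product need not be put in lowest terms.
  ν-fraction : ∀ q i j {a b} → ¬ p ∣ a → ¬ p ∣ b →
    ℤ.∣ ↥ q ∣ ℕ.* (p ^ j ℕ.* b) ≡ (p ^ i ℕ.* a) ℕ.* ↧ₙ q → ν p q ≡ fin (i ⊖ j)
  ν-fraction q i j {a} {b} ∤a ∤b eq with ℤ.∣ ↥ q ∣
  ... | zero  = contradiction eq (ℕP.<⇒≢ (ℕ.>-nonZero⁻¹ _ {{ℕP.m*n≢0 (p ^ i ℕ.* a) (↧ₙ q) {{nz}}}}))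
    where
    nz : NonZero (p ^ i ℕ.* a)
    nz = ℕP.m*n≢0 (p ^ i) a {{ℕP.m^n≢0 p i}} {{∤⇒≢0 ∤a}}
  ... | suc k =
    let a′ , n≡ , ∤a′ = p-part (suc k) (s≤s z≤n)
        b′ , d≡ , ∤b′ = p-part (↧ₙ q) (s≤s z≤n)
        i′ = vN p (suc k)
        j′ = vN p (↧ₙ q)
        -- Unique factorisation: p has the same exponent on both sides of the cross-multiplied
        -- equation.
        i′+j≡i+j′ = p^*-injective (i′ ℕ.+ j) (i ℕ.+ j′) (∤-* ∤a′ ∤b) (∤-* ∤a ∤b′)
          (trans (p^-regroup i′ j a′ b) (trans (cong (ℕ._* (p ^ j ℕ.* b)) (sym n≡))
            (trans eq (trans (cong ((p ^ i ℕ.* a) ℕ.*_) d≡) (sym (p^-regroup i j′ a b′))))))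
    in cong fin (⊖-cong i′ j′ i j i′+j≡i+j′)
    where
    ⊖-cong : ∀ i′ j′ i j → i′ ℕ.+ j ≡ i ℕ.+ j′ → i′ ⊖ j′ ≡ i ⊖ j
    ⊖-cong i′ j′ i j e = begin
      i′ ⊖ j′                       ≡⟨ ℤP.+-cancelˡ-⊖ j i′ j′ ⟨
      (j ℕ.+ i′) ⊖ (j ℕ.+ j′)       ≡⟨ cong (_⊖ (j ℕ.+ j′)) (trans (ℕP.+-comm j i′) e) ⟩
      (i ℕ.+ j′) ⊖ (j ℕ.+ j′)       ≡⟨ cong₂ _⊖_ (ℕP.+-comm i j′) (ℕP.+-comm j j′) ⟩
      (j′ ℕ.+ i) ⊖ (j′ ℕ.+ j)       ≡⟨ ℤP.+-cancelˡ-⊖ j′ i j ⟩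
      i ⊖ j                         ∎
      where open ≡-Reasoning

  ν-finite : ∀ q {v} → ν p q ≡ fin v → ∃ λ i → ∃ λ j → ∃ λ a → ∃ λ b →
    ℤ.∣ ↥ q ∣ ≡ p ^ i ℕ.* a × ↧ₙ q ≡ p ^ j ℕ.* b × ¬ p ∣ a × ¬ p ∣ b × v ≡ i ⊖ j
  ν-finite q eq with ℤ.∣ ↥ q ∣ | eq
  ... | suc k | refl =
    let a , n≡ , ∤a = p-part (suc k) (s≤s z≤n)
        b , d≡ , ∤b = p-part (↧ₙ q) (s≤s z≤n)
    in vN p (suc k) , vN p (↧ₙ q) , a , b , n≡ , d≡ , ∤a , ∤b , refl

  *-fraction : ∀ x y → ℤ.∣ ↥ (x * y) ∣ ℕ.* (↧ₙ x ℕ.* ↧ₙ y) ≡ (ℤ.∣ ↥ x ∣ ℕ.* ℤ.∣ ↥ y ∣) ℕ.* ↧ₙ (x * y)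
  *-fraction x@record{} y@record{} = begin
    ℤ.∣ ↥ (x * y) ∣ ℕ.* (↧ₙ x ℕ.* ↧ₙ y)              ≡⟨ ℤP.abs-* (↥ (x * y)) (+ (↧ₙ x ℕ.* ↧ₙ y)) ⟨
    ℤ.∣ ↥ (x * y) ℤ.* + (↧ₙ x ℕ.* ↧ₙ y) ∣            ≡⟨ cong ℤ.∣_∣ eq ⟩
    ℤ.∣ (↥ x ℤ.* ↥ y) ℤ.* ↧ (x * y) ∣                ≡⟨ ℤP.abs-* (↥ x ℤ.* ↥ y) (↧ (x * y)) ⟩
    ℤ.∣ ↥ x ℤ.* ↥ y ∣ ℕ.* ↧ₙ (x * y)                 ≡⟨ cong (ℕ._* ↧ₙ (x * y)) (ℤP.abs-* (↥ x) (↥ y)) ⟩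
    (ℤ.∣ ↥ x ∣ ℕ.* ℤ.∣ ↥ y ∣) ℕ.* ↧ₙ (x * y)         ∎
    where
    open ≡-Reasoning
    eq : ↥ (x * y) ℤ.* + (↧ₙ x ℕ.* ↧ₙ y) ≡ (↥ x ℤ.* ↥ y) ℤ.* ↧ (x * y)
    eq with x * y | ℚP.toℚᵘ-homo-* x y
    ... | record{} | ℚᵘ.*≡* e = e

  ν-* : ∀ x y {u v} → ν p x ≡ fin u → ν p y ≡ fin v → ν p (x * y) ≡ fin (u ℤ.+ v)
  ν-* x y νx νy with ν-finite x νx | ν-finite y νy
  ... | i , j , a , b , nx , dx , ∤a , ∤b , refl | k , l , c , d , ny , dy , ∤c , ∤d , refl =
    trans (ν-fraction (x * y) (i ℕ.+ k) (j ℕ.+ l) (∤-* ∤a ∤c) (∤-* ∤b ∤d)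
      (begin
        ℤ.∣ ↥ (x * y) ∣ ℕ.* (p ^ (j ℕ.+ l) ℕ.* (b ℕ.* d))
          ≡⟨ cong (ℤ.∣ ↥ (x * y) ∣ ℕ.*_) (trans (p^-regroup j l b d) (cong₂ ℕ._*_ (sym dx) (sym dy))) ⟩
        ℤ.∣ ↥ (x * y) ∣ ℕ.* (↧ₙ x ℕ.* ↧ₙ y)
          ≡⟨ *-fraction x y ⟩
        (ℤ.∣ ↥ x ∣ ℕ.* ℤ.∣ ↥ y ∣) ℕ.* ↧ₙ (x * y)
          ≡⟨ cong (ℕ._* ↧ₙ (x * y)) (trans (cong₂ ℕ._*_ nx ny) (sym (p^-regroup i k a c))) ⟩
        (p ^ (i ℕ.+ k) ℕ.* (a ℕ.* c)) ℕ.* ↧ₙ (x * y) ∎))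
      (cong fin (⊖-+ i j k l))
    where
    open ≡-Reasoning
    ⊖-+ : ∀ i j k l → (i ℕ.+ k) ⊖ (j ℕ.+ l) ≡ (i ⊖ j) ℤ.+ (k ⊖ l)
    ⊖-+ i j k l = begin
      (i ℕ.+ k) ⊖ (j ℕ.+ l)                     ≡⟨ ℤP.m-n≡m⊖n (i ℕ.+ k) (j ℕ.+ l) ⟨
      + (i ℕ.+ k) ℤ.- + (j ℕ.+ l)               ≡⟨ cong₂ ℤ._-_ (ℤP.pos-+ i k) (ℤP.pos-+ j l) ⟩
      (+ i ℤ.+ + k) ℤ.- (+ j ℤ.+ + l)           ≡⟨ lem (+ i) (+ j) (+ k) (+ l) ⟩
      (+ i ℤ.- + j) ℤ.+ (+ k ℤ.- + l)           ≡⟨ cong₂ ℤ._+_ (ℤP.m-n≡m⊖n i j) (ℤP.m-n≡m⊖n k l) ⟩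
      (i ⊖ j) ℤ.+ (k ⊖ l)                       ∎
      where
      lem : ∀ i j k l → (i ℤ.+ k) ℤ.- (j ℤ.+ l) ≡ (i ℤ.- j) ℤ.+ (k ℤ.- l)
      lem = solveℤ

  ν≡∞⇒≡0 : ∀ q → ν p q ≡ ∞ → q ≡ 0ℚ
  ν≡∞⇒≡0 q eq with ℤ.∣ ↥ q ∣ in n≡
  ... | zero  = ℚP.↥p≡0⇒p≡0 q (ℤP.∣i∣≡0⇒i≡0 n≡)

  ν-1 : ν p 1ℚ ≡ fin (+ 0)
  ν-1 = ν-fraction 1ℚ 0 0 p∤1 p∤1 refl

  ν-neg1 : ν p (- 1ℚ) ≡ fin (+ 0)
  ν-neg1 = ν-fraction (- 1ℚ) 0 0 p∤1 p∤1 refl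

  ν-1/ : ∀ q .{{_ : ℚ.NonZero q}} {v} → ν p q ≡ fin v → ν p (ℚ.1/ q) ≡ fin (ℤ.- v)
  ν-1/ q {v} νq with ν p (ℚ.1/ q) in eq
  ... | ∞ = contradiction (trans (sym (ℚP.*-inverseʳ q)) (trans (cong (q *_) (ν≡∞⇒≡0 (ℚ.1/ q) eq)) (ℚP.*-zeroʳ q))) λ ()
  ... | fin w = cong fin (lem (fin-injective (trans (sym (ν-* q (ℚ.1/ q) νq eq)) (trans (cong (ν p) (ℚP.*-inverseʳ q)) ν-1))))
    where
    lem : v ℤ.+ w ≡ + 0 → w ≡ ℤ.- v
    lem e = trans (l2 v w) (trans (cong (ℤ._- v) e) (ℤP.+-identityˡ (ℤ.- v)))
      where
      l2 : ∀ v w → w ≡ (v ℤ.+ w) ℤ.- v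
      l2 = solveℤ

  ∤-denominator⇒0≤ν : ∀ q {v} → ¬ p ∣ ↧ₙ q → ν p q ≡ fin v → + 0 ℤ.≤ v
  ∤-denominator⇒0≤ν q ∤d νq with ν-finite q νq
  ... | i , zero  , a , b , n≡ , d≡ , ∤a , ∤b , refl = ℤ.+≤+ z≤n
  ... | i , suc j , a , b , n≡ , d≡ , ∤a , ∤b , refl =
    contradiction (divides (p ^ j ℕ.* b) (trans d≡ (trans (ℕP.*-assoc p (p ^ j) b) (ℕP.*-comm p _)))) ∤d

  -- In lowest terms p cannot divide both numerator and denominator, so a factor p in the
  -- denominator makes the valuation negative.
  0≤ν⇒∤-denominator : ∀ q {v} → ν p q ≡ fin v → + 0 ℤ.≤ v → ¬ p ∣ ↧ₙ q
  0≤ν⇒∤-denominator q@(mkℚ _ _ coprime) νq 0≤v p∣d with ν-finite q νq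
  ... | i , zero , a , b , n≡ , d≡ , ∤a , ∤b , refl = ∤b (subst (p ∣_) (trans d≡ (ℕP.*-identityˡ b)) p∣d)
  ... | zero , suc j , a , b , n≡ , d≡ , ∤a , ∤b , refl with 0≤v
  ... | ()
  0≤ν⇒∤-denominator q@(mkℚ _ _ coprime) νq 0≤v p∣d | suc i , suc j , a , b , n≡ , d≡ , ∤a , ∤b , refl =
    p∤1 (subst (p ∣_) (Coprime.recompute coprime (p∣n , p∣d)) ∣P.∣-refl)
    where
    p∣n : p ∣ ℤ.∣ ↥ q ∣
    p∣n = divides (p ^ i ℕ.* a) (trans n≡ (trans (ℕP.*-assoc p (p ^ i) a) (ℕP.*-comm p _)))

  -- The reduced denominator of x + y divides the product of those of x and y, neither of which is
  -- divisible by p.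
  0≤ν-+ : ∀ x y {u v w} → ν p x ≡ fin u → + 0 ℤ.≤ u → ν p y ≡ fin v → + 0 ℤ.≤ v →
    ν p (x + y) ≡ fin w → + 0 ℤ.≤ w
  0≤ν-+ x@record{} y@record{} νx 0≤u νy 0≤v = ∤-denominator⇒0≤ν (x + y)
    λ p∣d → ∤-* (0≤ν⇒∤-denominator x νx 0≤u) (0≤ν⇒∤-denominator y νy 0≤v) (∣P.∣-trans p∣d d∣)
    where
    d∣ : ↧ₙ (x + y) ∣ ↧ₙ x ℕ.* ↧ₙ y
    d∣ = pos-∣ (↧ₙ (x + y)) (↧ₙ x ℕ.* ↧ₙ y) (ℚP.↧-+ x y)

  -- Write x + y = x (1 + y/x), where x has the smaller valuation. Then 1 + y/x is p-integral, and
  -- the ultrametric inequality reduces to the integral case.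
  ν-+ : ∀ x y {u v w} → ν p x ≡ fin u → ν p y ≡ fin v → u ℤ.≤ v → ν p (x + y) ≡ fin w → u ℤ.≤ w
  ν-+ x y {u} {v} {w} νx νy u≤v νx+y = 
    ≤-by (w ℤ.- u) (0≤ν-+ 1ℚ (y * ℚ.1/ x) ν-1 ℤP.≤-refl (ν-* y (ℚ.1/ x) νy (ν-1/ x νx)) (ℤP.i≤j⇒0≤j-i u≤v)
      (subst (λ z → ν p z ≡ fin (w ℤ.- u)) quot (ν-* (x + y) (ℚ.1/ x) νx+y (ν-1/ x νx))))
      (sym (lem w u))
    where
    x≢0 : x ≢ 0ℚ
    x≢0 eq with trans (sym (cong (ν p) eq)) νx
    ... | ()
    instance
      x-nonZero : ℚ.NonZero x
      x-nonZero = ℚ.≢-nonZero x≢0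
    quot : (x + y) * ℚ.1/ x ≡ 1ℚ + y * ℚ.1/ x
    quot = trans (ℚP.*-distribʳ-+ (ℚ.1/ x) x y) (cong (_+ y * ℚ.1/ x) (ℚP.*-inverseʳ x))
    lem : ∀ w u → u ℤ.+ (w ℤ.- u) ≡ w
    lem = solveℤ

  -- Weighted lower bounds on valuations, and p-adic units

  -- L N m q says that N ν(q) ≥ m, vacuously for q = 0; for N = 0 it says that q = 0 or m ≤ 0.
  record L (N : ℕ) (m : ℤ) (q : ℚ) : Set where
    constructor mkL
    field bound : ∀ {v} → ν p q ≡ fin v → m ℤ.≤ + N ℤ.* v
  open L public

  V : ℤ → ℚ → Set
  V = L 1

  record U (q : ℚ) : Set where
    constructor mkU
    field ν≡0 : ν p q ≡ fin (+ 0)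
  open U public

  L-0 : ∀ {N m} → L N m 0ℚ
  L-0 = mkL λ ()

  L-≤ : ∀ {N m n q} → m ℤ.≤ n → L N n q → L N m q
  L-≤ m≤n (mkL b) = mkL λ e → ℤP.≤-trans m≤n (b e)

  L-ν : ∀ {N m q v} → ν p q ≡ fin v → m ℤ.≤ + N ℤ.* v → L N m q
  L-ν {N} {m} e m≤ = mkL λ e′ → subst (λ w → m ℤ.≤ + N ℤ.* w) (fin-injective (trans (sym e) e′)) m≤

  L-+ : ∀ {N m x y} → L N m x → L N m y → L N m (x + y)
  L-+ {N} {m} {x} {y} (mkL bx) (mkL by) with ν p x in ex | ν p y in ey
  ... | ∞     | _     = subst (L N m) (sym (trans (cong (_+ y) (ν≡∞⇒≡0 x ex)) (ℚP.+-identityˡ y))) (mkL λ e → by (trans (sym ey) e))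
  ... | fin u | ∞     = subst (L N m) (sym (trans (cong (λ z → x + z) (ν≡∞⇒≡0 y ey)) (ℚP.+-identityʳ x))) (mkL λ e → bx (trans (sym ex) e))
  ... | fin u | fin v = mkL λ e → go e (ℤP.≤-total u v)
    where
    go : ∀ {w} → ν p (x + y) ≡ fin w → u ℤ.≤ v ⊎ v ℤ.≤ u → m ℤ.≤ + N ℤ.* w
    go e (inj₁ u≤v) = ℤP.≤-trans (bx refl) (ℤP.*-monoˡ-≤-nonNeg (+ N) (ν-+ x y ex ey u≤v e))
    go e (inj₂ v≤u) = ℤP.≤-trans (by refl) (ℤP.*-monoˡ-≤-nonNeg (+ N) (ν-+ y x ey ex v≤u (trans (cong (ν p) (ℚP.+-comm y x)) e)))

  L-* : ∀ {N m n x y} → L N m x → L N n y → L N (m ℤ.+ n) (x * y)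
  L-* {N} {m} {n} {x} {y} (mkL bx) (mkL by) with ν p x in ex | ν p y in ey
  ... | ∞     | _     = subst (L N _) (sym (trans (cong (_* y) (ν≡∞⇒≡0 x ex)) (ℚP.*-zeroˡ y))) L-0
  ... | fin u | ∞     = subst (L N _) (sym (trans (cong (x *_) (ν≡∞⇒≡0 y ey)) (ℚP.*-zeroʳ x))) L-0
  ... | fin u | fin v = L-ν (ν-* x y ex ey)
    (subst (m ℤ.+ n ℤ.≤_) (sym (ℤP.*-distribˡ-+ (+ N) u v)) (ℤP.+-mono-≤ (bx refl) (by refl)))

  U⇒L : ∀ {N q} → U q → L N (+ 0) q
  U⇒L {N} (mkU u) = L-ν u (ℤP.≤-reflexive (sym (ℤP.*-zeroʳ (+ N))))

  L-1 : ∀ {N} → L N (+ 0) 1ℚ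
  L-1 = U⇒L (mkU ν-1)

  U-neg1 : U (- 1ℚ)
  U-neg1 = mkU ν-neg1

  L-neg : ∀ {N m x} → L N m x → L N m (- x)
  L-neg {N} {m} {x} lx = subst (L N m) (trans (sym (ℚP.neg-distribˡ-* 1ℚ x)) (cong (-_) (ℚP.*-identityˡ x)))
    (subst (λ k → L N k (- 1ℚ * x)) (ℤP.+-identityˡ m) (L-* (U⇒L U-neg1) lx))

  L-- : ∀ {N m x y} → L N m x → L N m y → L N m (x - y)
  L-- lx ly = L-+ lx (L-neg ly)

  V⇒L : ∀ {N m k q} → V k q → m ℤ.≤ + N ℤ.* k → L N m q
  V⇒L {N} {k = k} (mkL b) m≤ = mkL λ {v} e → ℤP.≤-trans m≤ (ℤP.*-monoˡ-≤-nonNeg (+ N) (subst (k ℤ.≤_) (ℤP.*-identityˡ v) (b e)))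

  -- Valuations are integers, so a weighted bound strictly above `N k` rounds up to `k + 1`. This
  -- turns a strict inequality of weights into one more factor p.
  L⇒V : ∀ {N m q} k → + N ℤ.* k ℤ.+ + 1 ℤ.≤ m → L N m q → V (k ℤ.+ + 1) q
  L⇒V {N} k lt (mkL b) = mkL λ {v} e → subst (k ℤ.+ + 1 ℤ.≤_) (sym (ℤP.*-identityˡ v)) (*-cancelˡ-<-nonNeg N (ℤP.≤-trans lt (b e)))

  V? : ∀ k q → Dec (V k q)
  V? k q with ν p q in eq
  ... | ∞ = yes (mkL λ e → contradiction (trans (sym eq) e) λ ())
  ... | fin v with k ℤP.≤? v
  ...   | yes k≤v = yes (L-ν eq (subst (k ℤ.≤_) (sym (ℤP.*-identityˡ v)) k≤v))
  ...   | no  k≰v = no λ (mkL b) → k≰v (subst (k ℤ.≤_) (ℤP.*-identityˡ v) (b eq))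

  ValAtLeast⇒V : ∀ {k q} → ValAtLeast (ν p q) k → V k q
  ValAtLeast⇒V {k} {q} val with ν p q in eq
  ... | ∞     = mkL λ e → contradiction (trans (sym eq) e) λ ()
  ... | fin v = L-ν eq (subst (k ℤ.≤_) (sym (ℤP.*-identityˡ v)) val)

  V⇒ValAtLeast : ∀ {k q} → V k q → ValAtLeast (ν p q) k
  V⇒ValAtLeast {k} {q} (mkL b) with ν p q in eq
  ... | ∞     = tt
  ... | fin v = subst (k ℤ.≤_) (ℤP.*-identityˡ v) (b refl)

  ν⇒¬V : ∀ {k q} → ν p q ≡ fin k → ¬ V (k ℤ.+ + 1) q
  ν⇒¬V {k} e (mkL b) = i+1≰i k (subst (k ℤ.+ + 1 ℤ.≤_) (ℤP.*-identityˡ k) (b e))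

  V⇒ν : ∀ {k q} → V k q → ¬ V (k ℤ.+ + 1) q → ν p q ≡ fin k
  V⇒ν {k} {q} (mkL b) ¬v with ν p q in eq
  ... | ∞     = contradiction (mkL λ e → contradiction (trans (sym eq) e) λ ()) ¬v
  ... | fin v with v ℤP.≤? k
  ...   | yes v≤k = cong fin (ℤP.≤-antisym v≤k (subst (k ℤ.≤_) (ℤP.*-identityˡ v) (b refl)))
  ...   | no  v≰k = contradiction
    (L-ν eq (subst₂ ℤ._≤_ (ℤP.+-comm (+ 1) k) (sym (ℤP.*-identityˡ v)) (ℤP.i<j⇒suc[i]≤j (ℤP.≰⇒> v≰k)))) ¬v

  ν-pow : ∀ {x v} n → ν p x ≡ fin v → ν p (powQ x n) ≡ fin (+ n ℤ.* v)
  ν-pow {v = v} zero    e = trans ν-1 (cong fin (sym (ℤP.*-zeroˡ v)))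
  ν-pow {x} {v} (suc n) e = trans (ν-* x (powQ x n) e (ν-pow n e)) (cong fin (sym (ℤP.suc-* (+ n) v)))

  U-* : ∀ {x y} → U x → U y → U (x * y)
  U-* {x} {y} (mkU ux) (mkU uy) = mkU (ν-* x y ux uy)

  U-pow : ∀ {x} n → U x → U (powQ x n)
  U-pow n (mkU u) = mkU (trans (ν-pow n u) (cong fin (ℤP.*-zeroʳ (+ n))))

  L-pow : ∀ {N m x} n → L N m x → L N (+ n ℤ.* m) (powQ x n)
  L-pow {N} {m} zero    l = subst (λ k → L N k 1ℚ) (sym (ℤP.*-zeroˡ m)) L-1
  L-pow {N} {m} {x} (suc n) l = subst (λ k → L N k (powQ x (suc n))) (sym (ℤP.suc-* (+ n) m)) (L-* l (L-pow n l))

  L-cancel-U : ∀ {N m u x} → U u → L N m (u * x) → L N m x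
  L-cancel-U {u = u} {x} (mkU eu) (mkL b) = mkL λ {v} e → b (trans (ν-* u x eu e) (cong fin (ℤP.+-identityˡ v)))

  -- Rounding again: e ν(y) > e k gives ν(y) > k.
  V-root : ∀ {k u y} e → U u → V (+ e ℤ.* k ℤ.+ + 1) (u * powQ y e) → V (k ℤ.+ + 1) y
  V-root {k} {u} {y} e (mkU eu) (mkL b) = mkL λ {v} ey → subst (k ℤ.+ + 1 ℤ.≤_) (sym (ℤP.*-identityˡ v))
    (*-cancelˡ-<-nonNeg e (subst (+ e ℤ.* k ℤ.+ + 1 ℤ.≤_) (trans (ℤP.*-identityˡ _) (ℤP.+-identityˡ _))
      (b (ν-* u (powQ y e) eu (ν-pow e ey)))))

  -- Multiplying every weight by t carries the weights (d, r) that describe f to the weights (d t, r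
  -- t) that fit a composite with a polynomial of degree t.
  L-scale : ∀ {N m q} t → L N m q → L (t ℕ.* N) (+ t ℤ.* m) q
  L-scale {N} {m} t (mkL b) = mkL λ {v} e → subst (+ t ℤ.* m ℤ.≤_)
    (trans (sym (ℤP.*-assoc (+ t) (+ N) v)) (cong (ℤ._* v) (sym (ℤP.pos-* t N)))) (ℤP.*-monoˡ-≤-nonNeg (+ t) (b e))

  L-unscale : ∀ {N m q} t → .{{NonZero t}} → L (t ℕ.* N) (+ t ℤ.* m) q → L N m q
  L-unscale {N} {m} (suc t) (mkL b) = mkL λ {v} e → ℤP.*-cancelˡ-≤-pos _ _ (+ suc t)
    (subst (+ suc t ℤ.* m ℤ.≤_) (trans (cong (ℤ._* v) (ℤP.pos-* (suc t) N)) (ℤP.*-assoc (+ suc t) (+ N) v)) (b e))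

  U-1 : U 1ℚ
  U-1 = mkU ν-1

  U⇒¬V1 : ∀ {q} → U q → ¬ V (+ 1) q
  U⇒¬V1 (mkU u) = ν⇒¬V u

  ¬V1⇒U : ∀ {q} → V (+ 0) q → ¬ V (+ 1) q → U q
  ¬V1⇒U v0 ¬v1 = mkU (V⇒ν v0 ¬v1)

  V1⇒V0 : ∀ {q} → V (+ 1) q → V (+ 0) q
  V1⇒V0 = L-≤ 0≤pos

  -- Natural numbers in ℚ and divisibility by p

  ι : ℕ → ℚ
  ι zero    = 0ℚ
  ι (suc n) = 1ℚ + ι n

  ι-+ : ∀ m n → ι (m ℕ.+ n) ≡ ι m + ι n
  ι-+ zero    n = sym (ℚP.+-identityˡ (ι n))
  ι-+ (suc m) n = trans (cong (λ z → 1ℚ + z) (ι-+ m n)) (sym (ℚP.+-assoc 1ℚ (ι m) (ι n)))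

  ι-* : ∀ m n → ι (m ℕ.* n) ≡ ι m * ι n
  ι-* zero    n = sym (ℚP.*-zeroˡ (ι n))
  ι-* (suc m) n = begin
    ι (n ℕ.+ m ℕ.* n)            ≡⟨ ι-+ n (m ℕ.* n) ⟩
    ι n + ι (m ℕ.* n)            ≡⟨ cong₂ _+_ (sym (ℚP.*-identityˡ (ι n))) (ι-* m n) ⟩
    1ℚ * ι n + ι m * ι n         ≡⟨ ℚP.*-distribʳ-+ (ι n) 1ℚ (ι m) ⟨
    (1ℚ + ι m) * ι n             ∎
    where open ≡-Reasoning

  ι-fraction : ∀ n → ι n ≡ mkℚ (+ n) 0 (Coprime.sym (Coprime.1-coprimeTo n))
  ι-fraction zero    = refl
  ι-fraction (suc n) = trans (cong (λ z → 1ℚ + z) (ι-fraction n))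
    (ℚP.toℚᵘ-injective (ℚᵘP.≃-trans (ℚP.toℚᵘ-homo-+ 1ℚ (mkℚ (+ n) 0 (Coprime.sym (Coprime.1-coprimeTo n)))) (ℚᵘ.*≡* (lem (+ n)))))
    where
    lem : ∀ n → ((+ 1 ℤ.* + 1) ℤ.+ n ℤ.* + 1) ℤ.* + 1 ≡ (+ 1 ℤ.+ n) ℤ.* + 1
    lem = solveℤ

  V0-ι : ∀ n → V (+ 0) (ι n)
  V0-ι zero    = L-0
  V0-ι (suc n) = L-+ L-1 (V0-ι n)

  U-ι : ∀ {n} → ¬ p ∣ n → U (ι n)
  U-ι {n} ∤n = mkU (ν-fraction (ι n) 0 0 ∤n p∤1 lem)
    where
    lem : ℤ.∣ ↥ (ι n) ∣ ℕ.* (p ^ 0 ℕ.* 1) ≡ (p ^ 0 ℕ.* n) ℕ.* ↧ₙ (ι n)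
    lem rewrite ι-fraction n = trans (ℕP.*-identityʳ n) (sym (trans (ℕP.*-identityʳ _) (ℕP.*-identityˡ n)))

  V1-ι⁻¹ : ∀ {n} → V (+ 1) (ι n) → p ∣ n
  V1-ι⁻¹ {n} v with p ∣? n
  ... | yes ∣n = ∣n
  ... | no  ∤n = contradiction v (U⇒¬V1 (U-ι ∤n))

  V1-ι-p : V (+ 1) (ι p)
  V1-ι-p = L-ν {v = + 1} (ν-fraction (ι p) 1 0 p∤1 p∤1 lem) ℤP.≤-refl
    where
    lem : ℤ.∣ ↥ (ι p) ∣ ℕ.* (p ^ 0 ℕ.* 1) ≡ (p ^ 1 ℕ.* 1) ℕ.* ↧ₙ (ι p)
    lem rewrite ι-fraction p = sym (trans (ℕP.*-identityʳ _) (ℕP.*-identityʳ _) )  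

  V1-ι : ∀ {n} → p ∣ n → V (+ 1) (ι n)
  V1-ι (divides k refl) = subst (V (+ 1)) (sym (ι-* k p)) (L-* (V0-ι k) V1-ι-p)

  -- Clears the denominator, which lets Fermat's theorem pass from integers to p-integral rationals.
  ι-denominator : ∀ q → q * ι (↧ₙ q) ≡ ι ℤ.∣ ↥ q ∣ ⊎ q * ι (↧ₙ q) ≡ - ι ℤ.∣ ↥ q ∣
  ι-denominator (mkℚ (+ m) d c) rewrite ι-fraction (suc d) | ι-fraction m =
    inj₁ (ℚP.toℚᵘ-injective (ℚᵘP.≃-trans (ℚP.toℚᵘ-homo-* (mkℚ (+ m) d c)
      (mkℚ (+ suc d) 0 (Coprime.sym (Coprime.1-coprimeTo (suc d))))) (ℚᵘ.*≡* (clear (+ m) (+ suc d)))))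
    where
    clear : ∀ n d → (n ℤ.* d) ℤ.* + 1 ≡ n ℤ.* (d ℤ.* + 1)
    clear = solveℤ
  ι-denominator (mkℚ -[1+ m ] d c) rewrite ι-fraction (suc d) | ι-fraction (suc m) =
    inj₂ (ℚP.toℚᵘ-injective (ℚᵘP.≃-trans (ℚP.toℚᵘ-homo-* (mkℚ -[1+ m ] d c)
      (mkℚ (+ suc d) 0 (Coprime.sym (Coprime.1-coprimeTo (suc d))))) (ℚᵘ.*≡* (clear -[1+ m ] (+ suc d)))))
    where
    clear : ∀ n d → (n ℤ.* d) ℤ.* + 1 ≡ n ℤ.* (d ℤ.* + 1)
    clear = solveℤ

  V0⇒U-denominator : ∀ {q} → V (+ 0) q → U (ι (↧ₙ q))
  V0⇒U-denominator {q} (mkL b) with ν p q in eq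
  ... | fin v = U-ι (0≤ν⇒∤-denominator q eq (subst (+ 0 ℤ.≤_) (ℤP.*-identityˡ v) (b refl)))
  ... | ∞ rewrite ν≡∞⇒≡0 q eq = U-ι p∤1

-- The commutative ring of polynomials over ℚ

ℚ-ring : AlmostCommutativeRing 0ℓ 0ℓ
ℚ-ring = fromCommutativeRing ℚP.+-*-commutativeRing (λ q → dec⇒maybe (0ℚ ℚP.≟ q))

infix 4 _≈_
-- Lists that differ in trailing zeros represent the same polynomial, hence equality by
-- coefficients. As a record it lets `f` and `g` be inferred from a proof.
record _≈_ (f g : Poly) : Set where
  constructor mk≈
  field at : ∀ i → coeff f i ≡ coeff g i
open _≈_ public

≈-refl : ∀ {f} → f ≈ f
≈-refl = mk≈ λ _ → refl

≈-sym : ∀ {f g} → f ≈ g → g ≈ f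
≈-sym (mk≈ e) = mk≈ λ i → sym (e i)

≈-trans : ∀ {f g h} → f ≈ g → g ≈ h → f ≈ h
≈-trans (mk≈ e) (mk≈ e′) = mk≈ λ i → trans (e i) (e′ i)

≈-isEquivalence : IsEquivalence _≈_
≈-isEquivalence = record { refl = ≈-refl ; sym = ≈-sym ; trans = ≈-trans }

∷-cong : ∀ {a b f g} → a ≡ b → f ≈ g → (a ∷ f) ≈ (b ∷ g)
∷-cong refl (mk≈ e) = mk≈ λ { zero → refl ; (suc i) → e i }

0∷[]≈[] : (0ℚ ∷ []) ≈ []
0∷[]≈[] = mk≈ λ { zero → refl ; (suc i) → refl }

coeff-addP : ∀ f g i → coeff (addP f g) i ≡ coeff f i + coeff g i
coeff-addP []      g       i       = sym (ℚP.+-identityˡ (coeff g i))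
coeff-addP (a ∷ f) []      i       = sym (ℚP.+-identityʳ (coeff (a ∷ f) i))
coeff-addP (a ∷ f) (b ∷ g) zero    = refl
coeff-addP (a ∷ f) (b ∷ g) (suc i) = coeff-addP f g i

coeff-scaleP : ∀ c f i → coeff (scaleP c f) i ≡ c * coeff f i
coeff-scaleP c []      i       = sym (ℚP.*-zeroʳ c)
coeff-scaleP c (a ∷ f) zero    = refl
coeff-scaleP c (a ∷ f) (suc i) = coeff-scaleP c f i

negP : Poly → Poly
negP = scaleP (- 1ℚ)

subP : Poly → Poly → Poly
subP f g = addP f (negP g)

coeff-negP : ∀ f i → coeff (negP f) i ≡ - coeff f i
coeff-negP f i = trans (coeff-scaleP (- 1ℚ) f i)
  (trans (sym (ℚP.neg-distribˡ-* 1ℚ (coeff f i))) (cong (-_) (ℚP.*-identityˡ (coeff f i))))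

coeff-subP : ∀ f g i → coeff (subP f g) i ≡ coeff f i - coeff g i
coeff-subP f g i = trans (coeff-addP f (negP g) i) (cong (λ z → coeff f i + z) (coeff-negP g i))

addP-cong : ∀ {f f′ g g′} → f ≈ f′ → g ≈ g′ → addP f g ≈ addP f′ g′
addP-cong {f} {f′} {g} {g′} (mk≈ e) (mk≈ e′) = mk≈ λ i →
  trans (coeff-addP f g i) (trans (cong₂ _+_ (e i) (e′ i)) (sym (coeff-addP f′ g′ i)))

addP-congˡ : ∀ f {g g′} → g ≈ g′ → addP f g ≈ addP f g′
addP-congˡ f = addP-cong (≈-refl {f})

scaleP-cong : ∀ c {f g} → f ≈ g → scaleP c f ≈ scaleP c g
scaleP-cong c {f} {g} (mk≈ e) = mk≈ λ i →
  trans (coeff-scaleP c f i) (trans (cong (c *_) (e i)) (sym (coeff-scaleP c g i)))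

addP-comm : ∀ f g → addP f g ≈ addP g f
addP-comm f g = mk≈ λ i → trans (coeff-addP f g i) (trans (ℚP.+-comm (coeff f i) (coeff g i)) (sym (coeff-addP g f i)))

addP-assoc : ∀ f g h → addP (addP f g) h ≈ addP f (addP g h)
addP-assoc f g h = mk≈ λ i → begin
  coeff (addP (addP f g) h) i              ≡⟨ coeff-addP (addP f g) h i ⟩
  coeff (addP f g) i + coeff h i           ≡⟨ cong (_+ coeff h i) (coeff-addP f g i) ⟩
  coeff f i + coeff g i + coeff h i        ≡⟨ ℚP.+-assoc (coeff f i) (coeff g i) (coeff h i) ⟩
  coeff f i + (coeff g i + coeff h i)      ≡⟨ cong (λ z → coeff f i + z) (coeff-addP g h i) ⟨
  coeff f i + coeff (addP g h) i           ≡⟨ coeff-addP f (addP g h) i ⟨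
  coeff (addP f (addP g h)) i              ∎
  where open ≡-Reasoning

addP-identityʳ : ∀ f → addP f [] ≈ f
addP-identityʳ []      = ≈-refl
addP-identityʳ (a ∷ f) = ≈-refl

subP-self : ∀ f → subP f f ≈ []
subP-self f = mk≈ λ i → trans (coeff-subP f f i) (ℚP.+-inverseʳ (coeff f i))

scaleP-zero : ∀ f → scaleP 0ℚ f ≈ []
scaleP-zero f = mk≈ λ i → trans (coeff-scaleP 0ℚ f i) (ℚP.*-zeroˡ (coeff f i))

scaleP-one : ∀ f → scaleP 1ℚ f ≈ f
scaleP-one f = mk≈ λ i → trans (coeff-scaleP 1ℚ f i) (ℚP.*-identityˡ (coeff f i))

scaleP-addP : ∀ c f g → scaleP c (addP f g) ≈ addP (scaleP c f) (scaleP c g)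
scaleP-addP c f g = mk≈ λ i → begin
  coeff (scaleP c (addP f g)) i                     ≡⟨ coeff-scaleP c (addP f g) i ⟩
  c * coeff (addP f g) i                            ≡⟨ cong (c *_) (coeff-addP f g i) ⟩
  c * (coeff f i + coeff g i)                       ≡⟨ ℚP.*-distribˡ-+ c (coeff f i) (coeff g i) ⟩
  c * coeff f i + c * coeff g i                     ≡⟨ cong₂ _+_ (coeff-scaleP c f i) (coeff-scaleP c g i) ⟨
  coeff (scaleP c f) i + coeff (scaleP c g) i       ≡⟨ coeff-addP (scaleP c f) (scaleP c g) i ⟨
  coeff (addP (scaleP c f) (scaleP c g)) i          ∎
  where open ≡-Reasoning

scaleP-+ : ∀ c d f → scaleP (c + d) f ≈ addP (scaleP c f) (scaleP d f)
scaleP-+ c d f = mk≈ λ i → begin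
  coeff (scaleP (c + d) f) i                        ≡⟨ coeff-scaleP (c + d) f i ⟩
  (c + d) * coeff f i                               ≡⟨ ℚP.*-distribʳ-+ (coeff f i) c d ⟩
  c * coeff f i + d * coeff f i                     ≡⟨ cong₂ _+_ (coeff-scaleP c f i) (coeff-scaleP d f i) ⟨
  coeff (scaleP c f) i + coeff (scaleP d f) i       ≡⟨ coeff-addP (scaleP c f) (scaleP d f) i ⟨
  coeff (addP (scaleP c f) (scaleP d f)) i          ∎
  where open ≡-Reasoning

scaleP-* : ∀ c d f → scaleP (c * d) f ≈ scaleP c (scaleP d f)
scaleP-* c d f = mk≈ λ i → begin
  coeff (scaleP (c * d) f) i        ≡⟨ coeff-scaleP (c * d) f i ⟩
  (c * d) * coeff f i               ≡⟨ ℚP.*-assoc c d (coeff f i) ⟩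
  c * (d * coeff f i)               ≡⟨ cong (c *_) (coeff-scaleP d f i) ⟨
  c * coeff (scaleP d f) i          ≡⟨ coeff-scaleP c (scaleP d f) i ⟨
  coeff (scaleP c (scaleP d f)) i   ∎
  where open ≡-Reasoning

poly-setoid : Setoid 0ℓ 0ℓ
poly-setoid = record { isEquivalence = ≈-isEquivalence }

module ≈-Reasoning = SetoidReasoning poly-setoid

addP-interchange : ∀ f g h k → addP (addP f g) (addP h k) ≈ addP (addP f h) (addP g k)
addP-interchange f g h k = begin
  addP (addP f g) (addP h k) ≈⟨ addP-assoc f g (addP h k) ⟩
  addP f (addP g (addP h k)) ≈⟨ addP-congˡ f (addP-assoc g h k) ⟨
  addP f (addP (addP g h) k) ≈⟨ addP-congˡ f (addP-cong (addP-comm g h) (≈-refl {k})) ⟩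
  addP f (addP (addP h g) k) ≈⟨ addP-congˡ f (addP-assoc h g k) ⟩
  addP f (addP h (addP g k)) ≈⟨ addP-assoc f h (addP g k) ⟨
  addP (addP f h) (addP g k) ∎
  where open ≈-Reasoning

mulP-zeroʳ : ∀ f → mulP f [] ≈ []
mulP-zeroʳ []      = ≈-refl
mulP-zeroʳ (a ∷ f) = ≈-trans (∷-cong refl (mulP-zeroʳ f)) 0∷[]≈[]

mulP-zeroˡ : ∀ {f} g → f ≈ [] → mulP f g ≈ []
mulP-zeroˡ {[]}    g e       = ≈-refl
mulP-zeroˡ {a ∷ f} g (mk≈ e) rewrite e 0 =
  addP-cong (scaleP-zero g) (≈-trans (∷-cong refl (mulP-zeroˡ {f} g (mk≈ λ i → e (suc i)))) 0∷[]≈[])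

mulP-congˡ : ∀ f {g g′} → g ≈ g′ → mulP f g ≈ mulP f g′
mulP-congˡ []      e = ≈-refl
mulP-congˡ (a ∷ f) e = addP-cong (scaleP-cong a e) (∷-cong refl (mulP-congˡ f e))

mulP-congʳ : ∀ {f f′} g → f ≈ f′ → mulP f g ≈ mulP f′ g
mulP-congʳ {[]}    {f′}     g e = ≈-sym (mulP-zeroˡ g (≈-sym e))
mulP-congʳ {a ∷ f} {[]}     g e = mulP-zeroˡ g e
mulP-congʳ {a ∷ f} {b ∷ f′} g (mk≈ e) rewrite e 0 =
  addP-cong ≈-refl (∷-cong refl (mulP-congʳ {f} {f′} g (mk≈ λ i → e (suc i))))

mulP-cong : ∀ {f f′ g g′} → f ≈ f′ → g ≈ g′ → mulP f g ≈ mulP f′ g′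
mulP-cong {f} {f′} {g} e e′ = ≈-trans (mulP-congʳ g e) (mulP-congˡ f′ e′)

0∷-addP : ∀ f g → (0ℚ ∷ addP f g) ≈ addP (0ℚ ∷ f) (0ℚ ∷ g)
0∷-addP f g = ∷-cong refl ≈-refl

mulP-distribˡ : ∀ f g h → mulP f (addP g h) ≈ addP (mulP f g) (mulP f h)
mulP-distribˡ []      g h = ≈-refl
mulP-distribˡ (a ∷ f) g h = ≈-trans
  (addP-cong (scaleP-addP a g h) (≈-trans (∷-cong refl (mulP-distribˡ f g h)) (0∷-addP (mulP f g) (mulP f h))))
  (addP-interchange (scaleP a g) (scaleP a h) (0ℚ ∷ mulP f g) (0ℚ ∷ mulP f h))

mulP-distribʳ : ∀ h f g → mulP (addP f g) h ≈ addP (mulP f h) (mulP g h)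
mulP-distribʳ h []      g       = ≈-refl
mulP-distribʳ h (a ∷ f) []      = ≈-sym (addP-identityʳ (mulP (a ∷ f) h))
mulP-distribʳ h (a ∷ f) (b ∷ g) = ≈-trans
  (addP-cong (scaleP-+ a b h) (≈-trans (∷-cong refl (mulP-distribʳ h f g)) (0∷-addP (mulP f h) (mulP g h))))
  (addP-interchange (scaleP a h) (scaleP b h) (0ℚ ∷ mulP f h) (0ℚ ∷ mulP g h))

0∷-scaleP : ∀ c f → (0ℚ ∷ scaleP c f) ≈ scaleP c (0ℚ ∷ f)
0∷-scaleP c f = ∷-cong (sym (ℚP.*-zeroʳ c)) ≈-refl

mulP-scaleˡ : ∀ c f g → mulP (scaleP c f) g ≈ scaleP c (mulP f g)
mulP-scaleˡ c []      g = ≈-refl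
mulP-scaleˡ c (a ∷ f) g = ≈-trans
  (addP-cong (scaleP-* c a g) (≈-trans (∷-cong refl (mulP-scaleˡ c f g)) (0∷-scaleP c (mulP f g))))
  (≈-sym (scaleP-addP c (scaleP a g) (0ℚ ∷ mulP f g)))

mulP-0∷ˡ : ∀ f g → mulP (0ℚ ∷ f) g ≈ (0ℚ ∷ mulP f g)
mulP-0∷ˡ f g = addP-cong (scaleP-zero g) ≈-refl

mulP-0∷ʳ : ∀ f g → mulP f (0ℚ ∷ g) ≈ (0ℚ ∷ mulP f g)
mulP-0∷ʳ []      g = ≈-sym 0∷[]≈[]
mulP-0∷ʳ (a ∷ f) g = ≈-trans
  (addP-cong (≈-sym (0∷-scaleP a g)) (∷-cong refl (mulP-0∷ʳ f g)))
  (≈-sym (0∷-addP (scaleP a g) (0ℚ ∷ mulP f g)))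

mulP-constʳ : ∀ f a → mulP f (a ∷ []) ≈ scaleP a f
mulP-constʳ []      a = ≈-refl
mulP-constʳ (b ∷ f) a = ∷-cong (trans (ℚP.+-identityʳ (b * a)) (ℚP.*-comm b a)) (mulP-constʳ f a)

mulP-constˡ : ∀ a f → mulP (a ∷ []) f ≈ scaleP a f
mulP-constˡ a f = ≈-trans (addP-cong ≈-refl 0∷[]≈[]) (addP-identityʳ (scaleP a f))

∷-split : ∀ a f → (a ∷ f) ≈ addP (a ∷ []) (0ℚ ∷ f)
∷-split a f = ∷-cong (sym (ℚP.+-identityʳ a)) ≈-refl

mulP-comm : ∀ f g → mulP f g ≈ mulP g f
mulP-comm []      g = ≈-sym (mulP-zeroʳ g)
mulP-comm (a ∷ f) g = begin
  addP (scaleP a g) (0ℚ ∷ mulP f g)             ≈⟨ addP-cong (≈-sym (mulP-constʳ g a)) (∷-cong refl (mulP-comm f g)) ⟩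
  addP (mulP g (a ∷ [])) (0ℚ ∷ mulP g f)        ≈⟨ addP-cong ≈-refl (mulP-0∷ʳ g f) ⟨
  addP (mulP g (a ∷ [])) (mulP g (0ℚ ∷ f))      ≈⟨ mulP-distribˡ g (a ∷ []) (0ℚ ∷ f) ⟨
  mulP g (addP (a ∷ []) (0ℚ ∷ f))               ≈⟨ mulP-congˡ g (∷-split a f) ⟨
  mulP g (a ∷ f)                                ∎
  where open ≈-Reasoning

mulP-assoc : ∀ f g h → mulP (mulP f g) h ≈ mulP f (mulP g h)
mulP-assoc []      g h = ≈-refl
mulP-assoc (a ∷ f) g h = begin
  mulP (addP (scaleP a g) (0ℚ ∷ mulP f g)) h             ≈⟨ mulP-distribʳ h (scaleP a g) (0ℚ ∷ mulP f g) ⟩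
  addP (mulP (scaleP a g) h) (mulP (0ℚ ∷ mulP f g) h)    ≈⟨ addP-cong (mulP-scaleˡ a g h) (mulP-0∷ˡ (mulP f g) h) ⟩
  addP (scaleP a (mulP g h)) (0ℚ ∷ mulP (mulP f g) h)    ≈⟨ addP-cong (≈-refl {scaleP a (mulP g h)}) (∷-cong refl (mulP-assoc f g h)) ⟩
  addP (scaleP a (mulP g h)) (0ℚ ∷ mulP f (mulP g h))    ∎
  where open ≈-Reasoning

mulP-identityˡ : ∀ f → mulP (1ℚ ∷ []) f ≈ f
mulP-identityˡ f = ≈-trans (mulP-constˡ 1ℚ f) (scaleP-one f)

poly-commutativeRing : CommutativeRing 0ℓ 0ℓ
poly-commutativeRing = record
  { Carrier = Poly ; _≈_ = _≈_ ; _+_ = addP ; _*_ = mulP ; -_ = negP ; 0# = [] ; 1# = 1ℚ ∷ []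
  ; isCommutativeRing = record
    { isRing = record
      { +-isAbelianGroup = record
        { isGroup = record
          { isMonoid = record
            { isSemigroup = record
              { isMagma = record { isEquivalence = ≈-isEquivalence ; ∙-cong = addP-cong }
              ; assoc = addP-assoc }
            ; identity = (λ f → ≈-refl) , addP-identityʳ }
          ; inverse = (λ f → ≈-trans (addP-comm (negP f) f) (subP-self f)) , subP-self
          ; ⁻¹-cong = scaleP-cong (- 1ℚ) }
        ; comm = addP-comm }
      ; *-cong = mulP-cong
      ; *-assoc = mulP-assoc
      ; *-identity = mulP-identityˡ , λ f → ≈-trans (mulP-comm f (1ℚ ∷ [])) (mulP-identityˡ f)
      ; distrib = mulP-distribˡ , mulP-distribʳ }
    ; *-comm = mulP-comm } }

≈[]? : ∀ f → Maybe ([] ≈ f)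
≈[]? []      = just ≈-refl
≈[]? (a ∷ f) with 0ℚ ℚP.≟ a | ≈[]? f
... | yes e | just e′ = just (≈-trans (≈-sym 0∷[]≈[]) (∷-cong e e′))
... | _     | _       = nothing

poly-ring : AlmostCommutativeRing 0ℓ 0ℓ
poly-ring = fromCommutativeRing poly-commutativeRing ≈[]?


-- Composition as a ring homomorphism in its outer argument

compose-[]≈ : ∀ {f} g → f ≈ [] → compose f g ≈ []
compose-[]≈ {[]}    g e       = ≈-refl
compose-[]≈ {a ∷ f} g (mk≈ e) rewrite e 0 =
  addP-cong 0∷[]≈[] (≈-trans (mulP-congˡ g (compose-[]≈ {f} g (mk≈ λ i → e (suc i)))) (mulP-zeroʳ g))

compose-congʳ : ∀ {f f′} g → f ≈ f′ → compose f g ≈ compose f′ g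
compose-congʳ {[]}    {f′}     g e = ≈-sym (compose-[]≈ g (≈-sym e))
compose-congʳ {a ∷ f} {[]}     g e = compose-[]≈ g e
compose-congʳ {a ∷ f} {b ∷ f′} g (mk≈ e) rewrite e 0 =
  addP-congˡ (b ∷ []) (mulP-congˡ g (compose-congʳ {f} {f′} g (mk≈ λ i → e (suc i))))

compose-congˡ : ∀ f {g g′} → g ≈ g′ → compose f g ≈ compose f g′
compose-congˡ []      e = ≈-refl
compose-congˡ (a ∷ f) e = addP-congˡ (a ∷ []) (mulP-cong e (compose-congˡ f e))

compose-const : ∀ c g → compose (c ∷ []) g ≈ (c ∷ [])
compose-const c g = ≈-trans (addP-congˡ (c ∷ []) (mulP-zeroʳ g)) ≈-refl

compose-addP : ∀ f h g → compose (addP f h) g ≈ addP (compose f g) (compose h g)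
compose-addP []      h       g = ≈-refl
compose-addP (a ∷ f) []      g = ≈-sym (addP-identityʳ (compose (a ∷ f) g))
compose-addP (a ∷ f) (b ∷ h) g = begin
  addP (a + b ∷ []) (mulP g (compose (addP f h) g))
    ≈⟨ addP-congˡ (a + b ∷ []) (mulP-congˡ g (compose-addP f h g)) ⟩
  addP (addP (a ∷ []) (b ∷ [])) (mulP g (addP (compose f g) (compose h g)))
    ≈⟨ addP-congˡ (a + b ∷ []) (mulP-distribˡ g (compose f g) (compose h g)) ⟩
  addP (addP (a ∷ []) (b ∷ [])) (addP (mulP g (compose f g)) (mulP g (compose h g)))
    ≈⟨ addP-interchange (a ∷ []) (b ∷ []) (mulP g (compose f g)) (mulP g (compose h g)) ⟩
  addP (compose (a ∷ f) g) (compose (b ∷ h) g) ∎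
  where open ≈-Reasoning

compose-scaleP : ∀ c f g → compose (scaleP c f) g ≈ scaleP c (compose f g)
compose-scaleP c []      g = ≈-refl
compose-scaleP c (a ∷ f) g = begin
  addP (c * a ∷ []) (mulP g (compose (scaleP c f) g))
    ≈⟨ addP-congˡ (c * a ∷ []) (mulP-congˡ g (compose-scaleP c f g)) ⟩
  addP (c * a ∷ []) (mulP g (scaleP c (compose f g)))
    ≈⟨ addP-congˡ (c * a ∷ []) (≈-trans (mulP-comm g (scaleP c (compose f g)))
        (≈-trans (mulP-scaleˡ c (compose f g) g) (scaleP-cong c (mulP-comm (compose f g) g)))) ⟩
  addP (scaleP c (a ∷ [])) (scaleP c (mulP g (compose f g)))
    ≈⟨ scaleP-addP c (a ∷ []) (mulP g (compose f g)) ⟨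
  scaleP c (compose (a ∷ f) g) ∎
  where open ≈-Reasoning

compose-subP : ∀ f h g → compose (subP f h) g ≈ subP (compose f g) (compose h g)
compose-subP f h g = ≈-trans (compose-addP f (negP h) g) (addP-congˡ (compose f g) (compose-scaleP (- 1ℚ) h g))

compose-0∷ : ∀ f g → compose (0ℚ ∷ f) g ≈ mulP g (compose f g)
compose-0∷ f g = addP-cong 0∷[]≈[] ≈-refl

compose-mulP : ∀ f h g → compose (mulP f h) g ≈ mulP (compose f g) (compose h g)
compose-mulP []      h g = ≈-refl
compose-mulP (a ∷ f) h g = begin
  compose (addP (scaleP a h) (0ℚ ∷ mulP f h)) g
    ≈⟨ compose-addP (scaleP a h) (0ℚ ∷ mulP f h) g ⟩
  addP (compose (scaleP a h) g) (compose (0ℚ ∷ mulP f h) g)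
    ≈⟨ addP-cong (compose-scaleP a h g) (compose-0∷ (mulP f h) g) ⟩
  addP (scaleP a H) (mulP g (compose (mulP f h) g))
    ≈⟨ addP-cong (≈-sym (mulP-constˡ a H)) (mulP-congˡ g (compose-mulP f h g)) ⟩
  addP (mulP (a ∷ []) H) (mulP g (mulP F H))
    ≈⟨ addP-congˡ (mulP (a ∷ []) H) (mulP-assoc g F H) ⟨
  addP (mulP (a ∷ []) H) (mulP (mulP g F) H)
    ≈⟨ mulP-distribʳ H (a ∷ []) (mulP g F) ⟨
  mulP (compose (a ∷ f) g) H ∎
  where
  open ≈-Reasoning
  F = compose f g
  H = compose h g

compose-assoc : ∀ f g h → compose (compose f g) h ≈ compose f (compose g h)
compose-assoc []      g h = ≈-refl
compose-assoc (a ∷ f) g h = begin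
  compose (addP (a ∷ []) (mulP g (compose f g))) h
    ≈⟨ compose-addP (a ∷ []) (mulP g (compose f g)) h ⟩
  addP (compose (a ∷ []) h) (compose (mulP g (compose f g)) h)
    ≈⟨ addP-cong (compose-const a h) (compose-mulP g (compose f g) h) ⟩
  addP (a ∷ []) (mulP (compose g h) (compose (compose f g) h))
    ≈⟨ addP-congˡ (a ∷ []) (mulP-congˡ (compose g h) (compose-assoc f g h)) ⟩
  compose (a ∷ f) (compose g h) ∎
  where open ≈-Reasoning

compose-xPlus : ∀ c g → compose (xPlus c) g ≈ addP (c ∷ []) g
compose-xPlus c g = addP-congˡ (c ∷ []) (≈-trans (mulP-congˡ g (compose-const 1ℚ g))
  (≈-trans (mulP-comm g (1ℚ ∷ [])) (mulP-identityˡ g)))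

mulP-x : ∀ f → mulP (0ℚ ∷ 1ℚ ∷ []) f ≈ (0ℚ ∷ f)
mulP-x f = ≈-trans (mulP-0∷ˡ (1ℚ ∷ []) f) (∷-cong refl (mulP-identityˡ f))

compose-identityʳ : ∀ f → compose f (0ℚ ∷ 1ℚ ∷ []) ≈ f
compose-identityʳ []      = ≈-refl
compose-identityʳ (a ∷ f) = ≈-trans
  (addP-congˡ (a ∷ []) (≈-trans (mulP-x (compose f (0ℚ ∷ 1ℚ ∷ []))) (∷-cong refl (compose-identityʳ f))))
  (≈-sym (∷-split a f))

compose-identityˡ : ∀ g → compose (0ℚ ∷ 1ℚ ∷ []) g ≈ g
compose-identityˡ g = ≈-trans (compose-xPlus 0ℚ g) (addP-cong 0∷[]≈[] (≈-refl {g}))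

-- `iter` splits off the outermost copy of f; the arguments about f^n as f^(n-1)∘f need the
-- innermost one.
iter-sucʳ : ∀ k f → iter (suc k) f ≈ compose (iter k f) f
iter-sucʳ zero    f = ≈-trans (compose-identityʳ f) (≈-sym (compose-identityˡ f))
iter-sucʳ (suc k) f = ≈-trans (compose-congˡ f (iter-sucʳ k f)) (≈-sym (compose-assoc f (iter k f) f))

-- Evaluation and monomials

eval : Poly → ℚ → ℚ
eval []      x = 0ℚ
eval (a ∷ f) x = a + x * eval f x

coeff₀-mulP : ∀ f g → coeff (mulP f g) 0 ≡ coeff f 0 * coeff g 0
coeff₀-mulP []      g = sym (ℚP.*-zeroˡ (coeff g 0))
coeff₀-mulP (a ∷ f) g = trans (coeff-addP (scaleP a g) (0ℚ ∷ mulP f g) 0)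
  (trans (ℚP.+-identityʳ _) (coeff-scaleP a g 0))

coeff₀-compose : ∀ f g → coeff (compose f g) 0 ≡ eval f (coeff g 0)
coeff₀-compose []      g = refl
coeff₀-compose (a ∷ f) g = trans (coeff-addP (a ∷ []) (mulP g (compose f g)) 0)
  (cong (λ z → a + z) (trans (coeff₀-mulP g (compose f g)) (cong (coeff g 0 *_) (coeff₀-compose f g))))

mono : ℚ → ℕ → Poly
mono c zero    = c ∷ []
mono c (suc k) = 0ℚ ∷ mono c k

coeff-mono : ∀ c k → coeff (mono c k) k ≡ c
coeff-mono c zero    = refl
coeff-mono c (suc k) = coeff-mono c k

coeff-mono-≢ : ∀ c k i → i ≢ k → coeff (mono c k) i ≡ 0ℚ
coeff-mono-≢ c zero    zero    i≢k = contradiction refl i≢k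
coeff-mono-≢ c zero    (suc i) i≢k = refl
coeff-mono-≢ c (suc k) zero    i≢k = refl
coeff-mono-≢ c (suc k) (suc i) i≢k = coeff-mono-≢ c k i (λ e → i≢k (cong suc e))

scaleP-mono : ∀ c d k → scaleP c (mono d k) ≈ mono (c * d) k
scaleP-mono c d zero    = ≈-refl
scaleP-mono c d (suc k) = ∷-cong (ℚP.*-zeroʳ c) (scaleP-mono c d k)

mulP-mono : ∀ c d j k → mulP (mono c j) (mono d k) ≈ mono (c * d) (j ℕ.+ k)
mulP-mono c d zero    k = ≈-trans (mulP-constˡ c (mono d k)) (scaleP-mono c d k)
mulP-mono c d (suc j) k = ≈-trans (mulP-0∷ˡ (mono c j) (mono d k)) (∷-cong refl (mulP-mono c d j k))

compose-mono : ∀ c k d t → compose (mono c k) (mono d t) ≈ mono (c * powQ d k) (k ℕ.* t)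
compose-mono c zero    d t rewrite ℚP.*-identityʳ c = compose-const c (mono d t)
compose-mono c (suc k) d t = begin
  compose (0ℚ ∷ mono c k) (mono d t)                ≈⟨ compose-0∷ (mono c k) (mono d t) ⟩
  mulP (mono d t) (compose (mono c k) (mono d t))   ≈⟨ mulP-congˡ (mono d t) (compose-mono c k d t) ⟩
  mulP (mono d t) (mono (c * powQ d k) (k ℕ.* t))   ≈⟨ mulP-mono d (c * powQ d k) t (k ℕ.* t) ⟩
  mono (d * (c * powQ d k)) (t ℕ.+ k ℕ.* t)         ≡⟨ cong (λ z → mono z (t ℕ.+ k ℕ.* t)) (swap d c (powQ d k)) ⟩
  mono (c * (d * powQ d k)) (t ℕ.+ k ℕ.* t)         ∎
  where
  open ≈-Reasoning
  swap : ∀ (a b c : ℚ) → a * (b * c) ≡ b * (a * c)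
  swap = solve-∀ ℚ-ring

coeff-mulP-mono : ∀ c j f i → coeff (mulP (mono c j) f) (j ℕ.+ i) ≡ c * coeff f i
coeff-mulP-mono c zero    f i = trans (at (mulP-constˡ c f) i) (coeff-scaleP c f i)
coeff-mulP-mono c (suc j) f i = trans (at (mulP-0∷ˡ (mono c j) f) (suc j ℕ.+ i)) (coeff-mulP-mono c j f i)

-- For t > 0 the substitution of d x^t sends different exponents i to different exponents i t, so no
-- two terms of f collide.
coeff-compose-mono : ∀ f d t i → .{{NonZero t}} → coeff (compose f (mono d t)) (i ℕ.* t) ≡ coeff f i * powQ d i
coeff-compose-mono []      d t       i       = sym (ℚP.*-zeroˡ (powQ d i))
coeff-compose-mono (a ∷ f) d (suc t) zero    = begin
  coeff (addP (a ∷ []) (mulP (mono d (suc t)) F)) 0   ≡⟨ coeff-addP (a ∷ []) (mulP (mono d (suc t)) F) 0 ⟩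
  a + coeff (mulP (mono d (suc t)) F) 0               ≡⟨ cong (λ z → a + z) (at (mulP-0∷ˡ (mono d t) F) 0) ⟩
  a + 0ℚ                                              ≡⟨ ℚP.+-identityʳ a ⟩
  a                                                   ≡⟨ ℚP.*-identityʳ a ⟨
  a * 1ℚ                                              ∎
  where
  open ≡-Reasoning
  F = compose f (mono d (suc t))
coeff-compose-mono (a ∷ f) d (suc t) (suc i) = begin
  coeff (addP (a ∷ []) (mulP (mono d (suc t)) F)) (suc t ℕ.+ i ℕ.* suc t)
    ≡⟨ coeff-addP (a ∷ []) (mulP (mono d (suc t)) F) (suc t ℕ.+ i ℕ.* suc t) ⟩
  0ℚ + coeff (mulP (mono d (suc t)) F) (suc t ℕ.+ i ℕ.* suc t)
    ≡⟨ ℚP.+-identityˡ _ ⟩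
  coeff (mulP (mono d (suc t)) F) (suc t ℕ.+ i ℕ.* suc t)
    ≡⟨ coeff-mulP-mono d (suc t) F (i ℕ.* suc t) ⟩
  d * coeff F (i ℕ.* suc t)
    ≡⟨ cong (d *_) (coeff-compose-mono f d (suc t) i) ⟩
  d * (coeff f i * powQ d i)
    ≡⟨ swap d (coeff f i) (powQ d i) ⟩
  coeff f i * (d * powQ d i) ∎
  where
  open ≡-Reasoning
  F = compose f (mono d (suc t))
  swap : ∀ (a b c : ℚ) → a * (b * c) ≡ b * (a * c)
  swap = solve-∀ ℚ-ring

-- Gauss valuations and their behaviour under composition

module Filtration (p : ℕ) (p-prime : Prime p) where
  open Valuation p p-prime

  -- W N s m f says that f has value at least m when p has value N and x has value s;
  -- in particular W 0 (-1) (-d) f says that f has degree at most d.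
  record W (N : ℕ) (s m : ℤ) (f : Poly) : Set where
    constructor mkW
    field coef : ∀ i → L N (m ℤ.- s ℤ.* + i) (coeff f i)
  open W public

  W-≈ : ∀ {N s m f g} → f ≈ g → W N s m f → W N s m g
  W-≈ {N} {s} {m} (mk≈ e) (mkW w) = mkW λ i → subst (L N _) (e i) (w i)

  W-≡ : ∀ {N s m n f} → m ≡ n → W N s m f → W N s n f
  W-≡ refl w = w

  W-≤ : ∀ {N s m n f} → m ℤ.≤ n → W N s n f → W N s m f
  W-≤ {s = s} m≤n (mkW w) = mkW λ i → L-≤ (ℤP.+-monoˡ-≤ (ℤ.- (s ℤ.* + i)) m≤n) (w i)

  W-[] : ∀ {N s m} → W N s m []
  W-[] = mkW λ i → L-0

  W-addP : ∀ {N s m f g} → W N s m f → W N s m g → W N s m (addP f g)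
  W-addP {N} {f = f} {g} (mkW w) (mkW w′) = mkW λ i → subst (L N _) (sym (coeff-addP f g i)) (L-+ (w i) (w′ i))

  W-scaleP : ∀ {N s k m c f} → L N k c → W N s m f → W N s (k ℤ.+ m) (scaleP c f)
  W-scaleP {N} {s} {k} {m} {c} {f} l (mkW w) = mkW λ i → subst₂ (L N) (sym (ℤP.+-assoc k m _)) (sym (coeff-scaleP c f i)) (L-* l (w i))

  W-negP : ∀ {N s m f} → W N s m f → W N s m (negP f)
  W-negP {N} {f = f} (mkW w) = mkW λ i → subst (L N _) (sym (coeff-negP f i)) (L-neg (w i))

  W-subP : ∀ {N s m f g} → W N s m f → W N s m g → W N s m (subP f g)
  W-subP w w′ = W-addP w (W-negP w′)

  private
    head-weight : ∀ m s → m ≡ m ℤ.- s ℤ.* + 0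
    head-weight = solveℤ

    tail-weight : ∀ m s i → (m ℤ.- s) ℤ.- s ℤ.* i ≡ m ℤ.- s ℤ.* (+ 1 ℤ.+ i)
    tail-weight = solveℤ

  W-∷ : ∀ {N s m a f} → L N m a → W N s (m ℤ.- s) f → W N s m (a ∷ f)
  W-∷ {N} {s} {m} {a} {f} l (mkW w) = mkW λ
    { zero    → subst (λ k → L N k a) (head-weight m s) l
    ; (suc i) → subst (λ k → L N k (coeff f i)) (tail-weight m s (+ i)) (w i) }

  W-head : ∀ {N s m f} → W N s m f → L N m (coeff f 0)
  W-head {N} {s} {m} {f} (mkW w) = subst (λ k → L N k (coeff f 0)) (sym (head-weight m s)) (w 0)

  W-tail : ∀ {N s m a f} → W N s m (a ∷ f) → W N s (m ℤ.- s) f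
  W-tail {N} {s} {m} {a} {f} (mkW w) = mkW λ i → subst (λ k → L N k (coeff f i)) (sym (tail-weight m s (+ i))) (w (suc i))

  W-const : ∀ {N s m a} → L N m a → W N s m (a ∷ [])
  W-const l = W-∷ l W-[]

  W-mulP : ∀ {N s m n} f {g} → W N s m f → W N s n g → W N s (m ℤ.+ n) (mulP f g)
  W-mulP []      w w′ = W-[]
  W-mulP {N} {s} {m} {n} (a ∷ f) w w′ = W-addP (W-scaleP (W-head w) w′)
    (W-∷ L-0 (W-≡ (lem m n s) (W-mulP f (W-tail w) w′)))
    where
    lem : ∀ m n s → (m ℤ.- s) ℤ.+ n ≡ (m ℤ.+ n) ℤ.- s
    lem = solveℤ

  private
    s+[m-s]≡m : ∀ s m → s ℤ.+ (m ℤ.- s) ≡ m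
    s+[m-s]≡m = solveℤ

  -- The weight that f gives to x is the value of g, while the weight t of the inner x is free.
  -- Chaining different weights in this way is what makes iterates tractable.
  W-compose : ∀ {N s t m} f {g} → W N s m f → W N t s g → W N t m (compose f g)
  W-compose []      w w′ = W-[]
  W-compose {s = s} {m = m} (a ∷ f) {g} w w′ = W-addP (W-const (W-head w))
    (W-≡ (s+[m-s]≡m s m) (W-mulP g w′ (W-compose f (W-tail w) w′)))

  -- Horner's rule reduces the claim to g G - h H = (g - h) G + h (G - H): an inner change that
  -- gains δ over the value of g gains δ after composition.
  W-compose-subP : ∀ {N s t m δ} f {g h} → W N s m f → W N t s g → W N t s h →
    W N t (s ℤ.+ δ) (subP g h) → W N t (m ℤ.+ δ) (subP (compose f g) (compose f h))
  W-compose-subP []      wf wg wh w = W-[]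
  W-compose-subP {s = s} {m = m} {δ} (a ∷ f) {g} {h} wf wg wh w = W-≈ (≈-sym (split (a ∷ []) g h (compose f g) (compose f h)))
    (W-addP (W-≡ (lem₁ s m δ) (W-mulP (subP g h) w (W-compose f (W-tail wf) wg)))
            (W-≡ (lem₂ s m δ) (W-mulP h wh (W-compose-subP f (W-tail wf) wg wh w))))
    where
    split : ∀ c g h G H → subP (addP c (mulP g G)) (addP c (mulP h H)) ≈ addP (mulP (subP g h) G) (mulP h (subP G H))
    split = solve-∀ poly-ring
    lem₁ : ∀ s m δ → (s ℤ.+ δ) ℤ.+ (m ℤ.- s) ≡ m ℤ.+ δ
    lem₁ = solveℤ
    lem₂ : ∀ s m δ → s ℤ.+ ((m ℤ.- s) ℤ.+ δ) ≡ m ℤ.+ δ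
    lem₂ = solveℤ

  W-mono : ∀ {N s m c} k → L N (m ℤ.- s ℤ.* + k) c → W N s m (mono c k)
  W-mono {N} {s} {m} {c} k l = mkW go
    where
    go : ∀ i → L N (m ℤ.- s ℤ.* + i) (coeff (mono c k) i)
    go i with i ℕP.≟ k
    ... | yes refl = subst (L N _) (sym (coeff-mono c i)) l
    ... | no  i≢k  = subst (L N _) (sym (coeff-mono-≢ c k i i≢k)) L-0

  W-subP-mono : ∀ {N s m} f k → (∀ i → i ≢ k → L N (m ℤ.- s ℤ.* + i) (coeff f i)) →
    W N s m (subP f (mono (coeff f k) k))
  W-subP-mono {N} {s} {m} f k l = mkW go
    where
    go : ∀ i → L N (m ℤ.- s ℤ.* + i) (coeff (subP f (mono (coeff f k) k)) i)
    go i with i ℕP.≟ k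
    ... | yes refl = subst (L N _) (sym (trans (coeff-subP f (mono (coeff f i) i) i)
      (trans (cong (λ z → coeff f i - z) (coeff-mono (coeff f i) i)) (ℚP.+-inverseʳ (coeff f i))))) L-0
    ... | no  i≢k  = subst (L N _) (sym (trans (coeff-subP f (mono (coeff f k) k) i)
      (trans (cong (λ z → coeff f i - z) (coeff-mono-≢ (coeff f k) k i i≢k)) (ℚP.+-identityʳ (coeff f i))))) (l i i≢k)

  -- The initial form of a composite is the composite of the initial forms, when both are monomials.
  W-compose-initial : ∀ {N s t m} f {a k g b j} →
    W N s (m ℤ.+ + 1) (subP f (mono a k)) → W N s m (mono a k) →
    W N t s g → W N t s (mono b j) → W N t (s ℤ.+ + 1) (subP g (mono b j)) →
    W N t (m ℤ.+ + 1) (subP (compose f g) (mono (a * powQ b k) (k ℕ.* j)))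
  W-compose-initial f {a} {k} {g} {b} {j} wf wa wg wb wd =
    W-≈ (≈-trans (addP-cong (compose-subP f (mono a k) g) (addP-congˡ (compose (mono a k) g) (scaleP-cong (- 1ℚ) (compose-mono a k b j))))
      (telescope (compose f g) (compose (mono a k) g) (mono (a * powQ b k) (k ℕ.* j))))
      (W-addP (W-compose (subP f (mono a k)) wf wg) (W-compose-subP (mono a k) wa wg wb wd))
    where
    telescope : ∀ f g h → addP (subP f g) (subP g h) ≈ subP f h
    telescope = solve-∀ poly-ring

  W-coeff : ∀ {N s m f} c k → W N s m (subP f (mono c k)) → L N (m ℤ.- s ℤ.* + k) (coeff f k - c)
  W-coeff {N} {f = f} c k (mkW w) = subst (L N _) (trans (coeff-subP f (mono c k) k) (cong (λ z → coeff f k - z) (coeff-mono c k))) (w k)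

-- Degrees and p-integrality from iterates

powQ-* : ∀ x y n → powQ (x * y) n ≡ powQ x n * powQ y n
powQ-* x y zero    = refl
powQ-* x y (suc n) = trans (cong (x * y *_) (powQ-* x y n)) (lem x y (powQ x n) (powQ y n))
  where
  lem : ∀ (x y a b : ℚ) → x * y * (a * b) ≡ x * a * (y * b)
  lem = solve-∀ ℚ-ring

powQ-+ : ∀ x m n → powQ x (m ℕ.+ n) ≡ powQ x m * powQ x n
powQ-+ x zero    n = sym (ℚP.*-identityˡ (powQ x n))
powQ-+ x (suc m) n = trans (cong (x *_) (powQ-+ x m n)) (sym (ℚP.*-assoc x (powQ x m) (powQ x n)))

powQ-powQ : ∀ x m n → powQ (powQ x m) n ≡ powQ x (n ℕ.* m)
powQ-powQ x m zero    = refl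
powQ-powQ x m (suc n) = trans (cong (powQ x m *_) (powQ-powQ x m n)) (sym (powQ-+ x m (n ℕ.* m)))

x-y≡0⇒x≡y : ∀ {x y} → x - y ≡ 0ℚ → x ≡ y
x-y≡0⇒x≡y {x} {y} e = trans (lem x y) (trans (cong (_+ y) e) (ℚP.+-identityˡ y))
  where
  lem : ∀ (x y : ℚ) → x ≡ (x - y) + y
  lem = solve-∀ ℚ-ring

subP-addP : ∀ f g → addP (subP f g) g ≈ f
subP-addP = solve-∀ poly-ring

<⇒∃ : ∀ {i j} → i < j → ∃ λ k → j ≡ i ℕ.+ suc k
<⇒∃ {i} {j} i<j = let k , e = ℕP.m≤n⇒∃[o]m+o≡n i<j in k , trans (sym e) (sym (ℕP.+-suc i k))

DegreeAtMost : ℕ → Poly → Set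
DegreeAtMost d f = ∀ i → d < i → coeff f i ≡ 0ℚ

-- This is 1 + d + ... + d^(k-1), the power of the leading coefficient of f that leads f^k.
lead-exponent : ℕ → ℕ → ℕ
lead-exponent d zero    = 0
lead-exponent d (suc k) = suc (d ℕ.* lead-exponent d k)

module Integrality (p : ℕ) (p-prime : Prime p) where
  open Valuation p p-prime
  open Filtration p p-prime

  L0-≤0 : ∀ {k q} → k ℤ.≤ + 0 → L 0 k q
  L0-≤0 {k} k≤0 = mkL λ {v} e → subst (k ℤ.≤_) (sym (ℤP.*-zeroˡ v)) k≤0

  L0-zero : ∀ {k q} → + 1 ℤ.≤ k → L 0 k q → q ≡ 0ℚ
  L0-zero {k} {q} 1≤k (mkL b) with ν p q in eq
  ... | ∞     = ν≡∞⇒≡0 q eq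
  ... | fin v = contradiction (subst (k ℤ.≤_) (ℤP.*-zeroˡ v) (b refl)) λ k≤0 → i+1≰i (+ 0) (ℤP.≤-trans 1≤k k≤0)

  -- The case of weight 0 for p. With x of weight -1 in g and -t in f, the leading monomials are the
  -- initial forms, so `W-compose-initial` yields the degree bound and the leading coefficient
  -- together.
  compose-degree : ∀ {d t} f g → 1 ≤ t → DegreeAtMost d f → DegreeAtMost t g →
    DegreeAtMost (d ℕ.* t) (compose f g) × coeff (compose f g) (d ℕ.* t) ≡ coeff f d * powQ (coeff g t) d
  compose-degree {d} {t} f g 1≤t df dg = above , leading
    where
    c = coeff f d * powQ (coeff g t) d
    m = ℤ.- (+ d ℤ.* + t)
    outer : ∀ i → i ≢ d → L 0 ((m ℤ.+ + 1) ℤ.- (ℤ.- + t) ℤ.* + i) (coeff f i)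
    outer i i≢d with ℕP.<-cmp i d
    ... | tri≈ _ i≡d _ = contradiction i≡d i≢d
    ... | tri> _ _ d<i = subst (L 0 _) (sym (df i d<i)) L-0
    ... | tri< i<d _ _ with <⇒∃ i<d | <⇒∃ 1≤t
    ...   | k , refl | t′ , refl = L0-≤0 (≤-by (+ k ℤ.* (+ 1 ℤ.+ + t′) ℤ.+ + t′) (0≤-+ (0≤-* (0≤pos {k}) 0≤pos) 0≤pos)
            (lem (+ i) (+ k) (+ t′)))
      where
      lem : ∀ i k t → + 0 ≡ (((ℤ.- ((i ℤ.+ (+ 1 ℤ.+ k)) ℤ.* (+ 1 ℤ.+ t))) ℤ.+ + 1) ℤ.- (ℤ.- (+ 1 ℤ.+ t)) ℤ.* i)
            ℤ.+ (k ℤ.* (+ 1 ℤ.+ t) ℤ.+ t)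
      lem = solveℤ
    inner : ∀ i → i ≢ t → L 0 ((ℤ.- + t ℤ.+ + 1) ℤ.- (ℤ.- + 1) ℤ.* + i) (coeff g i)
    inner i i≢t with ℕP.<-cmp i t
    ... | tri≈ _ i≡t _ = contradiction i≡t i≢t
    ... | tri> _ _ t<i = subst (L 0 _) (sym (dg i t<i)) L-0
    ... | tri< i<t _ _ with <⇒∃ i<t
    ...   | k , refl = L0-≤0 (≤-by (+ k) 0≤pos (lem (+ i) (+ k)))
      where
      lem : ∀ i k → + 0 ≡ ((ℤ.- (i ℤ.+ (+ 1 ℤ.+ k)) ℤ.+ + 1) ℤ.- (ℤ.- + 1) ℤ.* i) ℤ.+ k
      lem = solveℤ
    mono-g : W 0 (ℤ.- + 1) (ℤ.- + t) (mono (coeff g t) t)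
    mono-g = W-mono t (L0-≤0 (ℤP.≤-reflexive (lem (+ t))))
      where
      lem : ∀ t → (ℤ.- t) ℤ.- (ℤ.- + 1) ℤ.* t ≡ + 0
      lem = solveℤ
    mono-f : W 0 (ℤ.- + t) m (mono (coeff f d) d)
    mono-f = W-mono d (L0-≤0 (ℤP.≤-reflexive (lem (+ d) (+ t))))
      where
      lem : ∀ d t → (ℤ.- (d ℤ.* t)) ℤ.- (ℤ.- t) ℤ.* d ≡ + 0
      lem = solveℤ
    diff-g : W 0 (ℤ.- + 1) (ℤ.- + t ℤ.+ + 1) (subP g (mono (coeff g t) t))
    diff-g = W-subP-mono g t inner
    whole-g : W 0 (ℤ.- + 1) (ℤ.- + t) g
    whole-g = W-≈ (subP-addP g (mono (coeff g t) t)) (W-addP (W-≤ (≤-by (+ 1) 0≤pos refl) diff-g) mono-g)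
    result : W 0 (ℤ.- + 1) (m ℤ.+ + 1) (subP (compose f g) (mono c (d ℕ.* t)))
    result = W-compose-initial f (W-subP-mono f d outer) mono-f whole-g mono-g diff-g
    -- From exponent d t on, the required weight is at least 1. When p weighs 0 this forces the
    -- coefficient of the difference to vanish.
    big : ∀ i k → i ≡ (d ℕ.* t) ℕ.+ k → + 1 ℤ.≤ (m ℤ.+ + 1) ℤ.- (ℤ.- + 1) ℤ.* + i
    big i k refl = ≤-by (+ k) 0≤pos
      (trans (cong (λ z → (m ℤ.+ + 1) ℤ.- (ℤ.- + 1) ℤ.* (z ℤ.+ + k)) (ℤP.pos-* d t)) (lem (+ d) (+ t) (+ k)))
      where
      lem : ∀ d t k → ((ℤ.- (d ℤ.* t)) ℤ.+ + 1) ℤ.- (ℤ.- + 1) ℤ.* (d ℤ.* t ℤ.+ k) ≡ + 1 ℤ.+ k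
      lem = solveℤ
    leading : coeff (compose f g) (d ℕ.* t) ≡ c
    leading = x-y≡0⇒x≡y (L0-zero (big (d ℕ.* t) 0 (sym (ℕP.+-identityʳ _))) (W-coeff c (d ℕ.* t) result))
    above : DegreeAtMost (d ℕ.* t) (compose f g)
    above i dt<i with <⇒∃ dt<i
    ... | k , e = trans (x-y≡0⇒x≡y (trans (sym (coeff-subP (compose f g) (mono c (d ℕ.* t)) i)) (L0-zero (big i (suc k) e) (coef result i))))
                    (coeff-mono-≢ c (d ℕ.* t) i (λ i≡ → ℕP.<-irrefl (sym i≡) dt<i))

  iter-degree : ∀ {d} f → 1 ≤ d → DegreeAtMost d f → ∀ k → DegreeAtMost (d ^ k) (iter k f)
  iter-degree f 1≤d df zero    zero          ()
  iter-degree f 1≤d df zero    (suc zero)    (s≤s ())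
  iter-degree f 1≤d df zero    (suc (suc i)) _ = refl
  iter-degree {d} f 1≤d df (suc k) = proj₁ (compose-degree f (iter k f) (ℕP.m^n>0 d {{ℕ.>-nonZero 1≤d}} k) df (iter-degree f 1≤d df k))

  iter-lead : ∀ {d} f → 1 ≤ d → DegreeAtMost d f → ∀ k → coeff (iter k f) (d ^ k) ≡ powQ (coeff f d) (lead-exponent d k)
  iter-lead f 1≤d df zero = refl
  iter-lead {d} f 1≤d df (suc k) = begin
    coeff (iter (suc k) f) (d ^ suc k)
      ≡⟨ proj₂ (compose-degree f (iter k f) (ℕP.m^n>0 d {{ℕ.>-nonZero 1≤d}} k) df (iter-degree f 1≤d df k)) ⟩
    a * powQ (coeff (iter k f) (d ^ k)) d
      ≡⟨ cong (λ z → a * powQ z d) (iter-lead f 1≤d df k) ⟩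
    a * powQ (powQ a (lead-exponent d k)) d
      ≡⟨ cong (a *_) (powQ-powQ a (lead-exponent d k) d) ⟩
    powQ a (lead-exponent d (suc k)) ∎
    where
    open ≡-Reasoning
    a = coeff f d

  Integral : Poly → Set
  Integral f = ∀ i → V (+ 0) (coeff f i)

  bounded-below : ∀ q → ∃ λ l → V (ℤ.- + l) q
  bounded-below q with ν p q in eq
  ... | ∞            = 0 , mkL λ e → contradiction (trans (sym eq) e) λ ()
  ... | fin (+ n)    = 0 , L-ν eq (subst (+ 0 ℤ.≤_) (sym (ℤP.*-identityˡ (+ n))) 0≤pos)
  ... | fin -[1+ n ] = suc n , L-ν eq (ℤP.≤-reflexive (sym (ℤP.*-identityˡ -[1+ n ])))

  coeffs-bounded-below : ∀ f → ∃ λ l → ∀ i → V (ℤ.- + l) (coeff f i)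
  coeffs-bounded-below []      = 0 , λ i → L-0
  coeffs-bounded-below (a ∷ f) =
    let k , va = bounded-below a
        l , vf = coeffs-bounded-below f
    in k ℕ.+ l , λ
      { zero    → L-≤ (≤-by (+ l) 0≤pos (lem₁ (+ k) (+ l))) va
      ; (suc i) → L-≤ (≤-by (+ k) 0≤pos (lem₂ (+ k) (+ l))) (vf i) }
    where
    lem₁ : ∀ k l → ℤ.- k ≡ ℤ.- (k ℤ.+ l) ℤ.+ l
    lem₁ = solveℤ
    lem₂ : ∀ k l → ℤ.- l ≡ ℤ.- (k ℤ.+ l) ℤ.+ k
    lem₂ = solveℤ

  -- With weight -1 on x the value of f is m < 0, and the leading term dominates f∘g whenever g has value M ≤ m;
  -- hence the initial form of every iterate comes from that of f.
  module _ {d} (f : Poly) (2≤d : 2 ≤ d) (df : DegreeAtMost d f) (ulead : U (coeff f d))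
    {N : ℕ} {m : ℤ} (m≤-1 : m ℤ.≤ ℤ.- + 1) (wf : W N (ℤ.- + 1) m f) where

    outer-dominated : ∀ {M} → M ℤ.≤ m → W N M (+ d ℤ.* M ℤ.+ + 1) (subP f (mono (coeff f d) d))
    outer-dominated {M} M≤m = W-subP-mono f d go
      where
      0≤m-M = ℤP.i≤j⇒0≤j-i M≤m
      0≤-M-1 : + 0 ℤ.≤ (ℤ.- + 1) ℤ.- M
      0≤-M-1 = ℤP.i≤j⇒0≤j-i (ℤP.≤-trans M≤m m≤-1)
      0≤-M : + 0 ℤ.≤ ℤ.- M
      0≤-M = ℤP.≤-trans 0≤-M-1 (≤-by (+ 1) 0≤pos (lem M))
        where
        lem : ∀ M → ℤ.- M ≡ ((ℤ.- + 1) ℤ.- M) ℤ.+ + 1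
        lem = solveℤ
      go : ∀ i → i ≢ d → L N ((+ d ℤ.* M ℤ.+ + 1) ℤ.- M ℤ.* + i) (coeff f i)
      go i i≢d with ℕP.<-cmp i d
      ... | tri≈ _ i≡d _ = contradiction i≡d i≢d
      ... | tri> _ _ d<i = subst (L N _) (sym (df i d<i)) L-0
      -- The constant term gains no weight from its exponent; here 2 ≤ d is what keeps it strictly
      -- above the leading term.
      go zero i≢d | tri< _ _ _ with <⇒∃ 2≤d
      ... | k , refl = L-≤ (≤-by ((m ℤ.- M) ℤ.+ ((ℤ.- + 1) ℤ.- M) ℤ.+ + k ℤ.* (ℤ.- M))
              (0≤-+ (0≤-+ 0≤m-M 0≤-M-1) (0≤-* (0≤pos {k}) 0≤-M)) (lem m M (+ k))) (coef wf 0)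
        where
        lem : ∀ m M k → m ℤ.- (ℤ.- + 1) ℤ.* + 0 ≡
          (((+ 1 ℤ.+ (+ 1 ℤ.+ k)) ℤ.* M ℤ.+ + 1) ℤ.- M ℤ.* + 0) ℤ.+ ((m ℤ.- M) ℤ.+ ((ℤ.- + 1) ℤ.- M) ℤ.+ k ℤ.* (ℤ.- M))
        lem = solveℤ
      go (suc i) i≢d | tri< i<d _ _ with <⇒∃ i<d
      ... | k , refl = L-≤ (≤-by ((m ℤ.- M) ℤ.+ + i ℤ.+ + k ℤ.* (ℤ.- M))
              (0≤-+ (0≤-+ 0≤m-M 0≤pos) (0≤-* (0≤pos {k}) 0≤-M)) (lem m M (+ i) (+ k))) (coef wf (suc i))
        where
        lem : ∀ m M i k → m ℤ.- (ℤ.- + 1) ℤ.* (+ 1 ℤ.+ i) ≡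
          ((((+ 1 ℤ.+ i) ℤ.+ (+ 1 ℤ.+ k)) ℤ.* M ℤ.+ + 1) ℤ.- M ℤ.* (+ 1 ℤ.+ i)) ℤ.+ ((m ℤ.- M) ℤ.+ i ℤ.+ k ℤ.* (ℤ.- M))
        lem = solveℤ

    mono-lead : ∀ M → W N M (+ d ℤ.* M) (mono (coeff f d) d)
    mono-lead M = W-mono d (L-≤ (ℤP.≤-reflexive (lem (+ d) M)) (U⇒L ulead))
      where
      lem : ∀ d M → d ℤ.* M ℤ.- M ℤ.* d ≡ + 0
      lem = solveℤ

    -- Only the innermost copy of f contributes its term in x^j. Every outer copy contributes its
    -- leading term, and `u` collects the resulting unit factors.
    iter-initial : ∀ {j} → W N (ℤ.- + 1) (m ℤ.+ + 1) (subP f (mono (coeff f j) j)) → ∀ k →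
      ∃ λ u → U u × + (d ^ k) ℤ.* m ℤ.≤ m × W N (ℤ.- + 1) (+ (d ^ k) ℤ.* m) (iter (suc k) f) ×
        W N (ℤ.- + 1) (+ (d ^ k) ℤ.* m ℤ.+ + 1) (subP (iter (suc k) f) (mono (u * powQ (coeff f j) (d ^ k)) (d ^ k ℕ.* j)))
    iter-initial {j} wj zero = 1ℚ , U-1 , ℤP.≤-reflexive (ℤP.*-identityˡ m) ,
      W-≡ (sym (ℤP.*-identityˡ m)) (W-≈ (≈-sym (compose-identityʳ f)) wf) ,
      W-≡ (cong (ℤ._+ + 1) (sym (ℤP.*-identityˡ m))) (W-≈ same wj)
      where
      same : subP f (mono (coeff f j) j) ≈ subP (iter 1 f) (mono (1ℚ * (coeff f j * 1ℚ)) (1 ℕ.* j))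
      same rewrite ℚP.*-identityˡ (coeff f j * 1ℚ) | ℚP.*-identityʳ (coeff f j) | ℕP.*-identityˡ j =
        addP-cong (≈-sym (compose-identityʳ f)) ≈-refl
    iter-initial {j} wj (suc k) with iter-initial wj k
    ... | u , uu , M≤m , wg , wd = coeff f d * powQ u d , U-* ulead (U-pow d uu) , dM≤m ,
      W-≡ M′≡ (W-compose f whole-f wg) ,
      subst₂ (λ c e → W N (ℤ.- + 1) (M′ ℤ.+ + 1) (subP (iter (suc (suc k)) f) (mono c e)))
        coefficient (sym (ℕP.*-assoc d (d ^ k) j))
        (W-≡ (cong (ℤ._+ + 1) M′≡) (W-compose-initial f (outer-dominated M≤m) (mono-lead M) wg wmono wd))
      where
      y  = coeff f j
      M  = + (d ^ k) ℤ.* m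
      M′ = + (d ^ suc k) ℤ.* m
      M′≡ : + d ℤ.* M ≡ M′
      M′≡ = trans (sym (ℤP.*-assoc (+ d) (+ (d ^ k)) m)) (cong (ℤ._* m) (sym (ℤP.pos-* d (d ^ k))))
      whole-f : W N M (+ d ℤ.* M) f
      whole-f = W-≈ (subP-addP f (mono (coeff f d) d))
        (W-addP (W-≤ (≤-by (+ 1) 0≤pos refl) (outer-dominated M≤m)) (mono-lead M))
      wmono : W N (ℤ.- + 1) M (mono (u * powQ y (d ^ k)) (d ^ k ℕ.* j))
      wmono = W-≈ (cancel (iter (suc k) f) (mono (u * powQ y (d ^ k)) (d ^ k ℕ.* j)))
        (W-subP wg (W-≤ (≤-by (+ 1) 0≤pos refl) wd))
        where
        cancel : ∀ f g → subP f (subP f g) ≈ g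
        cancel = solve-∀ poly-ring
      coefficient : coeff f d * powQ (u * powQ y (d ^ k)) d ≡ coeff f d * powQ u d * powQ y (d ^ suc k)
      coefficient = trans (cong (coeff f d *_) (trans (powQ-* u (powQ y (d ^ k)) d) (cong (powQ u d *_) (powQ-powQ y (d ^ k) d))))
        (sym (ℚP.*-assoc (coeff f d) (powQ u d) (powQ y (d ^ suc k))))
      dM≤m : M′ ℤ.≤ m
      dM≤m with <⇒∃ 2≤d
      ... | e , refl = ℤP.≤-trans (ℤP.≤-reflexive (sym M′≡)) (ℤP.≤-trans (≤-by (+ (suc e) ℤ.* (ℤ.- M)) (0≤-* (0≤pos {suc e}) 0≤-M) (lem (+ e) M)) M≤m)
        where
        0≤-M : + 0 ℤ.≤ ℤ.- M
        0≤-M = ℤP.neg-mono-≤ {M} {+ 0} (ℤP.≤-trans M≤m (ℤP.≤-trans m≤-1 ℤ.-≤+))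
        lem : ∀ e M → M ≡ (+ 1 ℤ.+ (+ 1 ℤ.+ e)) ℤ.* M ℤ.+ (+ 1 ℤ.+ e) ℤ.* (ℤ.- M)
        lem = solveℤ

  module _ {d} (f : Poly) (2≤d : 2 ≤ d) (df : DegreeAtMost d f) (ulead : U (coeff f d))
    {n} (int : Integral (iter (suc n) f)) where

    -- The weight d + 1 of p exceeds every exponent that occurs, so with x of weight -1 terms are
    -- compared first by their power of p and then by their exponent. If ν(a_j) were still -(l+1),
    -- the term in x^j would be the unique one of least value m, and its power in the iterate would
    -- contradict integrality.
    clear-denominators : ∀ l → (∀ i → V (ℤ.- + suc l) (coeff f i)) →
      ∀ j → (∀ i → j < i → V (ℤ.- + l) (coeff f i)) → V (ℤ.- + l) (coeff f j)
    clear-denominators l vf j vj with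
      iter-initial f 2≤d df ulead {suc d} {m} m≤-1 (mkW wf) {j} (W-subP-mono f j wj) n
      where
      k = ℤ.- + suc l
      m = + suc d ℤ.* k ℤ.- + j
      m≤-1 : m ℤ.≤ ℤ.- + 1
      m≤-1 = ≤-by (+ d ℤ.* (+ 1 ℤ.+ + l) ℤ.+ + l ℤ.+ + j) (0≤-+ (0≤-+ (0≤-* (0≤pos {d}) 0≤pos) 0≤pos) 0≤pos) (lem (+ d) (+ l) (+ j))
        where
        lem : ∀ d l j → ℤ.- + 1 ≡ ((+ 1 ℤ.+ d) ℤ.* (ℤ.- (+ 1 ℤ.+ l)) ℤ.- j) ℤ.+ (d ℤ.* (+ 1 ℤ.+ l) ℤ.+ l ℤ.+ j)
        lem = solveℤ
      below : ∀ i e → i ℕ.+ e ≡ j → L (suc d) ((m ℤ.+ + e) ℤ.- (ℤ.- + 1) ℤ.* + i) (coeff f i)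
      below i e refl = V⇒L (vf i) (ℤP.≤-reflexive (lem (+ suc d ℤ.* k) (+ i) (+ e)))
        where
        lem : ∀ x i e → ((x ℤ.- (i ℤ.+ e)) ℤ.+ e) ℤ.- (ℤ.- + 1) ℤ.* i ≡ x
        lem = solveℤ
      above : ∀ i → j < i → L (suc d) ((m ℤ.+ + 1) ℤ.- (ℤ.- + 1) ℤ.* + i) (coeff f i)
      above i j<i with i ℕP.≤? d
      ... | no  i≰d = subst (L (suc d) _) (sym (df i (ℕP.≰⇒> i≰d))) L-0
      ... | yes i≤d with ℕP.m≤n⇒∃[o]m+o≡n i≤d
      ...   | e , refl = V⇒L (vj i j<i) (≤-by (+ j ℤ.+ + e) 0≤pos (lem (+ l) (+ j) (+ i) (+ e)))
        where
        lem : ∀ l j i e → (+ 1 ℤ.+ (i ℤ.+ e)) ℤ.* (ℤ.- l) ≡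
          ((((+ 1 ℤ.+ (i ℤ.+ e)) ℤ.* (ℤ.- (+ 1 ℤ.+ l)) ℤ.- j) ℤ.+ + 1) ℤ.- (ℤ.- + 1) ℤ.* i) ℤ.+ (j ℤ.+ e)
        lem = solveℤ
      wj : ∀ i → i ≢ j → L (suc d) ((m ℤ.+ + 1) ℤ.- (ℤ.- + 1) ℤ.* + i) (coeff f i)
      wj i i≢j with ℕP.<-cmp i j
      ... | tri≈ _ i≡j _ = contradiction i≡j i≢j
      ... | tri> _ _ j<i = above i j<i
      ... | tri< i<j _ _ with <⇒∃ i<j
      ...   | e , refl = L-≤ (≤-by (+ e) 0≤pos (lem m (+ e) (+ i))) (below i (suc e) refl)
        where
        lem : ∀ m e i → (m ℤ.+ (+ 1 ℤ.+ e)) ℤ.- (ℤ.- + 1) ℤ.* i ≡ ((m ℤ.+ + 1) ℤ.- (ℤ.- + 1) ℤ.* i) ℤ.+ e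
        lem = solveℤ
      wf : ∀ i → L (suc d) (m ℤ.- (ℤ.- + 1) ℤ.* + i) (coeff f i)
      wf i with i ℕP.≟ j
      ... | yes refl = subst (λ z → L (suc d) (z ℤ.- (ℤ.- + 1) ℤ.* + i) (coeff f i)) (ℤP.+-identityʳ m) (below i 0 (ℕP.+-identityʳ i))
      ... | no  i≢j  = L-≤ (≤-by (+ 1) 0≤pos (lem m (+ i))) (wj i i≢j)
        where
        lem : ∀ m i → (m ℤ.+ + 1) ℤ.- (ℤ.- + 1) ℤ.* i ≡ (m ℤ.- (ℤ.- + 1) ℤ.* i) ℤ.+ + 1
        lem = solveℤ
    -- The coefficient at E j of the integral iterate agrees with u y^E up to higher weight. Hence
    -- ν(u y^E) > E k, and `V-root` gives ν(y) > k.
    ... | u , uu , _ , _ , wd = subst (λ z → V z (coeff f j)) (lem (+ l)) (V-root E uu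
          (L⇒V {suc d} (+ E ℤ.* k) ℤP.≤-refl (subst (L (suc d) _) (cancel (coeff (iter (suc n) f) (E ℕ.* j)) (u * powQ y E))
            (L-- (V⇒L (int (E ℕ.* j)) low) (L-≤ (ℤP.≤-reflexive weight) (W-coeff (u * powQ y E) (E ℕ.* j) wd))))))
      where
      E = d ^ n
      k = ℤ.- + suc l
      y = coeff f j
      lem : ∀ l → (ℤ.- (+ 1 ℤ.+ l)) ℤ.+ + 1 ≡ ℤ.- l
      lem = solveℤ
      cancel : ∀ (a b : ℚ) → a - (a - b) ≡ b
      cancel = solve-∀ ℚ-ring
      weight : + suc d ℤ.* (+ E ℤ.* k) ℤ.+ + 1 ≡ (+ E ℤ.* (+ suc d ℤ.* k ℤ.- + j) ℤ.+ + 1) ℤ.- (ℤ.- + 1) ℤ.* + (E ℕ.* j)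
      weight = trans (lem′ (+ suc d) (+ E) k (+ j))
        (cong (λ z → (+ E ℤ.* (+ suc d ℤ.* k ℤ.- + j) ℤ.+ + 1) ℤ.- (ℤ.- + 1) ℤ.* z) (sym (ℤP.pos-* E j)))
        where
        lem′ : ∀ d E k j → d ℤ.* (E ℤ.* k) ℤ.+ + 1 ≡ (E ℤ.* (d ℤ.* k ℤ.- j) ℤ.+ + 1) ℤ.- (ℤ.- + 1) ℤ.* (E ℤ.* j)
        lem′ = solveℤ
      low : + suc d ℤ.* (+ E ℤ.* k) ℤ.+ + 1 ℤ.≤ + suc d ℤ.* + 0
      low with <⇒∃ (ℕP.m^n>0 d {{ℕ.>-nonZero (ℕP.≤-trans (s≤s z≤n) 2≤d)}} n)
      ... | E′ , E≡ rewrite E≡ = ≤-by ((+ 1 ℤ.+ + d) ℤ.* ((+ 1 ℤ.+ + E′) ℤ.* + l ℤ.+ + E′) ℤ.+ + d)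
            (0≤-+ (0≤-* (0≤pos {suc d}) (0≤-+ (0≤-* (0≤pos {suc E′}) (0≤pos {l})) (0≤pos {E′}))) (0≤pos {d})) (lem′ (+ d) (+ E′) (+ l))
        where
        lem′ : ∀ d E l → (+ 1 ℤ.+ d) ℤ.* + 0 ≡ ((+ 1 ℤ.+ d) ℤ.* ((+ 1 ℤ.+ E) ℤ.* (ℤ.- (+ 1 ℤ.+ l))) ℤ.+ + 1)
          ℤ.+ ((+ 1 ℤ.+ d) ℤ.* ((+ 1 ℤ.+ E) ℤ.* l ℤ.+ E) ℤ.+ d)
        lem′ = solveℤ

    integral-of-iterate : Integral f
    integral-of-iterate = let l , vf = coeffs-bounded-below f in descend l vf
      where
      -- Induction from the top coefficient downwards; `k` bounds the distance from `i` to the first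
      -- exponent above d.
      step : ∀ l → (∀ i → V (ℤ.- + suc l) (coeff f i)) → ∀ k i → d < i ℕ.+ k → V (ℤ.- + l) (coeff f i)
      step l vf zero    i d<i = subst (V _) (sym (df i (subst (d <_) (ℕP.+-identityʳ i) d<i))) L-0
      step l vf (suc k) i d<i = clear-denominators l vf i λ i′ i<i′ →
        step l vf k i′ (ℕP.≤-trans d<i (ℕP.≤-trans (ℕP.≤-reflexive (ℕP.+-suc i k)) (ℕP.+-monoˡ-≤ k i<i′)))
      -- Each round removes one factor p from the common denominator.
      descend : ∀ l → (∀ i → V (ℤ.- + l) (coeff f i)) → Integral f
      descend zero    vf = vf
      descend (suc l) vf = descend l λ i → step l vf (suc d) i (ℕP.m≤n+m (suc d) i)

least : (Q : ℕ → Set) → (∀ i → Dec (Q i)) → ∀ n → Q n → ∃ λ j → j ≤ n × Q j × (∀ i → i < j → ¬ Q i)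
least Q Q? zero    q = 0 , z≤n , q , λ _ ()
least Q Q? (suc n) q with Q? 0
... | yes q0 = 0 , z≤n , q0 , λ _ ()
... | no ¬q0 with least (λ i → Q (suc i)) (λ i → Q? (suc i)) n q
...   | j , j≤n , qj , below = suc j , s≤s j≤n , qj , λ { zero _ → ¬q0 ; (suc i) (s≤s i<j) → below i i<j }

powQ-1 : ∀ n → powQ 1ℚ n ≡ 1ℚ
powQ-1 zero    = refl
powQ-1 (suc n) = trans (ℚP.*-identityˡ (powQ 1ℚ n)) (powQ-1 n)

-- With c = g(0), the composite is rewritten with an inner polynomial that has no constant term,
-- hence can have a monomial as its initial form.
compose-translate : ∀ f g c → compose (compose f (xPlus c)) (subP g (c ∷ [])) ≈ compose f g
compose-translate f g c = ≈-trans (compose-assoc f (xPlus c) (subP g (c ∷ [])))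
  (compose-congˡ f (≈-trans (compose-xPlus c (subP g (c ∷ []))) (cancel (c ∷ []) g)))
  where
  cancel : ∀ c g → addP c (subP g c) ≈ g
  cancel = solve-∀ poly-ring

coeff-subP-const : ∀ g c i → coeff (subP g (c ∷ [])) (suc i) ≡ coeff g (suc i)
coeff-subP-const g c i = trans (coeff-subP g (c ∷ []) (suc i)) (ℚP.+-identityʳ (coeff g (suc i)))

coeff₀-subP-const : ∀ g → coeff (subP g (coeff g 0 ∷ [])) 0 ≡ 0ℚ
coeff₀-subP-const g = trans (coeff-subP g (coeff g 0 ∷ []) 0) (ℚP.+-inverseʳ (coeff g 0))

-- Composites that reduce to a monomial modulo p

module Reduction (p : ℕ) (p-prime : Prime p) where
  open Valuation p p-prime
  open Filtration p p-prime
  open Integrality p p-prime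

  V⇒W : ∀ {k} f → (∀ i → V k (coeff f i)) → W 1 (+ 0) k f
  V⇒W {k} f v = mkW λ i → subst (λ z → V z (coeff f i)) (lem k (+ i)) (v i)
    where
    lem : ∀ k i → k ≡ k ℤ.- + 0 ℤ.* i
    lem = solveℤ

  W⇒V : ∀ {k} f → W 1 (+ 0) k f → ∀ i → V k (coeff f i)
  W⇒V {k} f (mkW w) i = subst (λ z → V z (coeff f i)) (lem k (+ i)) (w i)
    where
    lem : ∀ k i → k ℤ.- + 0 ℤ.* i ≡ k
    lem = solveℤ

  integral-compose : ∀ f g → Integral f → Integral g → Integral (compose f g)
  integral-compose f g vf vg = W⇒V (compose f g) (W-compose f (V⇒W f vf) (V⇒W g vg))

  integral-iter : ∀ f k → Integral f → Integral (iter k f)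
  integral-iter f zero    vf zero          = L-0
  integral-iter f zero    vf (suc zero)    = L-1
  integral-iter f zero    vf (suc (suc i)) = L-0
  integral-iter f (suc k) vf = integral-compose f (iter k f) vf (integral-iter f k vf)

  integral-xPlus : ∀ {c} → V (+ 0) c → Integral (xPlus c)
  integral-xPlus v zero          = v
  integral-xPlus v (suc zero)    = L-1
  integral-xPlus v (suc (suc i)) = L-0

  integral-subP-const : ∀ g → Integral g → Integral (subP g (coeff g 0 ∷ []))
  integral-subP-const g vg zero    = subst (V _) (sym (coeff₀-subP-const g)) L-0
  integral-subP-const g vg (suc i) = subst (V _) (sym (coeff-subP-const g (coeff g 0) i)) (vg (suc i))

  xPlus-degree : ∀ c → DegreeAtMost 1 (xPlus c)
  xPlus-degree c zero          ()
  xPlus-degree c (suc zero)    (s≤s ())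
  xPlus-degree c (suc (suc i)) _ = refl

  translate-degree : ∀ {d} f c → DegreeAtMost d f → DegreeAtMost d (compose f (xPlus c))
  translate-degree {d} f c df = subst (λ z → DegreeAtMost z (compose f (xPlus c))) (ℕP.*-identityʳ d)
    (proj₁ (compose-degree f (xPlus c) ℕP.≤-refl df (xPlus-degree c)))

  translate-lead : ∀ {d} f c → DegreeAtMost d f → coeff (compose f (xPlus c)) d ≡ coeff f d
  translate-lead {d} f c df = begin
    coeff (compose f (xPlus c)) d           ≡⟨ cong (coeff (compose f (xPlus c))) (ℕP.*-identityʳ d) ⟨
    coeff (compose f (xPlus c)) (d ℕ.* 1)   ≡⟨ proj₂ (compose-degree f (xPlus c) ℕP.≤-refl df (xPlus-degree c)) ⟩
    coeff f d * powQ 1ℚ d                   ≡⟨ cong (coeff f d *_) (powQ-1 d) ⟩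
    coeff f d * 1ℚ                          ≡⟨ ℚP.*-identityʳ (coeff f d) ⟩
    coeff f d                               ∎
    where open ≡-Reasoning

  x-[x-y]≡y : ∀ (x y : ℚ) → x - (x - y) ≡ y
  x-[x-y]≡y = solve-∀ ℚ-ring

  -- If y^t and x^j are the lowest terms of G and F surviving modulo p, then x^(tj) survives in G∘F.
  lowest-terms : ∀ {d e} F G → 1 ≤ d → 1 ≤ e → Integral F → Integral G → V (+ 1) (coeff F 0) →
    U (coeff F d) → U (coeff G e) → (∀ i → i < e ℕ.* d → V (+ 1) (coeff (compose G F) i)) →
    (∀ i → i < d → V (+ 1) (coeff F i)) × (∀ i → i < e → V (+ 1) (coeff G i))
  lowest-terms {d} {e} F G 1≤d 1≤e vF vG v₀ uF uG low
    with least (λ i → ¬ V (+ 1) (coeff F i)) (λ i → ¬? (V? (+ 1) (coeff F i))) d (U⇒¬V1 uF)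
       | least (λ i → ¬ V (+ 1) (coeff G i)) (λ i → ¬? (V? (+ 1) (coeff G i))) e (U⇒¬V1 uG)
  ... | zero   , _   , ¬vj , _   | _ = contradiction v₀ ¬vj
  ... | suc j′ , j≤d , ¬vj , <j⇒ | t , t≤e , ¬vt , <t⇒ =
    (λ i i<d → below-F i (subst (i <_) (sym j≡d) i<d)) , (λ i i<e → below-G i (subst (i <_) (sym t≡e) i<e))
    where
    j = suc j′
    -- The weight of p exceeds both j and t j, so every term divisible by p lies strictly above x^j
    -- in F and, with x of weight j, above x^t in G.
    N = t ℕ.* j ℕ.+ j ℕ.+ 1
    N≡ : + N ≡ + t ℤ.* + j ℤ.+ + j ℤ.+ + 1
    N≡ = cong (λ z → z ℤ.+ + j ℤ.+ + 1) (ℤP.pos-* t j)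
    below-F : ∀ i → i < j → V (+ 1) (coeff F i)
    below-F i i<j = decidable-stable (V? (+ 1) (coeff F i)) (<j⇒ i i<j)
    below-G : ∀ i → i < t → V (+ 1) (coeff G i)
    below-G i i<t = decidable-stable (V? (+ 1) (coeff G i)) (<t⇒ i i<t)
    a = coeff G t
    b = coeff F j
    inner : ∀ i → i ≢ j → L N ((+ j ℤ.+ + 1) ℤ.- + 1 ℤ.* + i) (coeff F i)
    inner i i≢j with ℕP.<-cmp i j
    ... | tri≈ _ i≡j _ = contradiction i≡j i≢j
    ... | tri< i<j _ _ = V⇒L (below-F i i<j) (≤-by (+ t ℤ.* + j ℤ.+ + i) (0≤-+ (0≤-* (0≤pos {t}) (0≤pos {j})) (0≤pos {i}))
            (trans (cong (ℤ._* + 1) N≡) (lem (+ t) (+ j) (+ i))))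
      where
      lem : ∀ t j i → (t ℤ.* j ℤ.+ j ℤ.+ + 1) ℤ.* + 1 ≡ ((j ℤ.+ + 1) ℤ.- + 1 ℤ.* i) ℤ.+ (t ℤ.* j ℤ.+ i)
      lem = solveℤ
    ... | tri> _ _ j<i with <⇒∃ j<i
    ...   | k , refl = V⇒L (vF i) (≤-by (+ k) 0≤pos (lem (+ N) (+ j) (+ k)))
      where
      lem : ∀ N j k → N ℤ.* + 0 ≡ ((j ℤ.+ + 1) ℤ.- + 1 ℤ.* (j ℤ.+ (+ 1 ℤ.+ k))) ℤ.+ k
      lem = solveℤ
    mono-F : W N (+ 1) (+ j) (mono b j)
    mono-F = W-mono j (V⇒L (vF j) (ℤP.≤-reflexive (lem (+ N) (+ j))))
      where
      lem : ∀ N j → j ℤ.- + 1 ℤ.* j ≡ N ℤ.* + 0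
      lem = solveℤ
    outer : ∀ i → i ≢ t → L N ((+ t ℤ.* + j ℤ.+ + 1) ℤ.- + j ℤ.* + i) (coeff G i)
    outer i i≢t with ℕP.<-cmp i t
    ... | tri≈ _ i≡t _ = contradiction i≡t i≢t
    ... | tri< i<t _ _ = V⇒L (below-G i i<t) (≤-by (+ j ℤ.+ + j ℤ.* + i) (0≤-+ (0≤pos {j}) (0≤-* (0≤pos {j}) (0≤pos {i})))
            (trans (cong (ℤ._* + 1) N≡) (lem (+ t) (+ j) (+ i))))
      where
      lem : ∀ t j i → (t ℤ.* j ℤ.+ j ℤ.+ + 1) ℤ.* + 1 ≡ ((t ℤ.* j ℤ.+ + 1) ℤ.- j ℤ.* i) ℤ.+ (j ℤ.+ j ℤ.* i)
      lem = solveℤ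
    ... | tri> _ _ t<i with <⇒∃ t<i
    ...   | k , refl = V⇒L (vG i) (≤-by (+ j′ ℤ.+ + j ℤ.* + k) (0≤-+ (0≤pos {j′}) (0≤-* (0≤pos {j}) (0≤pos {k}))) (lem (+ N) (+ t) (+ j′) (+ k)))
      where
      lem : ∀ N t j k → N ℤ.* + 0 ≡ ((t ℤ.* (+ 1 ℤ.+ j) ℤ.+ + 1) ℤ.- (+ 1 ℤ.+ j) ℤ.* (t ℤ.+ (+ 1 ℤ.+ k))) ℤ.+ (j ℤ.+ (+ 1 ℤ.+ j) ℤ.* k)
      lem = solveℤ
    mono-G : W N (+ j) (+ t ℤ.* + j) (mono a t)
    mono-G = W-mono t (V⇒L (vG t) (ℤP.≤-reflexive (lem (+ N) (+ t) (+ j))))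
      where
      lem : ∀ N t j → t ℤ.* j ℤ.- j ℤ.* t ≡ N ℤ.* + 0
      lem = solveℤ
    diff-F = W-subP-mono F j inner
    whole-F : W N (+ 1) (+ j) F
    whole-F = W-≈ (subP-addP F (mono b j)) (W-addP (W-≤ (≤-by (+ 1) 0≤pos refl) diff-F) mono-F)
    initial : W N (+ 1) (+ t ℤ.* + j ℤ.+ + 1) (subP (compose G F) (mono (a * powQ b t) (t ℕ.* j)))
    initial = W-compose-initial G (W-subP-mono G t outer) mono-G whole-F mono-F diff-F
    survives : ¬ V (+ 1) (coeff (compose G F) (t ℕ.* j))
    survives v = U⇒¬V1 (U-* (¬V1⇒U (vG t) ¬vt) (U-pow t (¬V1⇒U (vF j) ¬vj)))
      (subst (V (+ 1)) (x-[x-y]≡y (coeff (compose G F) (t ℕ.* j)) (a * powQ b t))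
        (L-- v (L⇒V {N} (+ 0) (ℤP.≤-reflexive weight) (W-coeff (a * powQ b t) (t ℕ.* j) initial))))
      where
      weight : + N ℤ.* + 0 ℤ.+ + 1 ≡ (+ t ℤ.* + j ℤ.+ + 1) ℤ.- + 1 ℤ.* + (t ℕ.* j)
      weight = trans (lem (+ N) (+ t) (+ j)) (cong (λ z → (+ t ℤ.* + j ℤ.+ + 1) ℤ.- + 1 ℤ.* z) (sym (ℤP.pos-* t j)))
        where
        lem : ∀ N t j → N ℤ.* + 0 ℤ.+ + 1 ≡ (t ℤ.* j ℤ.+ + 1) ℤ.- + 1 ℤ.* (t ℤ.* j)
        lem = solveℤ
    -- The surviving exponent t j cannot lie below e d. Since t ≤ e and j ≤ d with e and d positive,
    -- both must be equalities.
    ed≤tj : e ℕ.* d ≤ t ℕ.* j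
    ed≤tj = ℕP.≮⇒≥ λ tj<ed → survives (low (t ℕ.* j) tj<ed)
    j≡d : j ≡ d
    j≡d = ℕP.≤-antisym j≤d (ℕP.*-cancelˡ-≤ e {{ℕ.>-nonZero 1≤e}} (ℕP.≤-trans ed≤tj (ℕP.*-monoˡ-≤ j t≤e)))
    t≡e : t ≡ e
    t≡e = ℕP.≤-antisym t≤e (ℕP.*-cancelʳ-≤ e t d {{ℕ.>-nonZero 1≤d}} (ℕP.≤-trans ed≤tj (ℕP.*-monoʳ-≤ t j≤d)))

  -- `lowest-terms` applied to f - f(0) and g(x + f(0)), whose composite is still g∘f.
  compose≡monomial : ∀ {d e} f g → 1 ≤ d → 1 ≤ e → Integral f → Integral g → DegreeAtMost e g →
    U (coeff f d) → U (coeff g e) → (∀ i → i < e ℕ.* d → V (+ 1) (coeff (compose g f) i)) →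
    (∀ i → 1 ≤ i → i < d → V (+ 1) (coeff f i)) ×
    (∀ i → i < e → V (+ 1) (coeff (compose g (xPlus (coeff f 0))) i))
  compose≡monomial {suc d′} {e} f g 1≤d 1≤e vf vg dg uf ug low =
    (λ { (suc i) _ i<d → subst (V (+ 1)) (coeff-subP-const f c i) (proj₁ both (suc i) i<d) }) , proj₂ both
    where
    c = coeff f 0
    F = subP f (c ∷ [])
    G = compose g (xPlus c)
    both = lowest-terms F G 1≤d 1≤e (integral-subP-const f vf) (integral-compose g (xPlus c) vg (integral-xPlus (vf 0)))
      (subst (V (+ 1)) (sym (coeff₀-subP-const f)) L-0)
      (subst U (sym (coeff-subP-const f c d′)) uf) (subst U (sym (translate-lead g c dg)) ug)
      (λ i i< → subst (V (+ 1)) (sym (at (compose-translate g f c) i)) (low i i<))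

-- Purity under translation and composition

module Purity (p : ℕ) (p-prime : Prime p) (r : ℕ) where
  open Valuation p p-prime
  open Filtration p p-prime
  open Integrality p p-prime
  open Reduction p p-prime

  -- The Newton polygon condition with denominators cleared: when p weighs e and x weighs r, the
  -- segment from (0, r) to (e, 0) is the level of value e r. The field `slopes` covers all
  -- exponents, which makes it a single bound on a Gauss valuation.
  record PureAt (e : ℕ) (g : Poly) : Set where
    constructor mkPure
    field
      degree   : DegreeAtMost e g
      lead     : U (coeff g e)
      constant : ν p (coeff g 0) ≡ fin (+ r)
      slopes   : W e (+ r) (+ e ℤ.* + r) g
  open PureAt public

  PureAt-≈ : ∀ {e f g} → f ≈ g → PureAt e f → PureAt e g
  PureAt-≈ {e} f≈g (mkPure df uf cf wf) = mkPure
    (λ i e<i → trans (sym (at f≈g i)) (df i e<i)) (subst U (at f≈g e) uf)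
    (trans (cong (ν p) (sym (at f≈g 0))) cf) (W-≈ f≈g wf)

  U⇒≢0 : ∀ {q} → U q → q ≢ 0ℚ
  U⇒≢0 (mkU u) refl with u
  ... | ()

  PureAt⇒Pure : ∀ {e g} → PureAt e g → Pure p r g
  PureAt⇒Pure {e} {g} (mkPure df uf cf (mkW w)) = e , (U⇒≢0 uf , df) , ν≡0 uf , cf , λ i _ i<e → slope i i<e (w i)
    where
    slope : ∀ i → i < e → L e (+ e ℤ.* + r ℤ.- + r ℤ.* + i) (coeff g i) → SlopeOK (ν p (coeff g i)) r e i
    slope i i<e (mkL b) with ν p (coeff g i)
    ... | ∞     = tt
    ... | fin v with <⇒∃ i<e
    ...   | k , refl = subst₂ ℤ._≤_ (trans (lem (+ i) (+ k) (+ r)) (trans (sym (ℤP.pos-* r (suc k))) (cong (λ z → + (r ℕ.* z)) (sym (ℕP.m+n∸m≡n i (suc k))))))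
                         (ℤP.*-comm (+ e) v) (b refl)
      where
      lem : ∀ i k r → (i ℤ.+ (+ 1 ℤ.+ k)) ℤ.* r ℤ.- r ℤ.* i ≡ r ℤ.* (+ 1 ℤ.+ k)
      lem = solveℤ

  degree-unique : ∀ {d e g} → HasDegree g d → HasDegree g e → d ≡ e
  degree-unique {d} {e} (d≢0 , >d) (e≢0 , >e) with ℕP.<-cmp d e
  ... | tri≈ _ d≡e _ = d≡e
  ... | tri< d<e _ _ = contradiction (>d e d<e) e≢0
  ... | tri> _ _ e<d = contradiction (>e d e<d) d≢0

  Pure⇒PureAt : ∀ {d g} → HasDegree g d → Pure p r g → PureAt d g
  Pure⇒PureAt {d} {g} hd (e , he , le , ce , se) with degree-unique {g = g} hd he
  ... | refl = mkPure (proj₂ he) (mkU le) ce (mkW slope)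
    where
    slope : ∀ i → L d (+ d ℤ.* + r ℤ.- + r ℤ.* + i) (coeff g i)
    slope zero = L-ν ce (ℤP.≤-reflexive (lem (+ d) (+ r)))
      where
      lem : ∀ d r → d ℤ.* r ℤ.- r ℤ.* + 0 ≡ d ℤ.* r
      lem = solveℤ
    slope i@(suc i′) with ℕP.<-cmp i d
    ... | tri≈ _ refl _ = L-≤ (ℤP.≤-reflexive (lem (+ i) (+ r))) (U⇒L (mkU le))
      where
      lem : ∀ d r → d ℤ.* r ℤ.- r ℤ.* d ≡ + 0
      lem = solveℤ
    ... | tri> _ _ d<i = subst (L d _) (sym (proj₂ he i d<i)) L-0
    ... | tri< i<d _ _ with se i (s≤s z≤n) i<d
    ...   | ok with ν p (coeff g i) in eq
    ...     | ∞     = mkL λ e → contradiction (trans (sym eq) e) λ ()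
    ...     | fin v with <⇒∃ i<d
    ...       | k , refl = L-ν eq (subst₂ ℤ._≤_ (sym (trans (lem (+ i) (+ k) (+ r)) (trans (sym (ℤP.pos-* r (suc k)))
                           (cong (λ z → + (r ℕ.* z)) (sym (ℕP.m+n∸m≡n i (suc k)))))))
                         (ℤP.*-comm v (+ d)) ok)
      where
      lem : ∀ i k r → (i ℤ.+ (+ 1 ℤ.+ k)) ℤ.* r ℤ.- r ℤ.* i ≡ r ℤ.* (+ 1 ℤ.+ k)
      lem = solveℤ

  PureAt-low : ∀ {d g} → 1 ≤ r → PureAt d g → ∀ i → i < d → V (+ 1) (coeff g i)
  PureAt-low {d} {g} 1≤r (mkPure _ _ _ (mkW w)) i i<d with <⇒∃ i<d | <⇒∃ 1≤r
  ... | k , refl | s , refl = L⇒V {d} (+ 0)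
    (≤-by (+ s ℤ.+ + k ℤ.+ + s ℤ.* + k) (0≤-+ (0≤pos {s ℕ.+ k}) (0≤-* (0≤pos {s}) (0≤pos {k}))) (lem (+ i) (+ k) (+ s))) (w i)
    where
    lem : ∀ i k s → (i ℤ.+ (+ 1 ℤ.+ k)) ℤ.* (+ 1 ℤ.+ s) ℤ.- (+ 1 ℤ.+ s) ℤ.* i ≡
      ((i ℤ.+ (+ 1 ℤ.+ k)) ℤ.* + 0 ℤ.+ + 1) ℤ.+ (s ℤ.+ k ℤ.+ s ℤ.* k)
    lem = solveℤ

  PureAt-integral : ∀ {d g} → 1 ≤ r → PureAt d g → Integral g
  PureAt-integral {d} {g} 1≤r pg i with ℕP.<-cmp i d
  ... | tri< i<d _ _ = V1⇒V0 (PureAt-low 1≤r pg i i<d)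
  ... | tri≈ _ refl _ = U⇒L (lead pg)
  ... | tri> _ _ d<i = subst (V (+ 0)) (sym (degree pg i d<i)) L-0

  -- As p weighs d > r, the shift δ is heavier than x, so x + δ and x agree beyond weight r. The
  -- constant term of F therefore changes by something of value above d r, that is of valuation
  -- above r.
  PureAt-translate : ∀ {d F δ} → r < d → PureAt d F → V (+ 1) δ → PureAt d (compose F (xPlus δ))
  PureAt-translate {d} {F} {δ} r<d (mkPure dF uF cF wF) vδ = mkPure (translate-degree F δ dF)
    (subst U (sym (translate-lead F δ dF)) uF) (V⇒ν Vr ¬Vr+1) (W-compose F wF wδ)
    where
    x = 0ℚ ∷ 1ℚ ∷ []
    L-δ : L d (+ r ℤ.+ + 1) δ
    L-δ with <⇒∃ r<d
    ... | k , refl = V⇒L vδ (≤-by (+ k) 0≤pos (lem (+ r) (+ k)))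
      where
      lem : ∀ r k → (r ℤ.+ (+ 1 ℤ.+ k)) ℤ.* + 1 ≡ (r ℤ.+ + 1) ℤ.+ k
      lem = solveℤ
    tail : W d (+ r) (+ r ℤ.- + r) (1ℚ ∷ [])
    tail = W-const (L-≤ (ℤP.≤-reflexive (ℤP.+-inverseʳ (+ r))) L-1)
    wδ : W d (+ r) (+ r) (xPlus δ)
    wδ = W-∷ (L-≤ (≤-by (+ 1) 0≤pos refl) L-δ) tail
    diff : W d (+ r) (+ r ℤ.+ + 1) (subP (xPlus δ) x)
    diff = W-≈ (∷-cong (sym (ℚP.+-identityʳ δ)) (≈-sym 0∷[]≈[])) (W-const L-δ)
    F₀ = coeff F 0
    Fδ = coeff (compose F (xPlus δ)) 0
    change : V (+ r ℤ.+ + 1) (Fδ - F₀)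
    change = L⇒V {d} (+ r) ℤP.≤-refl (subst (L d _)
      (trans (coeff-subP (compose F (xPlus δ)) (compose F x) 0) (cong (λ z → Fδ - z) (at (compose-identityʳ F) 0)))
      (W-head (W-compose-subP F wF wδ (W-∷ L-0 tail) diff)))
    Vr : V (+ r) Fδ
    Vr = subst (V (+ r)) (lem Fδ F₀) (L-+ (L-≤ (≤-by (+ 1) 0≤pos refl) change) (L-ν cF (ℤP.≤-reflexive (sym (ℤP.*-identityˡ (+ r))))))
      where
      lem : ∀ (x y : ℚ) → (x - y) + y ≡ x
      lem = solve-∀ ℚ-ring
    ¬Vr+1 : ¬ V (+ r ℤ.+ + 1) Fδ
    ¬Vr+1 v = ν⇒¬V cF (subst (V _) (x-[x-y]≡y Fδ F₀) (L-- v change))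

  -- Since g - g(0) has initial form x^t for the weight r on x and dt on p, the slopes of f∘g are those of f(x + g(0)).
  module _ {d t} (f g : Poly) (r<d : r < d) (1≤t : 1 ≤ t) (vf : Integral f) (df : DegreeAtMost d f) (uf : U (coeff f d))
    (vg : Integral g) (dg : DegreeAtMost t g) (ug : U (coeff g t)) (low : ∀ i → 1 ≤ i → i < t → V (+ 1) (coeff g i)) where

    private
      c = coeff g 0
      F = compose f (xPlus c)
      G = subP g (c ∷ [])
      N = d ℕ.* t
      u = coeff g t

      lead-G : coeff G t ≡ u
      lead-G with <⇒∃ 1≤t
      ... | t′ , refl = coeff-subP-const g c t′

      same-constant : coeff (compose f g) 0 ≡ coeff F 0
      same-constant = trans (coeff₀-compose f g) (sym (coeff₀-compose f (xPlus c)))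

      -- This is where r < d is used: a factor p weighs d t, which is more than the weight r t of
      -- x^t.
      V⇒L-N : ∀ i → i < t → V (+ 1) (coeff G i) → L N ((+ r ℤ.* + t ℤ.+ + 1) ℤ.- + r ℤ.* + i) (coeff G i)
      V⇒L-N i i<t v with <⇒∃ i<t | <⇒∃ r<d
      ... | k , refl | s , refl = V⇒L v (≤-by (+ (i ℕ.+ k) ℤ.+ + s ℤ.* + t ℤ.+ + r ℤ.* + i)
              (0≤-+ (0≤-+ (0≤pos {i ℕ.+ k}) (0≤-* (0≤pos {s}) (0≤pos {t}))) (0≤-* (0≤pos {r}) (0≤pos {i})))
              (trans (cong (ℤ._* + 1) (ℤP.pos-* d t)) (lem (+ r) (+ s) (+ i) (+ k))))
        where
        lem : ∀ r s i k → ((r ℤ.+ (+ 1 ℤ.+ s)) ℤ.* (i ℤ.+ (+ 1 ℤ.+ k))) ℤ.* + 1 ≡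
          ((r ℤ.* (i ℤ.+ (+ 1 ℤ.+ k)) ℤ.+ + 1) ℤ.- r ℤ.* i) ℤ.+ ((i ℤ.+ k) ℤ.+ s ℤ.* (i ℤ.+ (+ 1 ℤ.+ k)) ℤ.+ r ℤ.* i)
        lem = solveℤ

      inner : ∀ i → i ≢ t → L N ((+ r ℤ.* + t ℤ.+ + 1) ℤ.- + r ℤ.* + i) (coeff G i)
      inner i i≢t with ℕP.<-cmp i t
      ... | tri≈ _ i≡t _ = contradiction i≡t i≢t
      inner zero     i≢t | tri> _ _ ()
      inner (suc i)  i≢t | tri> _ _ t<i = subst (L N _) (sym (trans (coeff-subP-const g c i) (dg (suc i) t<i))) L-0
      inner zero     i≢t | tri< i<t _ _ = V⇒L-N 0 i<t (subst (V (+ 1)) (sym (coeff₀-subP-const g)) L-0)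
      inner (suc i)  i≢t | tri< i<t _ _ = V⇒L-N (suc i) i<t (subst (V (+ 1)) (sym (coeff-subP-const g c i)) (low (suc i) (s≤s z≤n) i<t))

      diff-G : W N (+ r) (+ r ℤ.* + t ℤ.+ + 1) (subP G (mono u t))
      diff-G = subst (λ z → W N (+ r) _ (subP G (mono z t))) lead-G (W-subP-mono G t inner)

      mono-G : W N (+ r) (+ r ℤ.* + t) (mono u t)
      mono-G = W-mono t (L-≤ (ℤP.≤-reflexive (ℤP.+-inverseʳ (+ r ℤ.* + t))) (U⇒L ug))

      whole-G : W N (+ r) (+ r ℤ.* + t) G
      whole-G = W-≈ (subP-addP G (mono u t)) (W-addP (W-≤ (≤-by (+ 1) 0≤pos refl) diff-G) mono-G)

      F∘G≈ : compose F G ≈ compose f g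
      F∘G≈ = compose-translate f g c

      weight : ∀ i → + t ℤ.* (+ d ℤ.* + r ℤ.- + r ℤ.* + i) ≡ + N ℤ.* + r ℤ.- (+ r ℤ.* + t) ℤ.* + i
      weight i = trans (lem (+ d) (+ t) (+ r) (+ i)) (cong (λ z → z ℤ.* + r ℤ.- (+ r ℤ.* + t) ℤ.* + i) (sym (ℤP.pos-* d t)))
        where
        lem : ∀ d t r i → t ℤ.* (d ℤ.* r ℤ.- r ℤ.* i) ≡ (d ℤ.* t) ℤ.* r ℤ.- (r ℤ.* t) ℤ.* i
        lem = solveℤ

    -- Scaling the weights of F by t makes the weight of its variable equal to the value r t of g -
    -- g(0), after which `W-compose` applies.
    PureAt-compose⁺ : PureAt d (compose f (xPlus c)) → PureAt (d ℕ.* t) (compose f g)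
    PureAt-compose⁺ (mkPure _ _ cF (mkW wF)) = mkPure (proj₁ deg) (subst U (sym (proj₂ deg)) (U-* uf (U-pow d ug)))
      (trans (cong (ν p) same-constant) cF) (W-≈ F∘G≈ (W-compose F scaled whole-G))
      where
      deg = compose-degree f g 1≤t df dg
      scaled : W N (+ r ℤ.* + t) (+ N ℤ.* + r) F
      scaled = mkW λ i → subst₂ (λ n z → L n z (coeff F i)) (ℕP.*-comm t d) (weight i) (L-scale t (wF i))

    -- `W-compose` cannot be inverted directly, so the value of F is raised one unit at a time,
    -- starting from integrality. If F has value m < N r, then F∘G and F(u x^t) agree up to value m
    -- + 1, and F∘G = f∘g has value N r. The coefficients of F(u x^t) are those of F times unit
    -- powers of u, so F itself has value m + 1.
    PureAt-compose⁻ : PureAt (d ℕ.* t) (compose f g) → PureAt d (compose f (xPlus c))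
    PureAt-compose⁻ (mkPure _ _ cfg wfg) = mkPure (translate-degree f c df) (subst U (sym (translate-lead f c df)) uf)
      (trans (cong (ν p) (sym same-constant)) cfg)
      (mkW λ i → L-unscale t {{ℕ.>-nonZero 1≤t}} (subst₂ (λ n z → L n z (coeff F i)) (ℕP.*-comm d t)
        (trans (cong (ℤ._- (+ r ℤ.* + t) ℤ.* + i) (ℤP.pos-* N r)) (sym (weight i))) (coef (climb (N ℕ.* r) ℕP.≤-refl) i)))
      where
      vF : Integral F
      vF = integral-compose f (xPlus c) vf (integral-xPlus (vg 0))
      climb : ∀ m → m ≤ N ℕ.* r → W N (+ r ℤ.* + t) (+ m) F
      climb zero    _   = mkW λ i → V⇒L (vF i) (≤-by (+ r ℤ.* + t ℤ.* + i) (0≤-* (0≤-* (0≤pos {r}) (0≤pos {t})) (0≤pos {i})) (lem (+ N) (+ r ℤ.* + t) (+ i)))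
        where
        lem : ∀ N x i → N ℤ.* + 0 ≡ (+ 0 ℤ.- x ℤ.* i) ℤ.+ x ℤ.* i
        lem = solveℤ
      climb (suc m) m<Nr = mkW λ i → L-cancel-U (U-pow i ug) (subst₂ (L N)
          (cong (λ z → + suc m ℤ.- z) (trans (cong (+ r ℤ.*_) (trans (ℤP.pos-* i t) (ℤP.*-comm (+ i) (+ t)))) (sym (ℤP.*-assoc (+ r) (+ t) (+ i)))))
          (trans (coeff-compose-mono F u t i {{ℕ.>-nonZero 1≤t}}) (ℚP.*-comm (coeff F i) (powQ u i)))
          (coef initial (i ℕ.* t)))
        where
        wF : W N (+ r ℤ.* + t) (+ m) F
        wF = climb m (ℕP.<⇒≤ m<Nr)
        initial : W N (+ r) (+ suc m) (compose F (mono u t))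
        initial = W-≈ (cancel (compose F G) (compose F (mono u t)))
          (W-subP (W-≈ (≈-sym F∘G≈) (W-≤ (subst (+ suc m ℤ.≤_) (ℤP.pos-* N r) (ℤ.+≤+ m<Nr)) wfg))
                  (W-≡ (ℤP.+-comm (+ m) (+ 1)) (W-compose-subP F wF whole-G mono-G diff-G)))
          where
          cancel : ∀ f g → subP f (subP f g) ≈ g
          cancel = solve-∀ poly-ring

-- Binomial coefficients and laws of evaluation

nC0≡1 : ∀ n → n C 0 ≡ 1
nC0≡1 n = trans (nCk≡nC[n∸k] {0} {n} z≤n) (nCn≡1 n)

absorption : ∀ n k → suc k ℕ.* (suc n C suc k) ≡ suc n ℕ.* (n C k)
absorption n       zero    = trans (ℕP.*-identityˡ (suc n C 1))
  (trans (nC1≡n (suc n)) (sym (trans (cong (suc n ℕ.*_) (nC0≡1 n)) (ℕP.*-identityʳ (suc n)))))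
absorption zero    (suc k) = trans (cong (suc (suc k) ℕ.*_) (k>n⇒nCk≡0 {1} {suc (suc k)} (s≤s (s≤s z≤n))))
  (trans (ℕP.*-zeroʳ k) (sym (trans (ℕP.*-identityˡ (0 C suc k)) (k>n⇒nCk≡0 {0} {suc k} (s≤s z≤n)))))
absorption (suc n) (suc k) = begin
  suc (suc k) ℕ.* (suc (suc n) C suc (suc k))
    ≡⟨ cong (suc (suc k) ℕ.*_) (nCk+nC[k+1]≡[n+1]C[k+1] (suc n) (suc k)) ⟨
  suc (suc k) ℕ.* (x ℕ.+ y)
    ≡⟨ lem₁ k x y ⟩
  x ℕ.+ suc k ℕ.* x ℕ.+ suc (suc k) ℕ.* y
    ≡⟨ cong₂ (λ u v → x ℕ.+ u ℕ.+ v) (absorption n k) (absorption n (suc k)) ⟩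
  x ℕ.+ suc n ℕ.* (n C k) ℕ.+ suc n ℕ.* (n C suc k)
    ≡⟨ lem₂ x (suc n) (n C k) (n C suc k) ⟩
  x ℕ.+ suc n ℕ.* (n C k ℕ.+ n C suc k)
    ≡⟨ cong (λ z → x ℕ.+ suc n ℕ.* z) (nCk+nC[k+1]≡[n+1]C[k+1] n k) ⟩
  suc (suc n) ℕ.* x ∎
  where
  open ≡-Reasoning
  x = suc n C suc k
  y = suc n C suc (suc k)
  lem₁ : ∀ k x y → suc (suc k) ℕ.* (x ℕ.+ y) ≡ x ℕ.+ suc k ℕ.* x ℕ.+ suc (suc k) ℕ.* y
  lem₁ = solveℕ
  lem₂ : ∀ x n u v → x ℕ.+ n ℕ.* u ℕ.+ n ℕ.* v ≡ x ℕ.+ n ℕ.* (u ℕ.+ v)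
  lem₂ = solveℕ

eval-mono : ∀ a d x → eval (mono a d) x ≡ a * powQ x d
eval-mono a zero    x = lem a x
  where
  lem : ∀ (a x : ℚ) → a + x * 0ℚ ≡ a * 1ℚ
  lem = solve-∀ ℚ-ring
eval-mono a (suc d) x = trans (cong (λ z → 0ℚ + x * z) (eval-mono a d x)) (lem a x (powQ x d))
  where
  lem : ∀ (a x y : ℚ) → 0ℚ + x * (a * y) ≡ a * (x * y)
  lem = solve-∀ ℚ-ring

-- Evaluation at x is the constant term of the composite with the constant polynomial x, so its laws
-- are inherited from composition.
eval-addP : ∀ f g x → eval (addP f g) x ≡ eval f x + eval g x
eval-addP f g x = begin
  eval (addP f g) x                                         ≡⟨ coeff₀-compose (addP f g) (x ∷ []) ⟨
  coeff (compose (addP f g) (x ∷ [])) 0                     ≡⟨ at (compose-addP f g (x ∷ [])) 0 ⟩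
  coeff (addP (compose f (x ∷ [])) (compose g (x ∷ []))) 0  ≡⟨ coeff-addP (compose f (x ∷ [])) (compose g (x ∷ [])) 0 ⟩
  coeff (compose f (x ∷ [])) 0 + coeff (compose g (x ∷ [])) 0 ≡⟨ cong₂ _+_ (coeff₀-compose f (x ∷ [])) (coeff₀-compose g (x ∷ [])) ⟩
  eval f x + eval g x ∎
  where open ≡-Reasoning

eval-const : ∀ c x → eval (c ∷ []) x ≡ c
eval-const c x = trans (cong (λ z → c + z) (ℚP.*-zeroʳ x)) (ℚP.+-identityʳ c)

eval-compose : ∀ f g x → eval (compose f g) x ≡ eval f (eval g x)
eval-compose f g x = begin
  eval (compose f g) x                      ≡⟨ coeff₀-compose (compose f g) (x ∷ []) ⟨
  coeff (compose (compose f g) (x ∷ [])) 0  ≡⟨ at (compose-assoc f g (x ∷ [])) 0 ⟩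
  coeff (compose f (compose g (x ∷ []))) 0  ≡⟨ coeff₀-compose f (compose g (x ∷ [])) ⟩
  eval f (coeff (compose g (x ∷ [])) 0)     ≡⟨ cong (eval f) (coeff₀-compose g (x ∷ [])) ⟩
  eval f (eval g x)                         ∎
  where open ≡-Reasoning

eval-xPlus : ∀ c x → eval (xPlus c) x ≡ x + c
eval-xPlus c x = lem c x
  where
  lem : ∀ (c x : ℚ) → c + x * (1ℚ + x * 0ℚ) ≡ x + c
  lem = solve-∀ ℚ-ring

-- Prime powers, Frobenius and Fermat modulo p

module Frobenius (p : ℕ) (p-prime : Prime p) where
  open Valuation p p-prime
  open Filtration p p-prime
  open Integrality p p-prime
  open Reduction p p-prime

  -- By absorption i C(p,i) = p C(p-1,i-1), and p does not divide i.
  prime-∣-C : ∀ i → 1 ≤ i → i < p → p ∣ p C i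
  prime-∣-C (suc k) _ k<p with euclidsLemma (suc k) (p C suc k) p-prime (divides-p p refl)
    where
    divides-p : ∀ q → q ≡ p → p ∣ suc k ℕ.* (p C suc k)
    divides-p zero    refl = contradiction k<p λ ()
    divides-p (suc q) refl = divides (q C k) (trans (absorption q k) (ℕP.*-comm p (q C k)))
  ... | inj₁ p∣k = contradiction (∣P.∣⇒≤ p∣k) (ℕP.<⇒≱ k<p)
  ... | inj₂ p∣C = p∣C

  -- If every inner binomial coefficient of d vanishes mod p then C(d-1,j) = ±1 mod p;
  -- for the p-part q of d this makes C(d,q) = (d/q) C(d-1,q-1) nonzero mod p unless q = d.
  prime-power : ∀ d → 2 ≤ d → (∀ i → 1 ≤ i → i < d → p ∣ d C i) → ∃ λ m → 1 ≤ m × d ≡ p ^ m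
  prime-power d@(suc n) 2≤d p∣dC with p-part d (s≤s z≤n)
  ... | a , d≡ , ∤a with p ^ vN p d ℕP.<? d
  ...   | no  q≮d = vN p d , 1≤v (vN p d) refl , d≡q
    where
    d≡q : d ≡ p ^ vN p d
    d≡q = ℕP.≤-antisym (ℕP.≮⇒≥ q≮d) (subst (p ^ vN p d ≤_) (sym d≡) (ℕP.m≤m*n (p ^ vN p d) a {{∤⇒≢0 ∤a}}))
    1≤v : ∀ v → v ≡ vN p d → 1 ≤ v
    1≤v zero    e = contradiction (ℕP.≤-reflexive (trans d≡q (cong (p ^_) (sym e)))) (ℕP.<⇒≱ 2≤d)
    1≤v (suc v) e = s≤s z≤n
  ...   | yes q<d with p ^ vN p d in q≡ | ℕP.m^n>0 p (vN p d)
  ...     | suc q′ | _ = contradiction (p∣dC (suc q′) (s≤s z≤n) q<d)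
                           (subst (λ z → ¬ p ∣ z) (sym C≡) (∤-* ∤a (∤C q′ (ℕP.<⇒≤ (ℕP.≤-pred q<d)))))
    where
    -- By Pascal's rule C(n,j) + C(n,j+1) = C(d,j+1) is divisible by p, so divisibility would travel
    -- from C(n,j+1) down to C(n,0) = 1.
    ∤C : ∀ j → j ≤ n → ¬ p ∣ n C j
    ∤C zero    _   p∣ = p∤1 (subst (p ∣_) (nC0≡1 n) p∣)
    ∤C (suc j) j<n p∣ = ∤C j (ℕP.<⇒≤ j<n) (∣P.∣m+n∣m⇒∣n
      (subst (p ∣_) (trans (sym (nCk+nC[k+1]≡[n+1]C[k+1] n j)) (ℕP.+-comm (n C j) (n C suc j))) (p∣dC (suc j) (s≤s z≤n) (s≤s j<n))) p∣)
    C≡ : d C suc q′ ≡ a ℕ.* (n C q′)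
    C≡ = ℕP.*-cancelˡ-≡ _ _ (suc q′) (trans (absorption n q′) (trans (cong (ℕ._* (n C q′)) d≡) (ℕP.*-assoc (suc q′) a (n C q′))))

  coeff-binomial : ∀ a c d i → coeff (compose (mono a d) (xPlus c)) i ≡ a * ι (d C i) * powQ c (d ℕ.∸ i)
  coeff-binomial a c zero zero = lem a c
    where
    lem : ∀ (a c : ℚ) → a + 0ℚ ≡ a * 1ℚ * 1ℚ
    lem = solve-∀ ℚ-ring
  coeff-binomial a c zero (suc i) = trans (at (compose-const a (xPlus c)) (suc i))
    (sym (trans (cong (λ z → a * ι z * 1ℚ) (k>n⇒nCk≡0 {0} {suc i} (s≤s z≤n))) (lem a)))
    where
    lem : ∀ (a : ℚ) → a * 0ℚ * 1ℚ ≡ 0ℚ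
    lem = solve-∀ ℚ-ring
  coeff-binomial a c (suc d) zero = begin
    coeff (compose (mono a (suc d)) (xPlus c)) 0     ≡⟨ at (compose-0∷ (mono a d) (xPlus c)) 0 ⟩
    coeff (mulP (xPlus c) h) 0                       ≡⟨ coeff₀-mulP (xPlus c) h ⟩
    c * coeff h 0                                    ≡⟨ cong (c *_) (coeff-binomial a c d 0) ⟩
    c * (a * ι (d C 0) * powQ c d)                   ≡⟨ cong (λ z → c * (a * ι z * powQ c d)) (trans (nC0≡1 d) (sym (nC0≡1 (suc d)))) ⟩
    c * (a * ι (suc d C 0) * powQ c d)               ≡⟨ lem c a (ι (suc d C 0)) (powQ c d) ⟩
    a * ι (suc d C 0) * (c * powQ c d)               ∎
    where
    open ≡-Reasoning
    h = compose (mono a d) (xPlus c)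
    lem : ∀ (c a x y : ℚ) → c * (a * x * y) ≡ a * x * (c * y)
    lem = solve-∀ ℚ-ring
  coeff-binomial a c (suc d) (suc i) = begin
    coeff (compose (mono a (suc d)) (xPlus c)) (suc i)
      ≡⟨ at (compose-0∷ (mono a d) (xPlus c)) (suc i) ⟩
    coeff (mulP (xPlus c) h) (suc i)
      ≡⟨ coeff-addP (scaleP c h) (0ℚ ∷ mulP (1ℚ ∷ []) h) (suc i) ⟩
    coeff (scaleP c h) (suc i) + coeff (mulP (1ℚ ∷ []) h) i
      ≡⟨ cong₂ _+_ (coeff-scaleP c h (suc i)) (at (mulP-identityˡ h) i) ⟩
    c * coeff h (suc i) + coeff h i
      ≡⟨ cong₂ (λ u v → c * u + v) (coeff-binomial a c d (suc i)) (coeff-binomial a c d i) ⟩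
    c * (a * ι (d C suc i) * powQ c (d ℕ.∸ suc i)) + a * ι (d C i) * powQ c (d ℕ.∸ i)
      ≡⟨ lem₁ c a (ι (d C suc i)) (powQ c (d ℕ.∸ suc i)) (ι (d C i)) (powQ c (d ℕ.∸ i)) ⟩
    a * (ι (d C suc i) * (c * powQ c (d ℕ.∸ suc i))) + a * ι (d C i) * powQ c (d ℕ.∸ i)
      ≡⟨ cong (λ z → a * z + a * ι (d C i) * powQ c (d ℕ.∸ i)) drop ⟩
    a * (ι (d C suc i) * powQ c (d ℕ.∸ i)) + a * ι (d C i) * powQ c (d ℕ.∸ i)
      ≡⟨ lem₂ a (ι (d C suc i)) (ι (d C i)) (powQ c (d ℕ.∸ i)) ⟩
    a * (ι (d C i) + ι (d C suc i)) * powQ c (d ℕ.∸ i)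
      ≡⟨ cong (λ z → a * z * powQ c (d ℕ.∸ i)) (trans (sym (ι-+ (d C i) (d C suc i))) (cong ι (nCk+nC[k+1]≡[n+1]C[k+1] d i))) ⟩
    a * ι (suc d C suc i) * powQ c (d ℕ.∸ i) ∎
    where
    open ≡-Reasoning
    h = compose (mono a d) (xPlus c)
    lem₁ : ∀ (c a x y z w : ℚ) → c * (a * x * y) + a * z * w ≡ a * (x * (c * y)) + a * z * w
    lem₁ = solve-∀ ℚ-ring
    lem₂ : ∀ (a x z w : ℚ) → a * (x * w) + a * z * w ≡ a * (z + x) * w
    lem₂ = solve-∀ ℚ-ring
    -- For i ≥ d the truncated exponent no longer drops by one, but there C(d,i+1) = 0.
    drop : ι (d C suc i) * (c * powQ c (d ℕ.∸ suc i)) ≡ ι (d C suc i) * powQ c (d ℕ.∸ i)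
    drop with i ℕP.<? d
    ... | yes i<d = cong (λ z → ι (d C suc i) * powQ c z) (sym (ℕP.+-∸-assoc 1 i<d))
    ... | no  i≮d rewrite k>n⇒nCk≡0 {d} {suc i} (s≤s (ℕP.≮⇒≥ i≮d)) = trans (ℚP.*-zeroˡ (c * powQ c (d ℕ.∸ suc i))) (sym (ℚP.*-zeroˡ (powQ c (d ℕ.∸ i))))

  infix 4 _≡ₚ_
  -- Congruence modulo p as a bound on a difference over ℚ. It is compatible with composition only
  -- for p-integral polynomials, hence the integrality arguments that follow it everywhere.
  record _≡ₚ_ (f g : Poly) : Set where
    constructor mk≡ₚ
    field divides-difference : W 1 (+ 0) (+ 1) (subP f g)
  open _≡ₚ_ public

  ≈⇒≡ₚ : ∀ {f g} → f ≈ g → f ≡ₚ g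
  ≈⇒≡ₚ {f} {g} e = mk≡ₚ (W-≈ (≈-sym (≈-trans (addP-cong e (≈-refl {negP g})) (subP-self g))) W-[])

  ≡ₚ-trans : ∀ {f g h} → f ≡ₚ g → g ≡ₚ h → f ≡ₚ h
  ≡ₚ-trans {f} {g} {h} (mk≡ₚ w) (mk≡ₚ w′) = mk≡ₚ (W-≈ (telescope f g h) (W-addP w w′))
    where
    telescope : ∀ f g h → addP (subP f g) (subP g h) ≈ subP f h
    telescope = solve-∀ poly-ring

  ≡ₚ-addP : ∀ {f g f′ g′} → f ≡ₚ g → f′ ≡ₚ g′ → addP f f′ ≡ₚ addP g g′
  ≡ₚ-addP {f} {g} {f′} {g′} (mk≡ₚ w) (mk≡ₚ w′) = mk≡ₚ (W-≈ (regroup f g f′ g′) (W-addP w w′))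
    where
    regroup : ∀ f g f′ g′ → addP (subP f g) (subP f′ g′) ≈ subP (addP f f′) (addP g g′)
    regroup = solve-∀ poly-ring

  ≡ₚ-composeʳ : ∀ {f f′} g → f ≡ₚ f′ → Integral g → compose f g ≡ₚ compose f′ g
  ≡ₚ-composeʳ {f} {f′} g (mk≡ₚ w) vg = mk≡ₚ (W-≈ (compose-subP f f′ g) (W-compose (subP f f′) w (V⇒W g vg)))

  ≡ₚ-composeˡ : ∀ f {g g′} → Integral f → Integral g → Integral g′ → g ≡ₚ g′ → compose f g ≡ₚ compose f g′
  ≡ₚ-composeˡ f {g} {g′} vf vg vg′ (mk≡ₚ w) = mk≡ₚ (W-compose-subP {δ = + 1} f (V⇒W f vf) (V⇒W g vg) (V⇒W g′ vg′) w)

  ≡ₚ-coeff : ∀ {f g} → f ≡ₚ g → ∀ i → V (+ 1) (coeff f i - coeff g i)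
  ≡ₚ-coeff {f} {g} (mk≡ₚ w) i = subst (V (+ 1)) (coeff-subP f g i) (W⇒V (subP f g) w i)

  coeff⇒≡ₚ : ∀ f g → (∀ i → V (+ 1) (coeff f i - coeff g i)) → f ≡ₚ g
  coeff⇒≡ₚ f g v = mk≡ₚ (V⇒W (subP f g) λ i → subst (V (+ 1)) (sym (coeff-subP f g i)) (v i))

  integral-const : ∀ {c} → V (+ 0) c → Integral (c ∷ [])
  integral-const v zero    = v
  integral-const v (suc i) = L-0

  integral-mono : ∀ {c} k → V (+ 0) c → Integral (mono c k)
  integral-mono zero    v = integral-const v
  integral-mono (suc k) v zero    = L-0
  integral-mono (suc k) v (suc i) = integral-mono k v i

  integral-addP : ∀ f g → Integral f → Integral g → Integral (addP f g)
  integral-addP f g vf vg i = subst (V (+ 0)) (sym (coeff-addP f g i)) (L-+ (vf i) (vg i))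

  ≡ₚ-eval : ∀ {f g x} → f ≡ₚ g → V (+ 0) x → V (+ 1) (eval f x - eval g x)
  ≡ₚ-eval {f} {g} {x} e v = subst₂ (λ y z → V (+ 1) (y - z)) (coeff₀-compose f (x ∷ [])) (coeff₀-compose g (x ∷ []))
    (≡ₚ-coeff (≡ₚ-composeʳ (x ∷ []) e (integral-const v)) 0)

  V0-pow : ∀ {x} n → V (+ 0) x → V (+ 0) (powQ x n)
  V0-pow {x} n v = subst (λ k → V k (powQ x n)) (ℤP.*-zeroʳ (+ n)) (L-pow n v)

  frobenius-p : ∀ {c} → V (+ 0) c → compose (mono 1ℚ p) (xPlus c) ≡ₚ addP (mono 1ℚ p) (powQ c p ∷ [])
  frobenius-p {c} vc = coeff⇒≡ₚ _ _ λ i → subst₂ (λ y z → V (+ 1) (y - z)) (sym (coeff-binomial 1ℚ c p i))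
      (sym (coeff-addP (mono 1ℚ p) (powQ c p ∷ []) i)) (go i)
    where
    0≢p : 0 ≢ p
    0≢p e = ℕP.<⇒≢ (ℕP.<-trans (s≤s z≤n) p>1) e
    go : ∀ i → V (+ 1) (1ℚ * ι (p C i) * powQ c (p ℕ.∸ i) - (coeff (mono 1ℚ p) i + coeff (powQ c p ∷ []) i))
    go zero rewrite nC0≡1 p | coeff-mono-≢ 1ℚ p 0 0≢p = subst (V (+ 1)) (sym (lem (powQ c p))) L-0
      where
      lem : ∀ (x : ℚ) → 1ℚ * (1ℚ + 0ℚ) * x - (0ℚ + x) ≡ 0ℚ
      lem = solve-∀ ℚ-ring
    go i@(suc _) with ℕP.<-cmp i p
    ... | tri< i<p i≢p _ rewrite coeff-mono-≢ 1ℚ p i i≢p = subst (V (+ 1)) (lem (ι (p C i)) (powQ c (p ℕ.∸ i)))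
            (L-* (V1-ι (prime-∣-C i (s≤s z≤n) i<p)) (V0-pow (p ℕ.∸ i) vc))
      where
      lem : ∀ (x y : ℚ) → x * y ≡ 1ℚ * x * y - (0ℚ + 0ℚ)
      lem = solve-∀ ℚ-ring
    ... | tri≈ _ refl _ rewrite nCn≡1 i | ℕP.n∸n≡0 i | coeff-mono 1ℚ i = L-0
    ... | tri> _ i≢p p<i rewrite coeff-mono-≢ 1ℚ p i i≢p | k>n⇒nCk≡0 p<i = subst (V (+ 1)) (sym (lem (powQ c (p ℕ.∸ i)))) L-0
      where
      lem : ∀ (x : ℚ) → 1ℚ * 0ℚ * x - (0ℚ + 0ℚ) ≡ 0ℚ
      lem = solve-∀ ℚ-ring

  -- With q = p^m, (x + c)^(p q) ≡ (x^q + c^q)^p by induction; then `frobenius-p` is used with c^q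
  -- in place of c, and x^q is substituted.
  frobenius : ∀ {c} → V (+ 0) c → ∀ m → compose (mono 1ℚ (p ^ m)) (xPlus c) ≡ₚ addP (mono 1ℚ (p ^ m)) (powQ c (p ^ m) ∷ [])
  frobenius {c} vc zero = ≈⇒≡ₚ (≈-trans (compose-identityˡ (xPlus c))
    (∷-cong (sym (trans (ℚP.+-identityˡ (c * 1ℚ)) (ℚP.*-identityʳ c))) ≈-refl))
  frobenius {c} vc (suc m) =
    ≡ₚ-trans (≈⇒≡ₚ (≈-trans (compose-congʳ (xPlus c) (≈-sym split)) (compose-assoc (mono 1ℚ p) (mono 1ℚ q) (xPlus c))))
    (≡ₚ-trans (≡ₚ-composeˡ (mono 1ℚ p) (integral-mono p L-1) (integral-compose (mono 1ℚ q) (xPlus c) (integral-mono q L-1) (integral-xPlus vc))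
        (integral-addP (mono 1ℚ q) (e ∷ []) (integral-mono q L-1) (integral-const ve)) (frobenius vc m))
    (≡ₚ-trans (≈⇒≡ₚ (≈-trans (compose-congˡ (mono 1ℚ p) (≈-trans (addP-comm (mono 1ℚ q) (e ∷ [])) (≈-sym (compose-xPlus e (mono 1ℚ q)))))
        (≈-sym (compose-assoc (mono 1ℚ p) (xPlus e) (mono 1ℚ q)))))
    (≡ₚ-trans (≡ₚ-composeʳ (mono 1ℚ q) (frobenius-p ve) (integral-mono q L-1))
    (≈⇒≡ₚ (≈-trans (compose-addP (mono 1ℚ p) (powQ e p ∷ []) (mono 1ℚ q))
      (addP-cong split (≈-trans (compose-const (powQ e p) (mono 1ℚ q)) (∷-cong (powQ-powQ c q p) ≈-refl))))))))
    where
    q = p ^ m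
    e = powQ c q
    ve = V0-pow q vc
    split : compose (mono 1ℚ p) (mono 1ℚ q) ≈ mono 1ℚ (p ℕ.* q)
    split = subst (λ z → compose (mono 1ℚ p) (mono 1ℚ q) ≈ mono z (p ℕ.* q)) (trans (ℚP.*-identityˡ (powQ 1ℚ p)) (powQ-1 p)) (compose-mono 1ℚ p 1ℚ q)

  freshman : ∀ {x y} → V (+ 0) x → V (+ 0) y → V (+ 1) (powQ (x + y) p - (powQ x p + powQ y p))
  freshman {x} {y} vx vy = subst₂ (λ u v → V (+ 1) (u - v))
    (trans (eval-compose (mono 1ℚ p) (xPlus y) x) (trans (cong (eval (mono 1ℚ p)) (eval-xPlus y x)) (trans (eval-mono 1ℚ p (x + y)) (ℚP.*-identityˡ (powQ (x + y) p)))))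
    (trans (eval-addP (mono 1ℚ p) (powQ y p ∷ []) x) (cong₂ _+_ (trans (eval-mono 1ℚ p x) (ℚP.*-identityˡ (powQ x p))) (eval-const (powQ y p) x)))
    (≡ₚ-eval (frobenius-p vy) vx)

  powQ-0 : ∀ n → 1 ≤ n → powQ 0ℚ n ≡ 0ℚ
  powQ-0 (suc n) _ = ℚP.*-zeroˡ (powQ 0ℚ n)

  fermat-ι : ∀ n → V (+ 1) (powQ (ι n) p - ι n)
  fermat-ι zero    = subst (λ z → V (+ 1) (z - 0ℚ)) (sym (powQ-0 p (ℕP.<⇒≤ p>1))) L-0
  fermat-ι (suc n) = subst (V (+ 1))
    (trans (lem (powQ (1ℚ + ι n) p) (powQ 1ℚ p) (powQ (ι n) p) (ι n)) (cong (λ z → powQ (1ℚ + ι n) p - (z + ι n)) (powQ-1 p)))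
    (L-+ (freshman L-1 (V0-ι n)) (fermat-ι n))
    where
    lem : ∀ (a b c d : ℚ) → (a - (b + c)) + (c - d) ≡ a - (b + d)
    lem = solve-∀ ℚ-ring

  -- The additivity of p-th powers applied to n + (- n) = 0 avoids the sign (-1)^p and a separate
  -- treatment of p = 2.
  fermat-neg-ι : ∀ n → V (+ 1) (powQ (- ι n) p - (- ι n))
  fermat-neg-ι n = subst (V (+ 1)) (lem (powQ (ι n) p) (powQ (- ι n) p) (ι n))
    (L-- (L-neg (subst (λ z → V (+ 1) (z - (powQ (ι n) p + powQ (- ι n) p)))
           (trans (cong (λ z → powQ z p) (ℚP.+-inverseʳ (ι n))) (powQ-0 p (ℕP.<⇒≤ p>1))) (freshman (V0-ι n) (L-neg (V0-ι n)))))
         (fermat-ι n))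
    where
    lem : ∀ (a b c : ℚ) → - (0ℚ - (a + b)) - (a - c) ≡ b - (- c)
    lem = solve-∀ ℚ-ring

  -- The denominator D of x is a unit and x D is an integer up to sign. From D^p x^p ≡ x D and D^p ≡
  -- D follows D (x^p - x) ≡ 0, and D cancels.
  fermat : ∀ {x} → V (+ 0) x → V (+ 1) (powQ x p - x)
  fermat {x} vx = L-cancel-U (V0⇒U-denominator vx)
    (subst (V (+ 1)) (lem D (powQ D p) X x) (L-+ denominator (subst (λ w → V (+ 1) (w - x * D)) z^p numerator)))
    where
    D = ι (ℚ.↧ₙ x)
    X = powQ x p
    z^p : powQ (x * D) p ≡ powQ D p * X
    z^p = trans (cong (λ w → powQ w p) (ℚP.*-comm x D)) (powQ-* D x p)
    numerator : V (+ 1) (powQ (x * D) p - x * D)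
    numerator with ι-denominator x
    ... | inj₁ e = subst (λ w → V (+ 1) (powQ w p - w)) (sym e) (fermat-ι ℤ.∣ ℚ.↥ x ∣)
    ... | inj₂ e = subst (λ w → V (+ 1) (powQ w p - w)) (sym e) (fermat-neg-ι ℤ.∣ ℚ.↥ x ∣)
    denominator : V (+ 1) (- (powQ D p - D) * X)
    denominator = L-* (L-neg (fermat-ι (ℚ.↧ₙ x))) (V0-pow p vx)
    lem : ∀ (D E X x : ℚ) → - (E - D) * X + (E * X - x * D) ≡ D * (X - x)
    lem = solve-∀ ℚ-ring

-- Geometric sums 1 + a + ... + a^(n-1) and the orbit of 0 modulo p

geometric : ℚ → ℕ → ℚ
geometric a zero    = 0ℚ
geometric a (suc n) = 1ℚ + a * geometric a n

[a-1]*geometric : ∀ a n → (a - 1ℚ) * geometric a n ≡ powQ a n - 1ℚ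
[a-1]*geometric a zero    = ℚP.*-zeroʳ (a - 1ℚ)
[a-1]*geometric a (suc n) = trans (lem₁ a (geometric a n)) (trans (cong (λ z → (a - 1ℚ) + a * z) ([a-1]*geometric a n)) (lem₂ a (powQ a n)))
  where
  lem₁ : ∀ (a s : ℚ) → (a - 1ℚ) * (1ℚ + a * s) ≡ (a - 1ℚ) + a * ((a - 1ℚ) * s)
  lem₁ = solve-∀ ℚ-ring
  lem₂ : ∀ (a x : ℚ) → (a - 1ℚ) + a * (x - 1ℚ) ≡ a * x - 1ℚ
  lem₂ = solve-∀ ℚ-ring

module Iteration (p : ℕ) (p-prime : Prime p) where
  open Valuation p p-prime
  open Filtration p p-prime
  open Integrality p p-prime
  open Reduction p p-prime
  open Frobenius p p-prime

  V-resp : ∀ {k} x y → V k (x - y) → V k y → V k x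
  V-resp {k} x y vxy vy = subst (V k) (lem x y) (L-+ vxy vy)
    where
    lem : ∀ (x y : ℚ) → (x - y) + y ≡ x
    lem = solve-∀ ℚ-ring

  V-resp′ : ∀ {k} x y → V k (x - y) → V k x → V k y
  V-resp′ {k} x y vxy vx = subst (V k) (x-[x-y]≡y x y) (L-- vx vxy)

  V-geometric : ∀ {a} → V (+ 0) a → ∀ n → V (+ 0) (geometric a n)
  V-geometric va zero    = L-0
  V-geometric va (suc n) = L-+ L-1 (L-* va (V-geometric va n))

  geometric-ι : ∀ {a} → V (+ 0) a → V (+ 1) (a - 1ℚ) → ∀ n → V (+ 1) (geometric a n - ι n)
  geometric-ι va v1 zero = L-0
  geometric-ι {a} va v1 (suc n) = subst (V (+ 1)) (lem a (geometric a n) (ι n))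
    (L-+ (L-* v1 (V-geometric va n)) (geometric-ι va v1 n))
    where
    lem : ∀ (a s i : ℚ) → (a - 1ℚ) * s + (s - i) ≡ (1ℚ + a * s) - (1ℚ + i)
    lem = solve-∀ ℚ-ring

  -- The time at which 0 first returns to itself under x ↦ a x + b modulo p. For a unit b it depends
  -- on a alone.
  FirstReturn : ℚ → ℕ → Set
  FirstReturn a n = 1 < n × V (+ 1) (geometric a n) × (∀ m → 1 ≤ m → m < n → ¬ V (+ 1) (geometric a m))

  return-time-one : ∀ {a} → V (+ 0) a → V (+ 1) (a - 1ℚ) → FirstReturn a p
  return-time-one {a} va v1 = p>1 , V-resp (geometric a p) (ι p) (geometric-ι va v1 p) V1-ι-p , minimal
    where
    minimal : ∀ m → 1 ≤ m → m < p → ¬ V (+ 1) (geometric a m)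
    minimal (suc m) _ m<p v = ℕP.<⇒≱ m<p (∣P.∣⇒≤ (V1-ι⁻¹ {suc m} (V-resp′ (geometric a (suc m)) (ι (suc m)) (geometric-ι va v1 (suc m)) v)))

  -- (a - 1) times the sum is a^n - 1, and a - 1 is invertible modulo p. For a ≡ 1 this fails, the
  -- sum is congruent to n instead, and the return time is p rather than an order.
  geometric⇔powQ : ∀ a → U (a - 1ℚ) → ∀ n →
    (V (+ 1) (geometric a n) → V (+ 1) (powQ a n - 1ℚ)) × (V (+ 1) (powQ a n - 1ℚ) → V (+ 1) (geometric a n))
  geometric⇔powQ a u n = (λ v → subst (V (+ 1)) ([a-1]*geometric a n) (L-* (U⇒L u) v)) ,
    λ v → L-cancel-U u (subst (V (+ 1)) (sym ([a-1]*geometric a n)) v)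

  -- Fermat with one factor a cancelled, so `suc k` is p - 1. It bounds the search for the order.
  powQ-pred-p : ∀ {a} → U a → ∃ λ k → V (+ 1) (powQ a (suc k) - 1ℚ)
  powQ-pred-p {a} ua = go p p>1 refl
    where
    lem : ∀ (a x : ℚ) → a * x - a ≡ a * (x - 1ℚ)
    lem = solve-∀ ℚ-ring
    go : ∀ q → 1 < q → q ≡ p → ∃ λ k → V (+ 1) (powQ a (suc k) - 1ℚ)
    go (suc zero) (s≤s ()) e
    go (suc (suc k)) _ e = k , L-cancel-U ua (subst (V (+ 1)) (lem a (powQ a (suc k)))
      (subst (λ z → V (+ 1) (powQ a z - a)) (sym e) (fermat (U⇒L ua))))

  return-time-ord : ∀ {a} → U a → U (a - 1ℚ) → ∃ λ n → FirstReturn a n × IsOrd p a n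
  return-time-ord {a} ua u =
    let k , vk = powQ-pred-p ua
    in go (least (λ i → V (+ 1) (geometric a (suc i))) (λ i → V? (+ 1) (geometric a (suc i))) k (proj₂ (geometric⇔powQ a u (suc k)) vk))
    where
    lem : ∀ (a : ℚ) → 1ℚ + a * 0ℚ ≡ 1ℚ
    lem = solve-∀ ℚ-ring
    go : ∀ {k} → (∃ λ j → j ≤ k × V (+ 1) (geometric a (suc j)) × (∀ i → i < j → ¬ V (+ 1) (geometric a (suc i)))) →
      ∃ λ n → FirstReturn a n × IsOrd p a n
    -- The sum of length one is 1, a unit, so the first return cannot happen at time 1.
    go (zero  , _ , v , _)     = contradiction (subst (V (+ 1)) (lem a) v) (U⇒¬V1 U-1)
    go (suc j , _ , v , below) = suc (suc j) , (s≤s (s≤s z≤n) , v , minimal) ,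
      s≤s z≤n , V⇒ValAtLeast {q = powQ a (suc (suc j)) - 1ℚ} (proj₁ (geometric⇔powQ a u (suc (suc j))) v) ,
      λ i 1≤i i<n c → minimal i 1≤i i<n (proj₂ (geometric⇔powQ a u i) (ValAtLeast⇒V {q = powQ a i - 1ℚ} c))
      where
      minimal : ∀ m → 1 ≤ m → m < suc (suc j) → ¬ V (+ 1) (geometric a m)
      minimal (suc m) _ (s≤s m<j) = below m m<j

  return-time : ∀ {a} → U a → ∃ λ n → FirstReturn a n × (CongMod p a 1ℚ → n ≡ p) × (¬ CongMod p a 1ℚ → IsOrd p a n)
  return-time {a} ua = go (V? (+ 1) (a - 1ℚ))
    where
    go : Dec (V (+ 1) (a - 1ℚ)) → ∃ λ n → FirstReturn a n × (CongMod p a 1ℚ → n ≡ p) × (¬ CongMod p a 1ℚ → IsOrd p a n)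
    go (yes v1) = p , return-time-one (U⇒L ua) v1 , (λ _ → refl) , λ ¬c → contradiction (V⇒ValAtLeast {q = a - 1ℚ} v1) ¬c
    go (no ¬v1) =
      let n , rt , ord = return-time-ord ua (¬V1⇒U (L-- (U⇒L ua) L-1) ¬v1)
      in n , rt , (λ c → contradiction (ValAtLeast⇒V {q = a - 1ℚ} c) ¬v1) , λ _ → ord

  fermat-pow : ∀ {x} → V (+ 0) x → ∀ m → V (+ 1) (powQ x (p ^ m) - x)
  fermat-pow {x} vx zero    = subst (V (+ 1)) (lem x) L-0
    where
    lem : ∀ (x : ℚ) → 0ℚ ≡ x * 1ℚ - x
    lem = solve-∀ ℚ-ring
  fermat-pow {x} vx (suc m) = subst (λ z → V (+ 1) (z - x)) (powQ-powQ x (p ^ m) p)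
    (subst (V (+ 1)) (lem (powQ (powQ x (p ^ m)) p) (powQ x (p ^ m)) x) (L-+ (fermat (V0-pow (p ^ m) vx)) (fermat-pow vx m)))
    where
    lem : ∀ (a b c : ℚ) → (a - b) + (b - c) ≡ a - c
    lem = solve-∀ ℚ-ring

  frobenius-mono : ∀ {a c} → V (+ 0) a → V (+ 0) c → ∀ m →
    compose (mono a (p ^ m)) (xPlus c) ≡ₚ addP (mono a (p ^ m)) (a * powQ c (p ^ m) ∷ [])
  frobenius-mono {a} {c} va vc m = mk≡ₚ (W-≈ scaled (W-scaleP va (divides-difference (frobenius vc m))))
    where
    q = p ^ m
    X = compose (mono 1ℚ q) (xPlus c)
    mono≈ : scaleP a (mono 1ℚ q) ≈ mono a q
    mono≈ = subst (λ z → scaleP a (mono 1ℚ q) ≈ mono z q) (ℚP.*-identityʳ a) (scaleP-mono a 1ℚ q)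
    scaled : scaleP a (subP X (addP (mono 1ℚ q) (powQ c q ∷ []))) ≈ subP (compose (mono a q) (xPlus c)) (addP (mono a q) (a * powQ c q ∷ []))
    scaled = begin
      scaleP a (subP X Y)                     ≈⟨ scaleP-addP a X (negP Y) ⟩
      addP (scaleP a X) (scaleP a (negP Y))   ≈⟨ addP-congˡ (scaleP a X) (≈-trans (≈-sym (scaleP-* a (- 1ℚ) Y))
                                                   (≈-trans (scaleP-≡ Y (ℚP.*-comm a (- 1ℚ))) (scaleP-* (- 1ℚ) a Y))) ⟩
      subP (scaleP a X) (scaleP a Y)          ≈⟨ addP-cong (≈-trans (≈-sym (compose-scaleP a (mono 1ℚ q) (xPlus c))) (compose-congʳ (xPlus c) mono≈))
                                                   (scaleP-cong (- 1ℚ) (≈-trans (scaleP-addP a (mono 1ℚ q) (powQ c q ∷ [])) (addP-cong mono≈ ≈-refl))) ⟩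
      subP (compose (mono a q) (xPlus c)) (addP (mono a q) (a * powQ c q ∷ [])) ∎
      where
      open ≈-Reasoning
      Y = addP (mono 1ℚ q) (powQ c q ∷ [])
      scaleP-≡ : ∀ {x y} f → x ≡ y → scaleP x f ≈ scaleP y f
      scaleP-≡ f refl = ≈-refl

  Low : ℕ → Poly → Set
  Low d f = ∀ i → 1 ≤ i → i < d → V (+ 1) (coeff f i)

  low⇒≡ₚ : ∀ {d} f → 1 ≤ d → DegreeAtMost d f → Low d f → f ≡ₚ addP (mono (coeff f d) d) (coeff f 0 ∷ [])
  low⇒≡ₚ {d} f 1≤d df low = coeff⇒≡ₚ _ _ λ i → subst (λ z → V (+ 1) (coeff f i - z)) (sym (coeff-addP (mono (coeff f d) d) (coeff f 0 ∷ []) i)) (go i)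
    where
    go : ∀ i → V (+ 1) (coeff f i - (coeff (mono (coeff f d) d) i + coeff (coeff f 0 ∷ []) i))
    go zero rewrite coeff-mono-≢ (coeff f d) d 0 (ℕP.<⇒≢ 1≤d) = subst (V (+ 1)) (lem (coeff f 0)) L-0
      where
      lem : ∀ (x : ℚ) → 0ℚ ≡ x - (0ℚ + x)
      lem = solve-∀ ℚ-ring
    go i@(suc _) with ℕP.<-cmp i d
    ... | tri≈ _ refl _ rewrite coeff-mono (coeff f i) i = subst (V (+ 1)) (lem (coeff f i)) L-0
      where
      lem : ∀ (x : ℚ) → 0ℚ ≡ x - (x + 0ℚ)
      lem = solve-∀ ℚ-ring
    ... | tri< i<d i≢d _ rewrite coeff-mono-≢ (coeff f d) d i i≢d = subst (V (+ 1)) (lem (coeff f i)) (low i (s≤s z≤n) i<d)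
      where
      lem : ∀ (x : ℚ) → x ≡ x - (0ℚ + 0ℚ)
      lem = solve-∀ ℚ-ring
    ... | tri> _ i≢d d<i rewrite coeff-mono-≢ (coeff f d) d i i≢d | df i d<i = L-0

  ≡ₚ⇒low : ∀ {d a b} f → f ≡ₚ addP (mono a d) (b ∷ []) → Low d f
  ≡ₚ⇒low {d} {a} {b} f e i@(suc _) _ i<d = subst (V (+ 1))
    (trans (cong (λ z → coeff f i - z) (trans (coeff-addP (mono a d) (b ∷ []) i) (cong (_+ 0ℚ) (coeff-mono-≢ a d i (ℕP.<⇒≢ i<d))))) (ℚP.+-identityʳ (coeff f i)))
    (≡ₚ-coeff e i)

  module _ {d} (f : Poly) (1≤d : 1 ≤ d) (vf : Integral f) (df : DegreeAtMost d f) (low : Low d f) where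

    private
      a = coeff f d
      b = coeff f 0

    eval-mod : ∀ {x} → V (+ 0) x → V (+ 1) (eval f x - (a * powQ x d + b))
    eval-mod {x} vx = subst (λ z → V (+ 1) (eval f x - z))
      (trans (eval-addP (mono a d) (b ∷ []) x) (cong₂ _+_ (eval-mono a d x) (eval-const b x)))
      (≡ₚ-eval (low⇒≡ₚ f 1≤d df low) vx)

    module _ {m} (d≡ : d ≡ p ^ m) where

      -- Modulo p, a (A x^t + c)^d + b = a A^d x^(d t) + a c^d + b, because d is a power of p.
      compose-low : ∀ {t} g → 1 ≤ t → Integral g → DegreeAtMost t g → Low t g → Low (d ℕ.* t) (compose f g)
      compose-low {t} g 1≤t vg dg lg = ≡ₚ⇒low (compose f g)
        (≡ₚ-trans (≡ₚ-composeʳ g (low⇒≡ₚ f 1≤d df low) vg)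
        (≡ₚ-trans (≡ₚ-composeˡ f′ vf′ vg vg′ (low⇒≡ₚ g 1≤t dg lg))
        (≡ₚ-trans (≈⇒≡ₚ (≈-trans (compose-addP (mono a d) (b ∷ []) g′) (addP-cong outer (compose-const b g′))))
        (≡ₚ-trans (≡ₚ-addP (≡ₚ-composeʳ (mono A t) frob (integral-mono t (vg t))) (≈⇒≡ₚ ≈-refl))
        (≈⇒≡ₚ (≈-trans (addP-cong (≈-trans (compose-addP (mono a d) (a * powQ c d ∷ []) (mono A t))
              (addP-cong (compose-mono a d A t) (compose-const (a * powQ c d) (mono A t)))) ≈-refl)
            (addP-assoc (mono (a * powQ A d) (d ℕ.* t)) (a * powQ c d ∷ []) (b ∷ []))))))))
        where
        A = coeff g t
        c = coeff g 0
        f′ = addP (mono a d) (b ∷ [])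
        g′ = addP (mono A t) (c ∷ [])
        vf′ : Integral f′
        vf′ = integral-addP (mono a d) (b ∷ []) (integral-mono d (vf d)) (integral-const (vf 0))
        vg′ : Integral g′
        vg′ = integral-addP (mono A t) (c ∷ []) (integral-mono t (vg t)) (integral-const (vg 0))
        outer : compose (mono a d) g′ ≈ compose (compose (mono a d) (xPlus c)) (mono A t)
        outer = ≈-trans (compose-congˡ (mono a d) (≈-trans (addP-comm (mono A t) (c ∷ [])) (≈-sym (compose-xPlus c (mono A t)))))
          (≈-sym (compose-assoc (mono a d) (xPlus c) (mono A t)))
        frob : compose (mono a d) (xPlus c) ≡ₚ addP (mono a d) (a * powQ c d ∷ [])
        frob = subst (λ z → compose (mono a z) (xPlus c) ≡ₚ addP (mono a z) (a * powQ c z ∷ [])) (sym d≡) (frobenius-mono (vf d) (vg 0) m)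

      iter-low : ∀ k → Low (d ^ k) (iter k f)
      iter-low zero    (suc i) _ (s≤s ())
      iter-low (suc k) = compose-low (iter k f) (ℕP.m^n>0 d {{ℕ.>-nonZero 1≤d}} k) (integral-iter f k vf) (iter-degree f 1≤d df k) (iter-low k)

      eval-affine : ∀ {x} → V (+ 0) x → V (+ 1) (eval f x - (a * x + b))
      eval-affine {x} vx = subst (V (+ 1)) (lem (eval f x) a (powQ x d) x b)
        (L-+ (eval-mod vx) (L-* (vf d) (subst (λ z → V (+ 1) (powQ x z - x)) (sym d≡) (fermat-pow vx m))))
        where
        lem : ∀ (e a y x b : ℚ) → (e - (a * y + b)) + a * (y - x) ≡ e - (a * x + b)
        lem = solve-∀ ℚ-ring

      orbit-step : ∀ k → V (+ 1) (coeff (iter (suc k) f) 0 - (a * coeff (iter k f) 0 + b))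
      orbit-step k = subst (λ z → V (+ 1) (z - (a * coeff (iter k f) 0 + b))) (sym (coeff₀-compose f (iter k f))) (eval-affine (integral-iter f k vf 0))

      orbit : ∀ k → V (+ 1) (coeff (iter k f) 0 - b * geometric a k)
      orbit zero    = subst (V (+ 1)) (lem b) L-0
        where
        lem : ∀ (b : ℚ) → 0ℚ ≡ 0ℚ - b * 0ℚ
        lem = solve-∀ ℚ-ring
      orbit (suc k) = subst (V (+ 1)) (lem (coeff (iter (suc k) f) 0) a (coeff (iter k f) 0) b (geometric a k))
        (L-+ (orbit-step k) (L-* (vf d) (orbit k)))
        where
        lem : ∀ (y a x b s : ℚ) → (y - (a * x + b)) + a * (x - b * s) ≡ y - b * (1ℚ + a * s)
        lem = solve-∀ ℚ-ring

  -- The translation c in condition (iii) is an arbitrary rational. If ν(c) < 0, the term a c^d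
  -- would dominate f(c), which is p-integral; each step of the descent removes one factor p from
  -- the denominator of c.
  V0-of-eval : ∀ {d} f → Integral f → DegreeAtMost d f → U (coeff f d) → 1 ≤ d → ∀ c → V (+ 0) (eval f c) → V (+ 0) c
  V0-of-eval {d} f vf df uf 1≤d c ve = let l , v = bounded-below c in descend l v
    where
    a = coeff f d
    step : ∀ l → V (ℤ.- + suc l) c → V (ℤ.- + l) c
    step l v = subst (λ z → V z c) (lem (+ l)) (V-root d uf (subst (V _) (x-[x-y]≡y (eval f c) (a * powQ c d)) (L-- (L-≤ low ve) close)))
      where
      k = ℤ.- + suc l
      lem : ∀ l → (ℤ.- (+ 1 ℤ.+ l)) ℤ.+ + 1 ≡ ℤ.- l
      lem = solveℤ
      low : + d ℤ.* k ℤ.+ + 1 ℤ.≤ + 0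
      low with <⇒∃ 1≤d
      ... | d′ , refl = ≤-by (+ d′ ℤ.+ (+ 1 ℤ.+ + d′) ℤ.* + l) (0≤-+ (0≤pos {d′}) (0≤-* (0≤pos {suc d′}) (0≤pos {l}))) (lem′ (+ d′) (+ l))
        where
        lem′ : ∀ d l → + 0 ≡ ((+ 1 ℤ.+ d) ℤ.* (ℤ.- (+ 1 ℤ.+ l)) ℤ.+ + 1) ℤ.+ (d ℤ.+ (+ 1 ℤ.+ d) ℤ.* l)
        lem′ = solveℤ
      outer : ∀ i → i ≢ d → L 1 ((+ d ℤ.* k ℤ.+ + 1) ℤ.- k ℤ.* + i) (coeff f i)
      outer i i≢d with ℕP.<-cmp i d
      ... | tri≈ _ i≡d _ = contradiction i≡d i≢d
      ... | tri> _ _ d<i = subst (L 1 _) (sym (df i d<i)) L-0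
      ... | tri< i<d _ _ with <⇒∃ i<d
      ...   | e , refl = L-≤ (≤-by (+ e ℤ.+ (+ 1 ℤ.+ + e) ℤ.* + l) (0≤-+ (0≤pos {e}) (0≤-* (0≤pos {suc e}) (0≤pos {l}))) (lem′ (+ i) (+ e) (+ l))) (vf i)
        where
        lem′ : ∀ i e l → + 0 ≡ (((i ℤ.+ (+ 1 ℤ.+ e)) ℤ.* (ℤ.- (+ 1 ℤ.+ l)) ℤ.+ + 1) ℤ.- (ℤ.- (+ 1 ℤ.+ l)) ℤ.* i) ℤ.+ (e ℤ.+ (+ 1 ℤ.+ e) ℤ.* l)
        lem′ = solveℤ
      mono-f : W 1 k (+ d ℤ.* k) (mono a d)
      mono-f = W-mono d (L-≤ (ℤP.≤-reflexive (lem′ (+ d) k)) (U⇒L uf))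
        where
        lem′ : ∀ d k → d ℤ.* k ℤ.- k ℤ.* d ≡ + 0
        lem′ = solveℤ
      -- The constant polynomial c is its own monomial of exponent 0, so the initial form of f(c) is
      -- a c^d.
      close : V (+ d ℤ.* k ℤ.+ + 1) (eval f c - a * powQ c d)
      close = subst (V _) (trans (coeff-subP (compose f (c ∷ [])) (mono (a * powQ c d) (d ℕ.* 0)) 0) (cong₂ _-_ (coeff₀-compose f (c ∷ []))
          (cong (λ z → coeff (mono (a * powQ c d) z) 0) (ℕP.*-zeroʳ d))))
        (W-head {s = + 0} (W-compose-initial f (W-subP-mono f d outer) mono-f (W-const v) (W-const v) (W-≈ (≈-sym (subP-self (c ∷ []))) W-[])))
    descend : ∀ l → V (ℤ.- + l) c → V (+ 0) c
    descend zero    v = v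
    descend (suc l) v = descend l (step l v)

compose-xPlus-xPlus : ∀ f c e → compose (compose f (xPlus c)) (xPlus e) ≈ compose f (xPlus (c + e))
compose-xPlus-xPlus f c e = ≈-trans (compose-assoc f (xPlus c) (xPlus e)) (compose-congˡ f (compose-xPlus c (xPlus e)))

-- The two implications and the least exponent

module Main (p : ℕ) (p-prime : Prime p) (r : ℕ) (1≤r : 1 ≤ r) where
  open Valuation p p-prime
  open Filtration p p-prime
  open Integrality p p-prime
  open Reduction p p-prime
  open Purity p p-prime r
  open Frobenius p p-prime
  open Iteration p p-prime

  ν≡r⇒V1 : ∀ {q} → ν p q ≡ fin (+ r) → V (+ 1) q
  ν≡r⇒V1 e = L-ν e (subst (+ 1 ℤ.≤_) (sym (ℤP.*-identityˡ (+ r))) (ℤ.+≤+ 1≤r))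

  module _ {d} (f : Poly) (hd : HasDegree f d) (r<d : r < d) where

    private
      a = coeff f d
      b = coeff f 0
      df : DegreeAtMost d f
      df = proj₂ hd
      2≤d : 2 ≤ d
      2≤d = ℕP.≤-trans (s≤s 1≤r) r<d
      1≤d : 1 ≤ d
      1≤d = ℕP.<⇒≤ 2≤d
      1≤d^ : ∀ k → 1 ≤ d ^ k
      1≤d^ k = ℕP.m^n>0 d {{ℕ.>-nonZero 1≤d}} k

    U-iter-lead : U a → ∀ k → U (coeff (iter k f) (d ^ k))
    U-iter-lead ua k = subst U (sym (iter-lead f 1≤d df k)) (U-pow (lead-exponent d k) ua)

    integral-low : Low d f → U a → U b → Integral f
    integral-low low ua ub zero = U⇒L ub
    integral-low low ua ub i@(suc _) with ℕP.<-cmp i d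
    ... | tri< i<d _ _ = V1⇒V0 (low i (s≤s z≤n) i<d)
    ... | tri≈ _ refl _ = U⇒L ua
    ... | tri> _ _ d<i = subst (V (+ 0)) (sym (df i d<i)) L-0

    module Backward {m} (d≡ : d ≡ p ^ m) (ua : U a) (ub : U b) (low : Low d f)
      {c} (pure-c : PureAt d (compose f (xPlus c))) where

      private
        vf : Integral f
        vf = integral-low low ua ub
        ν-eval : ν p (eval f c) ≡ fin (+ r)
        ν-eval = trans (cong (ν p) (sym (coeff₀-compose f (xPlus c)))) (constant pure-c)
        vc : V (+ 0) c
        vc = V0-of-eval f vf df ua 1≤d c (V1⇒V0 (ν≡r⇒V1 ν-eval))
        c-root : V (+ 1) (a * c + b)
        c-root = V-resp′ (eval f c) (a * c + b) (eval-affine f 1≤d vf df low {m} d≡ vc) (ν≡r⇒V1 ν-eval)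

      pure⇒geometric : ∀ k → Pure p r (iter k f) → V (+ 1) (geometric a k)
      pure⇒geometric k (_ , _ , _ , ν≡r , _) = L-cancel-U ub
        (V-resp′ (coeff (iter k f) 0) (b * geometric a k) (orbit f 1≤d vf df low {m} d≡ k) (ν≡r⇒V1 ν≡r))

      -- Let cₖ = f^k(0). Then f(cₖ) and f(c) are both 0 modulo p and f acts there as x ↦ a x + b
      -- with a unit a, so cₖ ≡ c. Hence f(x + cₖ) is a translate of f(x + c) by a multiple of p and
      -- is pure, and `PureAt-compose⁺` passes to f∘f^k.
      geometric⇒pure : ∀ k → V (+ 1) (geometric a (suc k)) → Pure p r (iter (suc k) f)
      geometric⇒pure k v = PureAt⇒Pure (PureAt-compose⁺ f (iter k f) r<d (1≤d^ k) vf df ua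
        (integral-iter f k vf) (iter-degree f 1≤d df k) (U-iter-lead ua k) (iter-low f 1≤d vf df low {m} d≡ k)
        (PureAt-≈ (subst (λ z → compose (compose f (xPlus c)) (xPlus (cₖ - c)) ≈ compose f (xPlus z)) (lem₁ c cₖ) (compose-xPlus-xPlus f c (cₖ - c)))
          (PureAt-translate r<d pure-c close)))
        where
        cₖ = coeff (iter k f) 0
        lem₁ : ∀ (c x : ℚ) → c + (x - c) ≡ x
        lem₁ = solve-∀ ℚ-ring
        lem₂ : ∀ (a b c x : ℚ) → (a * x + b) - (a * c + b) ≡ a * (x - c)
        lem₂ = solve-∀ ℚ-ring
        next : V (+ 1) (coeff (iter (suc k) f) 0)
        next = V-resp (coeff (iter (suc k) f) 0) (b * geometric a (suc k)) (orbit f 1≤d vf df low {m} d≡ (suc k)) (L-* (U⇒L ub) v)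
        cₖ-root : V (+ 1) (a * cₖ + b)
        cₖ-root = V-resp′ (coeff (iter (suc k) f) 0) (a * cₖ + b) (orbit-step f 1≤d vf df low {m} d≡ k) next
        close : V (+ 1) (cₖ - c)
        close = L-cancel-U ua (subst (V (+ 1)) (lem₂ a b c cₖ) (L-- cₖ-root c-root))

    iter-hasDegree : ∀ k → HasDegree (iter k f) (d ^ k)
    iter-hasDegree k = lead≢0 , iter-degree f 1≤d df k
      where
      lead≢0 : coeff (iter k f) (d ^ k) ≢ 0ℚ
      lead≢0 e with ν p a in eq
      ... | ∞     = proj₁ hd (ν≡∞⇒≡0 a eq)
      ... | fin v = contradiction (trans (sym (ν-pow (lead-exponent d k) eq)) (cong (ν p) (trans (sym (iter-lead f 1≤d df k)) e))) λ ()

    -- The valuation of the leading coefficient of an iterate is a positive multiple of ν(a), so one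
    -- vanishes with the other.
    U-lead : ∀ k → U (coeff (iter (suc k) f) (d ^ suc k)) → U a
    U-lead k (mkU u) with ν p a in eq
    ... | ∞     = contradiction (ν≡∞⇒≡0 a eq) (proj₁ hd)
    ... | fin v = mkU (trans eq (cong fin (ℤP.*-cancelˡ-≡ (+ lead-exponent d (suc k)) v (+ 0)
                    (trans (fin-injective (trans (sym (ν-pow (lead-exponent d (suc k)) eq)) (trans (cong (ν p) (sym (iter-lead f 1≤d df (suc k)))) u)))
                      (sym (ℤP.*-zeroʳ (+ lead-exponent d (suc k))))))))

    module Forward (¬pure : ¬ Pure p r f) (k : ℕ) (pure-n : Pure p r (iter (suc (suc k)) f)) where

      private
        g = iter (suc k) f
        t = d ^ suc k
        1≤t = 1≤d^ (suc k)
        pn : PureAt (d ℕ.* t) (iter (suc (suc k)) f)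
        pn = Pure⇒PureAt (iter-hasDegree (suc (suc k))) pure-n

      ua : U a
      ua = U-lead (suc k) (lead pn)

      vf : Integral f
      vf = integral-of-iterate f 2≤d df ua {suc k} (PureAt-integral 1≤r pn)

      private
        vg : Integral g
        vg = integral-iter f (suc k) vf
        dg : DegreeAtMost t g
        dg = iter-degree f 1≤d df (suc k)
        ug : U (coeff g t)
        ug = U-iter-lead ua (suc k)
        -- The pure iterate read as g∘f: it gives f ≡ a x^d + b, and also that g(x + b) has only its
        -- leading term modulo p.
        inner-f = compose≡monomial f g 1≤d 1≤t vf vg dg ua ug λ i i<td →
          subst (V (+ 1)) (at (iter-sucʳ (suc k) f) i) (PureAt-low 1≤r pn i (subst (i <_) (ℕP.*-comm t d) i<td))
        -- The same iterate read as f∘g, which gives the shape of g required by `PureAt-compose⁻`.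
        inner-g = compose≡monomial g f 1≤t 1≤d vg vf df ug ua (PureAt-low 1≤r pn)

      low : Low d f
      low = proj₁ inner-f

      c = coeff g 0

      pure-c : PureAt d (compose f (xPlus c))
      pure-c = PureAt-compose⁻ f g r<d 1≤t vf df ua vg dg ug (proj₁ inner-g) pn

      iter₀-low : V (+ 1) b → ∀ j → V (+ 1) (coeff (iter j f) 0)
      iter₀-low vb zero    = L-0
      iter₀-low vb (suc j) = subst (V (+ 1)) (sym (coeff₀-compose f (iter j f)))
        (V-resp (eval f x) (a * powQ x d + b) (eval-mod f 1≤d vf df low (V1⇒V0 vx)) (L-+ (L-* (U⇒L ua) (pow d 1≤d)) vb))
        where
        x = coeff (iter j f) 0
        vx = iter₀-low vb j
        pow : ∀ n → 1 ≤ n → V (+ 1) (powQ x n)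
        pow (suc n) _ = L-* vx (V0-pow n (V1⇒V0 vx))

      -- If p divided b, the orbit of 0 would stay divisible by p, so c ≡ 0. Translating f(x + c)
      -- back by -c would then preserve purity and make f pure.
      ub : U b
      ub = ¬V1⇒U (vf 0) λ vb → ¬pure (PureAt⇒Pure (PureAt-≈ back (PureAt-translate r<d pure-c (L-neg (iter₀-low vb (suc k))))))
        where
        back : compose (compose f (xPlus c)) (xPlus (- c)) ≈ f
        back = ≈-trans (compose-xPlus-xPlus f c (- c))
          (subst (λ z → compose f (xPlus z) ≈ f) (sym (ℚP.+-inverseʳ c)) (compose-identityʳ f))

      -- Modulo p, f(x + b) ≡ a (x + b)^d + b, with middle coefficients a C(d,i) b^(d-i). They
      -- vanish modulo p while a and b are units, so p divides each C(d,i).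
      d-prime-power : ∃ λ m → 1 ≤ m × d ≡ p ^ m
      d-prime-power = prime-power d 2≤d λ i 1≤i i<d → V1-ι⁻¹ {d C i}
        (L-cancel-U (U-* ua (U-pow (d ℕ.∸ i) ub)) (subst (V (+ 1)) (lem a (ι (d C i)) (powQ b (d ℕ.∸ i))) (binomial i 1≤i i<d)))
        where
        lem : ∀ (a x y : ℚ) → a * x * y ≡ a * y * x
        lem = solve-∀ ℚ-ring
        h = compose f (xPlus b)
        vx : Integral (xPlus b)
        vx = integral-xPlus (vf 0)
        factor : compose (iter k f) h ≈ compose g (xPlus b)
        factor = ≈-trans (≈-sym (compose-assoc (iter k f) f (xPlus b))) (compose-congʳ (xPlus b) (≈-sym (iter-sucʳ k f)))
        -- Here g(x + b) = f^k∘f(x + b), already known to have only its leading term modulo p, is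
        -- decomposed once more. For k = 0 the outer factor is x itself, of degree d^0 = 1.
        inner-h = compose≡monomial h (iter k f) 1≤d (1≤d^ k) (integral-compose f (xPlus b) vf vx) (integral-iter f k vf) (iter-degree f 1≤d df k)
          (subst U (sym (translate-lead f b df)) ua) (U-iter-lead ua k)
          λ i i< → subst (V (+ 1)) (sym (at factor i)) (proj₂ inner-f i (subst (i <_) (ℕP.*-comm (d ^ k) d) i<))
        h≡ : h ≡ₚ addP (compose (mono a d) (xPlus b)) (b ∷ [])
        h≡ = ≡ₚ-trans (≡ₚ-composeʳ (xPlus b) (low⇒≡ₚ f 1≤d df low) vx)
          (≈⇒≡ₚ (≈-trans (compose-addP (mono a d) (b ∷ []) (xPlus b)) (addP-congˡ (compose (mono a d) (xPlus b)) (compose-const b (xPlus b)))))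
        binomial : ∀ i → 1 ≤ i → i < d → V (+ 1) (a * ι (d C i) * powQ b (d ℕ.∸ i))
        binomial (suc i) 1≤i i<d = subst (V (+ 1))
          (trans (coeff-addP (compose (mono a d) (xPlus b)) (b ∷ []) (suc i)) (trans (ℚP.+-identityʳ _) (coeff-binomial a b d (suc i))))
          (V-resp′ (coeff h (suc i)) _ (≡ₚ-coeff h≡ (suc i)) (proj₁ inner-h (suc i) 1≤i i<d))

Conditions : ℕ → ℕ → ℕ → Poly → Set
Conditions p r d f =
  (Σ ℕ λ m → (1 ≤ m) × (d ≡ p ^ m))
  × ((ν p (coeff f d) ≡ fin (+ 0)) × (ν p (coeff f 0) ≡ fin (+ 0))
    × (∀ i → 1 ≤ i → i < d → ValAtLeast (ν p (coeff f i)) (+ 1)))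
  × (Σ ℚ λ c → Pure p r (compose f (xPlus c)))

module _ (p r d : ℕ) (f : Poly) (p-prime : Prime p) (1≤r : 1 ≤ r) (hd : HasDegree f d) (r<d : r < d) where
  open Valuation p p-prime
  open Integrality p p-prime
  open Reduction p p-prime
  open Purity p p-prime r
  open Iteration p p-prime
  open Main p p-prime r 1≤r

  eventuallyPure⇒conditions : ¬ Pure p r f → EventuallyPure p r f → Conditions p r d f
  -- `iter 1 f` is the composite of f with x, equal to f only up to `≈`, so purity has to be
  -- transported.
  eventuallyPure⇒conditions ¬pure (suc zero , _ , pure) = contradiction
    (PureAt⇒Pure (PureAt-≈ (compose-identityʳ f) (Pure⇒PureAt (iter-hasDegree f hd r<d 1) pure))) ¬pure
  eventuallyPure⇒conditions ¬pure (suc (suc k) , _ , pure) =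
    d-prime-power , (ν≡0 ua , ν≡0 ub , λ i 1≤i i<d → V⇒ValAtLeast {q = coeff f i} (low i 1≤i i<d)) , c , PureAt⇒Pure pure-c
    where open Forward f hd r<d ¬pure k pure

  translate-hasDegree : ∀ c → HasDegree (compose f (xPlus c)) d
  translate-hasDegree c = (λ e → proj₁ hd (trans (sym (translate-lead f c (proj₂ hd))) e)) , translate-degree f c (proj₂ hd)

  conditions⇒least : Conditions p r d f → Σ ℕ λ n → LeastPureAbove1 p r f n
    × (CongMod p (coeff f d) 1ℚ → n ≡ p) × (¬ CongMod p (coeff f d) 1ℚ → IsOrd p (coeff f d) n)
  conditions⇒least ((m , _ , d≡) , (νa , νb , low) , c , pure-c) = go (return-time (mkU νa))
    where
    open Backward f hd r<d {m} d≡ (mkU νa) (mkU νb) (λ i 1≤i i<d → ValAtLeast⇒V {q = coeff f i} (low i 1≤i i<d))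
      {c} (Pure⇒PureAt (translate-hasDegree c) pure-c)
    go : (∃ λ n → FirstReturn (coeff f d) n × (CongMod p (coeff f d) 1ℚ → n ≡ p) × (¬ CongMod p (coeff f d) 1ℚ → IsOrd p (coeff f d) n)) → _
    go (suc n , (1<n , v , minimal) , n≡p , ord) = suc n ,
      (1<n , geometric⇒pure n v , λ j 1<j j<n pure → minimal j (ℕP.<⇒≤ 1<j) j<n (pure⇒geometric j pure)) , n≡p , ord

theorem5p6 : (p r d : ℕ) (f : Poly) → Prime p → 1 ≤ r → HasDegree f d
    → ¬ Pure p r f → r < d
    → (EventuallyPure p r f
    → (Σ ℕ λ m → (1 ≤ m) × (d ≡ p ^ m))
    × ((ν p (coeff f d) ≡ fin (+ 0)) × (ν p (coeff f 0) ≡ fin (+ 0))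
    × (∀ i → 1 ≤ i → i < d → ValAtLeast (ν p (coeff f i)) (+ 1)))
    × (Σ ℚ λ c → Pure p r (compose f (xPlus c))))
    × ((Σ ℕ λ m → (1 ≤ m) × (d ≡ p ^ m))
    × ((ν p (coeff f d) ≡ fin (+ 0)) × (ν p (coeff f 0) ≡ fin (+ 0))
    × (∀ i → 1 ≤ i → i < d → ValAtLeast (ν p (coeff f i)) (+ 1)))
    × (Σ ℚ λ c → Pure p r (compose f (xPlus c)))
    → EventuallyPure p r f)
    × (EventuallyPure p r f
    → Σ ℕ λ n → LeastPureAbove1 p r f n
    × (CongMod p (coeff f d) 1ℚ → n ≡ p)
    × (¬ CongMod p (coeff f d) 1ℚ → IsOrd p (coeff f d) n))
theorem5p6 p r d f p-prime 1≤r hd ¬pure r<d =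
  forward , (λ conditions → let n , (1<n , pure , _) , _ = least-pure conditions in n , ℕP.<⇒≤ 1<n , pure) ,
  λ eventually → least-pure (forward eventually)
  where
  forward = eventuallyPure⇒conditions p r d f p-prime 1≤r hd r<d ¬pure
  least-pure = conditions⇒least p r d f p-prime 1≤r hd r<d
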